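{- Let $\mathbb{A}$ be a symmetric strict monoidal category, let $\mathsf{T}(\mathbb{A})$ be the spatial strict monoidal category presented by the generators and equations given in the context, let $\mathbf{H}\,\mathcal{C}(\mathbb{A})$ be the strict monoidal category of horizontal cells of the free cornering of $\mathbb{A}$, and let $M:\mathsf{T}(\mathbb{A})\to\mathbf{H}\,\mathcal{C}(\mathbb{A})$ be the strict monoidal functor given in the context. Then $M$ is full, faithful, and identity-on-objects.
   Context: Single-object double categories. A single-object double category $\mathbb{D}$ consists of a monoid $(\mathbb{D}_H,\otimes,I)$ of horizontal edges, a monoid $(\mathbb{D}_V,\otimes,I)$ of vertical edges, and cells $\alpha$, each with a top and a bottom boundary in $\mathbb{D}_H$ and a left and a right boundary in $\mathbb{D}_V$. If the right boundary of $\alpha$ equals the left boundary of $\beta$ there is a horizontal composite $\alpha\vert\beta$ (top/bottom boundaries are multiplied in the order $\alpha,\beta$; left boundary that of $\alpha$, right boundary that of $\beta$). If the bottom boundary of $\alpha$ equals the top boundary of $\beta$ there is a vertical composite $\frac{\alpha}{\beta}$ (left/right boundaries multiplied in the order $\alpha,\beta$; top that of $\alpha$, bottom that of $\beta$). Both compositions are associative and unital, with identity cells $1_A$ for $A\in\mathbb{D}_H$ (top $=$ bottom $=A$, left $=$ right $=I$; identities for vertical composition) and $1_X$ for $X\in\mathbb{D}_V$ (left $=$ right $=X$, top $=$ bottom $=I$; identities for horizontal composition), with $1_A\vert 1_B=1_{A\otimes B}$, $\frac{1_X}{1_Y}=1_{X\otimes Y}$, the two identity cells on $I$ coincide, and the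 interchange law $\frac{\alpha}{\beta}\big\vert\frac{\gamma}{\delta}=\frac{\alpha\vert\gamma}{\beta\vert\delta}$ holds. Horizontal cells. $\mathbf{H}\mathbb{D}$ is the strict monoidal category with object set $\mathbb{D}_V$, whose morphisms $X\to Y$ are cells with left boundary $X$, right boundary $Y$ and top and bottom boundary $I$; composition is horizontal composition, and the tensor product is vertical composition, $h\otimes k=\frac{h}{k}$. Free cornering. For a symmetric strict monoidal category $\mathbb{A}$ (with object set $\mathbb{A}_0$ and braiding $\sigma_{A,B}:A\otimes B\to B\otimes A$), $\mathcal{C}(\mathbb{A})$ is the free single-object double category determined by: horizontal edge monoid $(\mathbb{A}_0,\otimes,I)$; vertical edge monoid the free monoid $\mathbb{A}^{\circ\bullet}=(\mathbb{A}_0\times\{\circ,\bullet\})^*$, with generators written $A^\circ$, $A^\bullet$, product written $\otimes$ and unit $I$; generating cells, for each $A\in\mathbb{A}_0$, the corners (boundaries not mentioned are $I$) - $s^\circ_A$: top $A$, right $A^\circ$; $\quad r^\circ_A$: left $A^\circ$, bottom $A$; - $s^\bullet_A$: top $A$, left $A^\bullet$; $\quad r^\bullet_A$: right $A^\bullet$, bottom $A$; and, for each morphism $f:A\to B$ of $\mathbb{A}$, a cell $\ulcorner f\urcorner$ with top $A$, bottom $B$; subject to the yanking equations $s^\circ_A\vert r^\circ_A=1_A$, $\frac{r^\circ_A}{s^\circ_A}=1_{A^\circ}$, $r^\bullet_A\vert s^\bullet_A=1_A$, $\frac{r^\bullet_A}{s^\bullet_A}=1_{A^\bullet}$, and the equations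 $\frac{\ulcorner f\urcorner}{\ulcorner g\urcorner}=\ulcorner f;g\urcorner$ (for composable $f,g$; $f;g$ is "first $f$ then $g$"), $\ulcorner 1_A\urcorner=1_A$, $\ulcorner f\urcorner\vert\ulcorner g\urcorner=\ulcorner f\otimes g\urcorner$. The category $\mathsf{T}(\mathbb{A})$. A strict monoidal category is spatial if $h\otimes 1_X=1_X\otimes h$ for every object $X$ and $h:I\to I$. $\mathsf{T}(\mathbb{A})$ is the free spatial strict monoidal category with generating objects $A^\circ,A^\bullet$ for $A\in\mathbb{A}_0$, and generating morphisms, for all $A,B\in\mathbb{A}_0$ and $f:A\to B$ in $\mathbb{A}$: $f^\circ:A^\circ\to B^\circ$; $f^\bullet:B^\bullet\to A^\bullet$; $\triangleleft_{A,B}:(A\otimes B)^\circ\to A^\circ\otimes B^\circ$; $\triangleright_{A,B}:A^\circ\otimes B^\circ\to(A\otimes B)^\circ$; $\blacktriangleleft_{A,B}:(A\otimes B)^\bullet\to A^\bullet\otimes B^\bullet$; $\blacktriangleright_{A,B}:A^\bullet\otimes B^\bullet\to(A\otimes B)^\bullet$; $\iota^\circ:I\to I^\circ$; $\kappa^\circ:I^\circ\to I$; $\iota^\bullet:I\to I^\bullet$; $\kappa^\bullet:I^\bullet\to I$; $\sigma^\circ_{A,B}:A^\circ\otimes B^\circ\to B^\circ\otimes A^\circ$; $\sigma^\bullet_{A,B}:A^\bullet\otimes B^\bullet\to B^\bullet\otimes A^\bullet$; $\eta_A:I\to A^\bullet\otimes A^\circ$; $\varepsilon_A:A^\circ\otimes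 A^\bullet\to I$. The equations are as follows (composition written $;$ in diagrammatic order, $1$ denoting identities of the evident type, for all objects and morphisms of $\mathbb{A}$). In (1)–(6) the equations are stated for $\circ$; the same equations are also imposed with $\triangleleft,\triangleright,\iota^\circ,\kappa^\circ,\sigma^\circ$ replaced by $\blacktriangleleft,\blacktriangleright,\iota^\bullet,\kappa^\bullet,\sigma^\bullet$, $A^\circ$ by $A^\bullet$, and $f^\circ:A^\circ\to B^\circ$ by $f^\bullet:B^\bullet\to A^\bullet$. (1) $\triangleleft_{A,B};\triangleright_{A,B}=1$; $\triangleright_{A,B};\triangleleft_{A,B}=1$; $(\triangleright_{A,B}\otimes 1);\triangleright_{A\otimes B,C}=(1\otimes\triangleright_{B,C});\triangleright_{A,B\otimes C}$; $\triangleleft_{A\otimes B,C};(\triangleleft_{A,B}\otimes 1)=\triangleleft_{A,B\otimes C};(1\otimes\triangleleft_{B,C})$. (2) $\iota^\circ;\kappa^\circ=1$; $\kappa^\circ;\iota^\circ=1$. (3) $(\iota^\circ\otimes 1);\triangleright_{I,A}=1$; $(1\otimes\iota^\circ);\triangleright_{A,I}=1$; $\triangleleft_{I,A};(\kappa^\circ\otimes 1)=1$; $\triangleleft_{A,I};(1\otimes\kappa^\circ)=1$; $\iota^\circ;\triangleleft_{I,I}=\iota^\circ\otimes\iota^\circ$; $\triangleright_{I,I};\kappa^\circ=\kappa^\circ\otimes\kappa^\circ$. (4) $(f^\circ\otimes 1);\sigma^\circ=\sigma^\circ;(1\otimes f^\circ)$; $(1\otimes f^\circ);\sigma^\circ=\sigma^\circ;(f^\circ\otimes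 1)$. (5) $(\triangleright_{A,B}\otimes 1);\sigma^\circ_{A\otimes B,C}=(1\otimes\sigma^\circ_{B,C});(\sigma^\circ_{A,C}\otimes 1);(1\otimes\triangleright_{A,B})$; $(1\otimes\triangleright_{B,C});\sigma^\circ_{A,B\otimes C}=(\sigma^\circ_{A,B}\otimes 1);(1\otimes\sigma^\circ_{A,C});(\triangleright_{B,C}\otimes 1)$; $\sigma^\circ_{A\otimes B,C};(1\otimes\triangleleft_{A,B})=(\triangleleft_{A,B}\otimes 1);(1\otimes\sigma^\circ_{B,C});(\sigma^\circ_{A,C}\otimes 1)$; $\sigma^\circ_{A,B\otimes C};(\triangleleft_{B,C}\otimes 1)=(1\otimes\triangleleft_{B,C});(\sigma^\circ_{A,B}\otimes 1);(1\otimes\sigma^\circ_{A,C})$. (6) $(\iota^\circ\otimes 1);\sigma^\circ_{I,A}=1\otimes\iota^\circ$; $(1\otimes\iota^\circ);\sigma^\circ_{A,I}=\iota^\circ\otimes 1$; $\sigma^\circ_{I,A};(1\otimes\kappa^\circ)=\kappa^\circ\otimes 1$; $\sigma^\circ_{A,I};(\kappa^\circ\otimes 1)=1\otimes\kappa^\circ$. (7) $(1_{A^\circ}\otimes\eta_A);(\varepsilon_A\otimes 1_{A^\circ})=1_{A^\circ}$; $(\eta_A\otimes 1_{A^\bullet});(1_{A^\bullet}\otimes\varepsilon_A)=1_{A^\bullet}$; for $f:A\to B$: $\eta_A;(1\otimes f^\circ)=\eta_B;(f^\bullet\otimes 1)$ and $(f^\circ\otimes 1);\varepsilon_B=(1\otimes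 f^\bullet);\varepsilon_A$. (8) With $N_{A,B}=\eta_B;(1\otimes\eta_A\otimes 1):I\to B^\bullet\otimes A^\bullet\otimes A^\circ\otimes B^\circ$ and $E_{A,B}=(1\otimes\varepsilon_B\otimes 1);\varepsilon_A:A^\circ\otimes B^\circ\otimes B^\bullet\otimes A^\bullet\to I$: $N_{A,B};(1\otimes\sigma^\circ_{A,B})=N_{B,A};(\sigma^\bullet_{A,B}\otimes 1)$ and $(\sigma^\circ_{A,B}\otimes 1);E_{B,A}=(1\otimes\sigma^\bullet_{A,B});E_{A,B}$. (9) $\eta_{A\otimes B};(\blacktriangleleft_{A,B}\otimes 1)=N_{B,A};(1\otimes\sigma^\circ_{B,A});(1\otimes\triangleright_{A,B})$; $\eta_{A\otimes B};(1\otimes\triangleleft_{A,B})=N_{A,B};(\sigma^\bullet_{B,A}\otimes 1);(\blacktriangleright_{A,B}\otimes 1)$; $(\triangleright_{A,B}\otimes 1);\varepsilon_{A\otimes B}=(1\otimes\blacktriangleleft_{A,B});(1\otimes\sigma^\bullet_{A,B});E_{A,B}$; $(1\otimes\blacktriangleright_{A,B});\varepsilon_{A\otimes B}=(\triangleleft_{A,B}\otimes 1);(\sigma^\circ_{A,B}\otimes 1);E_{B,A}$. (10) $f^\circ;g^\circ=(f;g)^\circ$; $\triangleleft;(f^\circ\otimes g^\circ);\triangleright=(f\otimes g)^\circ$; $(1_A)^\circ=1_{A^\circ}$; $\triangleright_{A,B};(\sigma_{A,B})^\circ;\triangleleft_{B,A}=\sigma^\circ_{A,B}$; $g^\bullet;f^\bullet=(f;g)^\bullet$;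 $\blacktriangleleft;(f^\bullet\otimes g^\bullet);\blacktriangleright=(f\otimes g)^\bullet$; $(1_A)^\bullet=1_{A^\bullet}$; $\blacktriangleright_{A,B};(\sigma_{B,A})^\bullet;\blacktriangleleft_{B,A}=\sigma^\bullet_{A,B}$. The functor $M$. $M$ is the strict monoidal functor with $M(X)=X$ on objects (both categories have object set $\mathbb{A}^{\circ\bullet}$), given on generators by the following vertical composites of cells, listed from top to bottom: $M(f^\circ)$: $r^\circ_A,\ulcorner f\urcorner,s^\circ_B$; $M(f^\bullet)$: $r^\bullet_A,\ulcorner f\urcorner,s^\bullet_B$; $M(\triangleleft_{A,B})$: $r^\circ_{A\otimes B},\ulcorner\sigma_{A,B}\urcorner,1_B\vert s^\circ_A,s^\circ_B$; $M(\triangleright_{A,B})$: $r^\circ_A,\;r^\circ_B\vert 1_A,\;\ulcorner\sigma_{B,A}\urcorner,\;s^\circ_{A\otimes B}$; $M(\blacktriangleleft_{A,B})$: $r^\bullet_A,\;1_A\vert r^\bullet_B,\;s^\bullet_{A\otimes B}$; $M(\blacktriangleright_{A,B})$: $r^\bullet_{A\otimes B},\;s^\bullet_A\vert 1_B,\;s^\bullet_B$; $M(\iota^\circ)=s^\circ_I$, $M(\kappa^\circ)=r^\circ_I$, $M(\iota^\bullet)=r^\bullet_I$, $M(\kappa^\bullet)=s^\bullet_I$; $M(\sigma^\circ_{A,B})$: $r^\circ_A,\;r^\circ_B\vert 1_A,\;\ulcorner\sigma_{B,A}\urcorner,\;1_A\vert s^\circ_B,\;s^\circ_A$; $M(\sigma^\bullet_{A,B})$: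 $r^\bullet_B,\;1_B\vert r^\bullet_A,\;\ulcorner\sigma_{B,A}\urcorner,\;s^\bullet_A\vert 1_B,\;s^\bullet_B$; $M(\eta_A)$: $r^\bullet_A,s^\circ_A$; $\quad M(\varepsilon_A)$: $r^\circ_A,s^\bullet_A$. -}

module Defs where

open import Level using (Level; _⊔_; suc)
open import Algebra.Core using (Op₂)
open import Algebra.Structures using (IsMonoid)
open import Data.List.Base using (List; []; _∷_; [_]; _++_)
open import Data.List.Properties using (++-isMonoid; ++-assoc; ++-identityʳ)
open import Data.Product.Base using (∃-syntax; _×_; _,_)
open import Relation.Binary.Core using (Rel)
open import Relation.Binary.Structures using (IsEquivalence)
open import Relation.Binary.PropositionalEquality
  using (_≡_; refl; sym; trans; cong; cong₂; subst; subst₂)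

private
  variable
    o ℓ e o′ ℓ′ e′ v : Level

-- Objects are compared with _≡_ and form a monoid on the nose; morphisms
-- form setoids.  The strictness laws for morphisms are stated after
-- transport along the monoid laws for objects.

record StrictMonoidalCategory o ℓ e : Set (suc (o ⊔ ℓ ⊔ e)) where
  infix  4 _≈_
  infixr 5 _⨾_
  infixr 6 _⊗₁_
  infixr 7 _⊗₀_
  field
    Obj         : Set o
    _⊗₀_        : Op₂ Obj
    unit        : Obj
    ⊗₀-isMonoid : IsMonoid _≡_ _⊗₀_ unit

  open IsMonoid ⊗₀-isMonoid public using ()
    renaming (assoc to ⊗₀-assoc; identityˡ to ⊗₀-identityˡ; identityʳ to ⊗₀-identityʳ)

  field
    Hom     : Obj → Obj → Set ℓ
    _≈_     : ∀ {A B} → Rel (Hom A B) e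
    ≈-equiv : ∀ {A B} → IsEquivalence (_≈_ {A} {B})

    id  : ∀ {A} → Hom A A
    -- diagrammatic order: f ⨾ g is "first f, then g"
    _⨾_ : ∀ {A B C} → Hom A B → Hom B C → Hom A C

    ⨾-cong      : ∀ {A B C} {f f′ : Hom A B} {g g′ : Hom B C} →
                  f ≈ f′ → g ≈ g′ → f ⨾ g ≈ f′ ⨾ g′
    ⨾-assoc     : ∀ {A B C D} (f : Hom A B) (g : Hom B C) (h : Hom C D) →
                  (f ⨾ g) ⨾ h ≈ f ⨾ (g ⨾ h)
    ⨾-identityˡ : ∀ {A B} (f : Hom A B) → id ⨾ f ≈ f
    ⨾-identityʳ : ∀ {A B} (f : Hom A B) → f ⨾ id ≈ f

    _⊗₁_ : ∀ {A B C D} → Hom A B → Hom C D → Hom (A ⊗₀ C) (B ⊗₀ D)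

    ⊗₁-cong : ∀ {A B C D} {f f′ : Hom A B} {g g′ : Hom C D} →
              f ≈ f′ → g ≈ g′ → f ⊗₁ g ≈ f′ ⊗₁ g′
    ⊗₁-id   : ∀ {A B} → id {A} ⊗₁ id {B} ≈ id {A ⊗₀ B}
    ⊗₁-⨾    : ∀ {A B C A′ B′ C′}
              (f : Hom A B) (g : Hom B C) (f′ : Hom A′ B′) (g′ : Hom B′ C′) →
              (f ⨾ g) ⊗₁ (f′ ⨾ g′) ≈ (f ⊗₁ f′) ⨾ (g ⊗₁ g′)

    ⊗₁-assoc     : ∀ {A A′ B B′ C C′} (f : Hom A A′) (g : Hom B B′) (h : Hom C C′) →
                   subst₂ Hom (⊗₀-assoc A B C) (⊗₀-assoc A′ B′ C′) ((f ⊗₁ g) ⊗₁ h)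
                     ≈ f ⊗₁ (g ⊗₁ h)
    ⊗₁-identityˡ : ∀ {A B} (f : Hom A B) →
                   subst₂ Hom (⊗₀-identityˡ A) (⊗₀-identityˡ B) (id {unit} ⊗₁ f) ≈ f
    ⊗₁-identityʳ : ∀ {A B} (f : Hom A B) →
                   subst₂ Hom (⊗₀-identityʳ A) (⊗₀-identityʳ B) (f ⊗₁ id {unit}) ≈ f

Spatial : StrictMonoidalCategory o ℓ e → Set (o ⊔ ℓ ⊔ e)
Spatial C = ∀ (h : Hom unit unit) X →
  subst₂ Hom (⊗₀-identityˡ X) (⊗₀-identityˡ X) (h ⊗₁ id {X})
    ≈ subst₂ Hom (⊗₀-identityʳ X) (⊗₀-identityʳ X) (id {X} ⊗₁ h)
  where open StrictMonoidalCategory C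

record SymmetricStrictMonoidalCategory o ℓ e : Set (suc (o ⊔ ℓ ⊔ e)) where
  field
    strictMonoidalCategory : StrictMonoidalCategory o ℓ e

  open StrictMonoidalCategory strictMonoidalCategory public

  field
    σ : ∀ A B → Hom (A ⊗₀ B) (B ⊗₀ A)

    σ-natural    : ∀ {A A′ B B′} (f : Hom A A′) (g : Hom B B′) →
                   (f ⊗₁ g) ⨾ σ A′ B′ ≈ σ A B ⨾ (g ⊗₁ f)
    σ-involutive : ∀ A B → σ A B ⨾ σ B A ≈ id
    -- The other hexagon follows from this one and involutivity.
    σ-hexagon    : ∀ A B C →
                   subst₂ Hom (⊗₀-assoc A B C) (sym (⊗₀-assoc C A B)) (σ (A ⊗₀ B) C)
                     ≈ (id {A} ⊗₁ σ B C)
                       ⨾ subst (λ Z → Hom Z ((C ⊗₀ A) ⊗₀ B)) (⊗₀-assoc A C B)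
                               (σ A C ⊗₁ id {B})

record StrictMonoidalFunctor
  (C : StrictMonoidalCategory o ℓ e) (D : StrictMonoidalCategory o′ ℓ′ e′)
  : Set (o ⊔ ℓ ⊔ e ⊔ o′ ⊔ ℓ′ ⊔ e′) where
  private
    module C = StrictMonoidalCategory C
    module D = StrictMonoidalCategory D
  field
    F₀      : C.Obj → D.Obj
    F₀-unit : F₀ C.unit ≡ D.unit
    F₀-⊗    : ∀ A B → F₀ (A C.⊗₀ B) ≡ F₀ A D.⊗₀ F₀ B

    F₁      : ∀ {A B} → C.Hom A B → D.Hom (F₀ A) (F₀ B)
    F₁-cong : ∀ {A B} {f g : C.Hom A B} → f C.≈ g → F₁ f D.≈ F₁ g
    F₁-id   : ∀ {A} → F₁ (C.id {A}) D.≈ D.id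
    F₁-⨾    : ∀ {X Y Z} (f : C.Hom X Y) (g : C.Hom Y Z) →
              F₁ (f C.⨾ g) D.≈ F₁ f D.⨾ F₁ g
    F₁-⊗    : ∀ {X X′ Y Y′} (f : C.Hom X X′) (g : C.Hom Y Y′) →
              subst₂ D.Hom (F₀-⊗ X Y) (F₀-⊗ X′ Y′) (F₁ (f C.⊗₁ g)) D.≈ F₁ f D.⊗₁ F₁ g

module _ {C : StrictMonoidalCategory o ℓ e} {D : StrictMonoidalCategory o′ ℓ′ e′}
         (F : StrictMonoidalFunctor C D) where
  private
    module C = StrictMonoidalCategory C
    module D = StrictMonoidalCategory D
  open StrictMonoidalFunctor F

  Full : Set (o ⊔ ℓ ⊔ ℓ′ ⊔ e′)
  Full = ∀ {X Y} (g : D.Hom (F₀ X) (F₀ Y)) → ∃[ f ] F₁ {X} {Y} f D.≈ g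

  Faithful : Set (o ⊔ ℓ ⊔ e ⊔ e′)
  Faithful = ∀ {X Y} {f g : C.Hom X Y} → F₁ f D.≈ F₁ g → f C.≈ g

-- Cell A B X Y is to be read: top A, bottom B, left X, right Y.
cast : {H : Set o} {V : Set v} (Cell : H → H → V → V → Set ℓ) →
       ∀ {A A′ B B′ X X′ Y Y′} → A ≡ A′ → B ≡ B′ → X ≡ X′ → Y ≡ Y′ →
       Cell A B X Y → Cell A′ B′ X′ Y′
cast Cell refl refl refl refl α = α

record SingleObjectDoubleCategory o v ℓ e : Set (suc (o ⊔ v ⊔ ℓ ⊔ e)) where
  infix  4 _≈_
  infixr 5 _/_
  infixr 6 _∣_
  infixr 7 _⊗ᴴ_ _⊗ⱽ_
  field
    H         : Set o
    _⊗ᴴ_      : Op₂ H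
    Iᴴ        : H
    H-isMonoid : IsMonoid _≡_ _⊗ᴴ_ Iᴴ
    V         : Set v
    _⊗ⱽ_      : Op₂ V
    Iⱽ        : V
    V-isMonoid : IsMonoid _≡_ _⊗ⱽ_ Iⱽ

  module H-monoid = IsMonoid H-isMonoid
  module V-monoid = IsMonoid V-isMonoid

  field
    Cell    : (top bottom : H) (left right : V) → Set ℓ
    _≈_     : ∀ {A B X Y} → Rel (Cell A B X Y) e
    ≈-equiv : ∀ {A B X Y} → IsEquivalence (_≈_ {A} {B} {X} {Y})

    _∣_ : ∀ {A B C D X Y Z} → Cell A B X Y → Cell C D Y Z → Cell (A ⊗ᴴ C) (B ⊗ᴴ D) X Z
    _/_ : ∀ {A B C X Y Z W} → Cell A B X Y → Cell B C Z W → Cell A C (X ⊗ⱽ Z) (Y ⊗ⱽ W)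
    idᴴ : ∀ A → Cell A A Iⱽ Iⱽ
    idⱽ : ∀ X → Cell Iᴴ Iᴴ X X

    ∣-cong : ∀ {A B C D X Y Z} {α α′ : Cell A B X Y} {β β′ : Cell C D Y Z} →
             α ≈ α′ → β ≈ β′ → α ∣ β ≈ α′ ∣ β′
    /-cong : ∀ {A B C X Y Z W} {α α′ : Cell A B X Y} {β β′ : Cell B C Z W} →
             α ≈ α′ → β ≈ β′ → α / β ≈ α′ / β′

    ∣-assoc     : ∀ {A A′ B B′ C C′ X Y Z W}
                  (α : Cell A A′ X Y) (β : Cell B B′ Y Z) (γ : Cell C C′ Z W) →
                  cast Cell (H-monoid.assoc A B C) (H-monoid.assoc A′ B′ C′) refl refl
                       ((α ∣ β) ∣ γ) ≈ α ∣ (β ∣ γ)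
    ∣-identityˡ : ∀ {A B X Y} (α : Cell A B X Y) →
                  cast Cell (H-monoid.identityˡ A) (H-monoid.identityˡ B) refl refl
                       (idⱽ X ∣ α) ≈ α
    ∣-identityʳ : ∀ {A B X Y} (α : Cell A B X Y) →
                  cast Cell (H-monoid.identityʳ A) (H-monoid.identityʳ B) refl refl
                       (α ∣ idⱽ Y) ≈ α

    /-assoc     : ∀ {A B C D X X′ Y Y′ Z Z′}
                  (α : Cell A B X X′) (β : Cell B C Y Y′) (γ : Cell C D Z Z′) →
                  cast Cell refl refl (V-monoid.assoc X Y Z) (V-monoid.assoc X′ Y′ Z′)
                       ((α / β) / γ) ≈ α / (β / γ)
    /-identityˡ : ∀ {A B X Y} (α : Cell A B X Y) →
                  cast Cell refl refl (V-monoid.identityˡ X) (V-monoid.identityˡ Y)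
                       (idᴴ A / α) ≈ α
    /-identityʳ : ∀ {A B X Y} (α : Cell A B X Y) →
                  cast Cell refl refl (V-monoid.identityʳ X) (V-monoid.identityʳ Y)
                       (α / idᴴ B) ≈ α

    idᴴ-∣   : ∀ A B → idᴴ A ∣ idᴴ B ≈ idᴴ (A ⊗ᴴ B)
    idⱽ-/   : ∀ X Y → idⱽ X / idⱽ Y ≈ idⱽ (X ⊗ⱽ Y)
    idᴴ≈idⱽ : idᴴ Iᴴ ≈ idⱽ Iⱽ

    interchange : ∀ {A B C A′ B′ C′ X Y Z X′ Y′ Z′}
                  (α : Cell A B X Y) (β : Cell B C X′ Y′)
                  (γ : Cell A′ B′ Y Z) (δ : Cell B′ C′ Y′ Z′) →
                  (α / β) ∣ (γ / δ) ≈ (α ∣ γ) / (β ∣ δ)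

module _ (𝔻 : SingleObjectDoubleCategory o v ℓ e) where
  open SingleObjectDoubleCategory 𝔻
  private
    module ≈ {A B X Y} = IsEquivalence (≈-equiv {A} {B} {X} {Y})

    I⊗I≡I : Iᴴ ⊗ᴴ Iᴴ ≡ Iᴴ
    I⊗I≡I = H-monoid.identityˡ Iᴴ

    HHom : V → V → Set ℓ
    HHom = Cell Iᴴ Iᴴ

    infix 4 _≋_
    data _≋_ {A B X Y} (α : Cell A B X Y) : ∀ {A′ B′ X′ Y′} → Cell A′ B′ X′ Y′ → Set (ℓ ⊔ e) where
      ⌊_⌋ : ∀ {β : Cell A B X Y} → α ≈ β → α ≋ β

    toHom : ∀ {A B X Y} {α β : Cell A B X Y} → α ≋ β → α ≈ β
    toHom ⌊ p ⌋ = p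

    ≋-sym : ∀ {A B X Y A′ B′ X′ Y′} {α : Cell A B X Y} {β : Cell A′ B′ X′ Y′} → α ≋ β → β ≋ α
    ≋-sym ⌊ p ⌋ = ⌊ ≈.sym p ⌋

    infixr 3 _∙_
    _∙_ : ∀ {A B X Y A′ B′ X′ Y′ A″ B″ X″ Y″}
          {α : Cell A B X Y} {β : Cell A′ B′ X′ Y′} {γ : Cell A″ B″ X″ Y″} →
          α ≋ β → β ≋ γ → α ≋ γ
    ⌊ p ⌋ ∙ ⌊ q ⌋ = ⌊ ≈.trans p q ⌋

    castˡ : ∀ {A B X Y A′ B′ X′ Y′} (p : A ≡ A′) (q : B ≡ B′) (r : X ≡ X′) (s : Y ≡ Y′)
            {α : Cell A B X Y} → cast Cell p q r s α ≋ α
    castˡ refl refl refl refl = ⌊ ≈.refl ⌋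

    uncast : ∀ {A B X Y A′ B′ X′ Y′} {p : A ≡ A′} {q : B ≡ B′} {r : X ≡ X′} {s : Y ≡ Y′}
             {α : Cell A B X Y} {β : Cell A′ B′ X′ Y′} → cast Cell p q r s α ≈ β → α ≋ β
    uncast {p = p} {q} {r} {s} h = ≋-sym (castˡ p q r s) ∙ ⌊ h ⌋

    subst₂ˡ : ∀ {X Y X′ Y′} (r : X ≡ X′) (s : Y ≡ Y′) {α : HHom X Y} →
              subst₂ HHom r s α ≋ α
    subst₂ˡ refl refl = ⌊ ≈.refl ⌋

    ∣-congᵇ : ∀ {A B C D X Y Z A′ B′ C′ D′ X′ Z′}
              {α : Cell A B X Y} {α′ : Cell A′ B′ X′ Y} {β : Cell C D Y Z} {β′ : Cell C′ D′ Y Z′} →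
              α ≋ α′ → β ≋ β′ → α ∣ β ≋ α′ ∣ β′
    ∣-congᵇ ⌊ p ⌋ ⌊ q ⌋ = ⌊ ∣-cong p q ⌋

    infixr 5 _⨾ᴴ_
    _⨾ᴴ_ : ∀ {X Y Z} → HHom X Y → HHom Y Z → HHom X Z
    α ⨾ᴴ β = cast Cell I⊗I≡I I⊗I≡I refl refl (α ∣ β)

    ⨾ᴴ≋∣ : ∀ {X Y Z} {α : HHom X Y} {β : HHom Y Z} → α ⨾ᴴ β ≋ α ∣ β
    ⨾ᴴ≋∣ = castˡ I⊗I≡I I⊗I≡I refl refl

    reflᵇ : ∀ {A B X Y} {α : Cell A B X Y} → α ≋ α
    reflᵇ = ⌊ ≈.refl ⌋

    /-congᵇ : ∀ {A B C X Y X₁ Y₁ A′ B′ C′}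
              {α : Cell A B X Y} {α′ : Cell A′ B′ X Y} {β : Cell B C X₁ Y₁} {β′ : Cell B′ C′ X₁ Y₁} →
              α ≋ α′ → β ≋ β′ → α / β ≋ α′ / β′
    /-congᵇ ⌊ p ⌋ ⌊ q ⌋ = ⌊ /-cong p q ⌋

    cast-cong : ∀ {A B X Y A′ B′ X′ Y′} (p : A ≡ A′) (q : B ≡ B′) (r : X ≡ X′) (s : Y ≡ Y′)
                {α β : Cell A B X Y} → α ≈ β → cast Cell p q r s α ≈ cast Cell p q r s β
    cast-cong refl refl refl refl h = h

  𝐇 : StrictMonoidalCategory v ℓ e
  𝐇 = record
    { Obj          = V
    ; _⊗₀_         = _⊗ⱽ_
    ; unit         = Iⱽ
    ; ⊗₀-isMonoid  = V-isMonoid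
    ; Hom          = Cell Iᴴ Iᴴ
    ; _≈_          = _≈_
    ; ≈-equiv      = ≈-equiv
    ; id           = λ {X} → idⱽ X
    ; _⨾_          = _⨾ᴴ_
    ; ⨾-cong       = λ p q → cast-cong I⊗I≡I I⊗I≡I refl refl (∣-cong p q)
    ; ⨾-assoc      = λ f g h → toHom
        (⨾ᴴ≋∣ ∙ ∣-congᵇ ⨾ᴴ≋∣ reflᵇ ∙ uncast (∣-assoc f g h)
          ∙ ≋-sym (∣-congᵇ reflᵇ ⨾ᴴ≋∣) ∙ ≋-sym ⨾ᴴ≋∣)
    ; ⨾-identityˡ  = λ f → toHom (⨾ᴴ≋∣ ∙ uncast (∣-identityˡ f))
    ; ⨾-identityʳ  = λ f → toHom (⨾ᴴ≋∣ ∙ uncast (∣-identityʳ f))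
    ; _⊗₁_         = _/_
    ; ⊗₁-cong      = /-cong
    ; ⊗₁-id        = idⱽ-/ _ _
    ; ⊗₁-⨾         = λ f g f′ g′ → toHom
        (/-congᵇ ⨾ᴴ≋∣ ⨾ᴴ≋∣ ∙ ≋-sym ⌊ interchange f f′ g g′ ⌋ ∙ ≋-sym ⨾ᴴ≋∣)
    ; ⊗₁-assoc     = λ f g h → toHom
        (subst₂ˡ (V-monoid.assoc _ _ _) (V-monoid.assoc _ _ _) ∙ uncast (/-assoc f g h))
    ; ⊗₁-identityˡ = λ f → toHom
        (subst₂ˡ _ _ ∙ /-congᵇ (≋-sym ⌊ idᴴ≈idⱽ ⌋) reflᵇ ∙ uncast (/-identityˡ f))
    ; ⊗₁-identityʳ = λ f → toHom
        (subst₂ˡ _ _ ∙ /-congᵇ reflᵇ (≋-sym ⌊ idᴴ≈idⱽ ⌋) ∙ uncast (/-identityʳ f))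
    }

data Polarity : Set where
  ○ ● : Polarity

module _ (𝔸 : SymmetricStrictMonoidalCategory o ℓ e) where
  private
    module 𝔸 = SymmetricStrictMonoidalCategory 𝔸
  open 𝔸 using (Obj; _⊗₀_; unit; Hom)

  -- The free monoid (𝔸₀ × {∘,•})* is realised by lists under _++_.
  Edge : Set o
  Edge = List (Obj × Polarity)

  infix 8 _^_ _° _•
  _^_ : Obj → Polarity → Edge
  A ^ p = [ (A , p) ]

  _° _• : Obj → Edge
  A ° = A ^ ○
  A • = A ^ ●

  -- The free cornering of 𝔸, as terms modulo the least congruence
  -- containing the required equations.
  module FreeCornering where
    infix  4 _≋_
    infixr 5 _/_
    infixr 6 _∣_

    data Cell : (top bottom : Obj) (left right : Edge) → Set (o ⊔ ℓ) where
      _∣_ : ∀ {A B C D X Y Z} → Cell A B X Y → Cell C D Y Z → Cell (A ⊗₀ C) (B ⊗₀ D) X Z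
      _/_ : ∀ {A B C X Y Z W} → Cell A B X Y → Cell B C Z W → Cell A C (X ++ Z) (Y ++ W)
      idᴴ : ∀ A → Cell A A [] []
      idⱽ : ∀ X → Cell unit unit X X
      s°  : ∀ A → Cell A unit [] (A °)
      r°  : ∀ A → Cell unit A (A °) []
      s•  : ∀ A → Cell A unit (A •) []
      r•  : ∀ A → Cell unit A [] (A •)
      ⌜_⌝ : ∀ {A B} → Hom A B → Cell A B [] []

    -- The two sides of a strict equation may have boundaries that are only
    -- propositionally equal, so the congruence is heterogeneous; by
    -- ≋-boundaries it only relates cells with equal boundaries.
    data _≋_ : ∀ {A B X Y A′ B′ X′ Y′} → Cell A B X Y → Cell A′ B′ X′ Y′ → Set (o ⊔ ℓ ⊔ e) where
      ≋-refl  : ∀ {A B X Y} {α : Cell A B X Y} → α ≋ α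
      ≋-sym   : ∀ {A B X Y A′ B′ X′ Y′} {α : Cell A B X Y} {β : Cell A′ B′ X′ Y′} →
                α ≋ β → β ≋ α
      ≋-trans : ∀ {A B X Y A′ B′ X′ Y′ A″ B″ X″ Y″}
                {α : Cell A B X Y} {β : Cell A′ B′ X′ Y′} {γ : Cell A″ B″ X″ Y″} →
                α ≋ β → β ≋ γ → α ≋ γ
      ∣-cong  : ∀ {A B C D X Y Z A′ B′ C′ D′ X′ Y′ Z′}
                {α : Cell A B X Y} {β : Cell C D Y Z}
                {α′ : Cell A′ B′ X′ Y′} {β′ : Cell C′ D′ Y′ Z′} →
                α ≋ α′ → β ≋ β′ → α ∣ β ≋ α′ ∣ β′
      /-cong  : ∀ {A B C X Y Z W A′ B′ C′ X′ Y′ Z′ W′}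
                {α : Cell A B X Y} {β : Cell B C Z W}
                {α′ : Cell A′ B′ X′ Y′} {β′ : Cell B′ C′ Z′ W′} →
                α ≋ α′ → β ≋ β′ → α / β ≋ α′ / β′

      ∣-assoc     : ∀ {A A′ B B′ C C′ X Y Z W}
                    (α : Cell A A′ X Y) (β : Cell B B′ Y Z) (γ : Cell C C′ Z W) →
                    (α ∣ β) ∣ γ ≋ α ∣ (β ∣ γ)
      ∣-identityˡ : ∀ {A B X Y} (α : Cell A B X Y) → idⱽ X ∣ α ≋ α
      ∣-identityʳ : ∀ {A B X Y} (α : Cell A B X Y) → α ∣ idⱽ Y ≋ α
      /-assoc     : ∀ {A B C D X X′ Y Y′ Z Z′}
                    (α : Cell A B X X′) (β : Cell B C Y Y′) (γ : Cell C D Z Z′) →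
                    (α / β) / γ ≋ α / (β / γ)
      /-identityˡ : ∀ {A B X Y} (α : Cell A B X Y) → idᴴ A / α ≋ α
      /-identityʳ : ∀ {A B X Y} (α : Cell A B X Y) → α / idᴴ B ≋ α
      idᴴ-∣       : ∀ A B → idᴴ A ∣ idᴴ B ≋ idᴴ (A ⊗₀ B)
      idⱽ-/       : ∀ X Y → idⱽ X / idⱽ Y ≋ idⱽ (X ++ Y)
      idᴴ≋idⱽ     : idᴴ unit ≋ idⱽ []
      interchange : ∀ {A B C A′ B′ C′ X Y Z X′ Y′ Z′}
                    (α : Cell A B X Y) (β : Cell B C X′ Y′)
                    (γ : Cell A′ B′ Y Z) (δ : Cell B′ C′ Y′ Z′) →
                    (α / β) ∣ (γ / δ) ≋ (α ∣ γ) / (β ∣ δ)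

      yank-°-∣ : ∀ A → s° A ∣ r° A ≋ idᴴ A
      yank-°-/ : ∀ A → r° A / s° A ≋ idⱽ (A °)
      yank-•-∣ : ∀ A → r• A ∣ s• A ≋ idᴴ A
      yank-•-/ : ∀ A → r• A / s• A ≋ idⱽ (A •)

      -- the morphisms of 𝔸 form setoids, so ⌜_⌝ has to respect their equality
      ⌜⌝-cong : ∀ {A B} {f g : Hom A B} → f 𝔸.≈ g → ⌜ f ⌝ ≋ ⌜ g ⌝
      ⌜⌝-⨾    : ∀ {A B C} (f : Hom A B) (g : Hom B C) → ⌜ f ⌝ / ⌜ g ⌝ ≋ ⌜ f 𝔸.⨾ g ⌝
      ⌜⌝-id   : ∀ A → ⌜ 𝔸.id {A} ⌝ ≋ idᴴ A
      ⌜⌝-⊗    : ∀ {A B C D} (f : Hom A B) (g : Hom C D) → ⌜ f ⌝ ∣ ⌜ g ⌝ ≋ ⌜ f 𝔸.⊗₁ g ⌝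

    ≋-boundaries : ∀ {A B X Y A′ B′ X′ Y′} {α : Cell A B X Y} {β : Cell A′ B′ X′ Y′} →
                   α ≋ β → (A ≡ A′ × B ≡ B′) × (X ≡ X′ × Y ≡ Y′)
    ≋-boundaries ≋-refl = (refl , refl) , (refl , refl)
    ≋-boundaries (≋-sym h) =
      let (a , b) , (x , y) = ≋-boundaries h in (sym a , sym b) , (sym x , sym y)
    ≋-boundaries (≋-trans h k) =
      let (a , b) , (x , y) = ≋-boundaries h
          (c , d) , (z , w) = ≋-boundaries k
      in (trans a c , trans b d) , (trans x z , trans y w)
    ≋-boundaries (∣-cong h k) =
      let (a , b) , (x , _) = ≋-boundaries h
          (c , d) , (_ , y) = ≋-boundaries k
      in (cong₂ _⊗₀_ a c , cong₂ _⊗₀_ b d) , (x , y)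
    ≋-boundaries (/-cong h k) =
      let (a , _) , (x , y) = ≋-boundaries h
          (_ , b) , (z , w) = ≋-boundaries k
      in (a , b) , (cong₂ _++_ x z , cong₂ _++_ y w)
    ≋-boundaries (∣-assoc {A} {A′} {B} {B′} {C} {C′} _ _ _) =
      (𝔸.⊗₀-assoc A B C , 𝔸.⊗₀-assoc A′ B′ C′) , (refl , refl)
    ≋-boundaries (∣-identityˡ {A} {B} _) =
      (𝔸.⊗₀-identityˡ A , 𝔸.⊗₀-identityˡ B) , (refl , refl)
    ≋-boundaries (∣-identityʳ {A} {B} _) =
      (𝔸.⊗₀-identityʳ A , 𝔸.⊗₀-identityʳ B) , (refl , refl)
    ≋-boundaries (/-assoc {X = X} {X′} {Y} {Y′} {Z} {Z′} _ _ _) =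
      (refl , refl) , (++-assoc X Y Z , ++-assoc X′ Y′ Z′)
    ≋-boundaries (/-identityˡ _) = (refl , refl) , (refl , refl)
    ≋-boundaries (/-identityʳ {X = X} {Y} _) =
      (refl , refl) , (++-identityʳ X , ++-identityʳ Y)
    ≋-boundaries (idᴴ-∣ _ _) = (refl , refl) , (refl , refl)
    ≋-boundaries (idⱽ-/ _ _) = (refl , refl) , (refl , refl)
    ≋-boundaries idᴴ≋idⱽ = (refl , refl) , (refl , refl)
    ≋-boundaries (interchange _ _ _ _) = (refl , refl) , (refl , refl)
    ≋-boundaries (yank-°-∣ A) =
      (𝔸.⊗₀-identityʳ A , 𝔸.⊗₀-identityˡ A) , (refl , refl)
    ≋-boundaries (yank-°-/ _) = (refl , refl) , (refl , refl)
    ≋-boundaries (yank-•-∣ A) =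
      (𝔸.⊗₀-identityˡ A , 𝔸.⊗₀-identityʳ A) , (refl , refl)
    ≋-boundaries (yank-•-/ _) = (refl , refl) , (refl , refl)
    ≋-boundaries (⌜⌝-cong _) = (refl , refl) , (refl , refl)
    ≋-boundaries (⌜⌝-⨾ _ _) = (refl , refl) , (refl , refl)
    ≋-boundaries (⌜⌝-id _) = (refl , refl) , (refl , refl)
    ≋-boundaries (⌜⌝-⊗ _ _) = (refl , refl) , (refl , refl)

    cast-≋ : ∀ {A B X Y A′ B′ X′ Y′} {A″ B″ X″ Y″}
             (p : A ≡ A′) (q : B ≡ B′) (r : X ≡ X′) (s : Y ≡ Y′)
             {α : Cell A B X Y} {β : Cell A″ B″ X″ Y″} →
             α ≋ β → cast Cell p q r s α ≋ β
    cast-≋ refl refl refl refl h = h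

  𝒞 : SingleObjectDoubleCategory o o (o ⊔ ℓ) (o ⊔ ℓ ⊔ e)
  𝒞 = record
    { H          = Obj
    ; _⊗ᴴ_       = _⊗₀_
    ; Iᴴ         = unit
    ; H-isMonoid = 𝔸.⊗₀-isMonoid
    ; V          = Edge
    ; _⊗ⱽ_       = _++_
    ; Iⱽ         = []
    ; V-isMonoid = ++-isMonoid
    ; Cell       = Cell
    ; _≈_        = λ α β → α ≋ β
    ; ≈-equiv    = record { refl = ≋-refl ; sym = ≋-sym ; trans = ≋-trans }
    ; _∣_        = _∣_
    ; _/_        = _/_
    ; idᴴ        = idᴴ
    ; idⱽ        = idⱽ
    ; ∣-cong     = ∣-cong
    ; /-cong     = /-cong
    ; ∣-assoc     = λ α β γ → cast-≋ _ _ refl refl (∣-assoc α β γ)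
    ; ∣-identityˡ = λ α → cast-≋ _ _ refl refl (∣-identityˡ α)
    ; ∣-identityʳ = λ α → cast-≋ _ _ refl refl (∣-identityʳ α)
    ; /-assoc     = λ α β γ → cast-≋ refl refl _ _ (/-assoc α β γ)
    ; /-identityˡ = λ α → cast-≋ refl refl _ _ (/-identityˡ α)
    ; /-identityʳ = λ α → cast-≋ refl refl _ _ (/-identityʳ α)
    ; idᴴ-∣       = idᴴ-∣
    ; idⱽ-/       = idⱽ-/
    ; idᴴ≈idⱽ     = idᴴ≋idⱽ
    ; interchange = interchange
    }
    where open FreeCornering

  -- The free spatial strict monoidal category T(𝔸), as terms modulo the
  -- least congruence containing the required equations.  The families of
  -- generators and equations that occur once for ∘ and once for • are
  -- indexed by the polarity p: ◁ ○, ▷ ○ are the white triangles and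
  -- ◁ ●, ▷ ● the black ones.
  module Presentation where
    infix  4 _≋_
    infixr 5 _⨾_
    infixr 6 _⊗_
    infix  9 _⟨°⟩ _⟨•⟩

    data Term : Edge → Edge → Set (o ⊔ ℓ) where
      id  : ∀ {X} → Term X X
      _⨾_ : ∀ {X Y Z} → Term X Y → Term Y Z → Term X Z
      _⊗_ : ∀ {X X′ Y Y′} → Term X X′ → Term Y Y′ → Term (X ++ Y) (X′ ++ Y′)

      _⟨°⟩ : ∀ {A B} → Hom A B → Term (A °) (B °)
      _⟨•⟩ : ∀ {A B} → Hom A B → Term (B •) (A •)
      ◁    : ∀ p A B → Term ((A ⊗₀ B) ^ p) (A ^ p ++ B ^ p)
      ▷    : ∀ p A B → Term (A ^ p ++ B ^ p) ((A ⊗₀ B) ^ p)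
      ι    : ∀ p → Term [] (unit ^ p)
      κ    : ∀ p → Term (unit ^ p) []
      σ    : ∀ p A B → Term (A ^ p ++ B ^ p) (B ^ p ++ A ^ p)
      η    : ∀ A → Term [] (A • ++ A °)
      ε    : ∀ A → Term (A ° ++ A •) []

    1[_] : ∀ X → Term X X
    1[ X ] = id {X}

    N : ∀ A B → Term [] (B • ++ A • ++ A ° ++ B °)
    N A B = η B ⨾ 1[ B • ] ⊗ η A ⊗ 1[ B ° ]

    E : ∀ A B → Term (A ° ++ B ° ++ B • ++ A •) []
    E A B = (1[ A ° ] ⊗ ε B ⊗ 1[ A • ]) ⨾ ε A

    -- Heterogeneous for the same reason as the congruence on cells.
    data _≋_ : ∀ {X Y X′ Y′} → Term X Y → Term X′ Y′ → Set (o ⊔ ℓ ⊔ e) where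
      ≋-refl  : ∀ {X Y} {f : Term X Y} → f ≋ f
      ≋-sym   : ∀ {X Y X′ Y′} {f : Term X Y} {g : Term X′ Y′} → f ≋ g → g ≋ f
      ≋-trans : ∀ {X Y X′ Y′ X″ Y″} {f : Term X Y} {g : Term X′ Y′} {h : Term X″ Y″} →
                f ≋ g → g ≋ h → f ≋ h
      ⨾-cong  : ∀ {X Y Z X′ Y′ Z′} {f : Term X Y} {g : Term Y Z}
                {f′ : Term X′ Y′} {g′ : Term Y′ Z′} →
                f ≋ f′ → g ≋ g′ → f ⨾ g ≋ f′ ⨾ g′
      ⊗-cong  : ∀ {X Y Z W X′ Y′ Z′ W′} {f : Term X Y} {g : Term Z W}
                {f′ : Term X′ Y′} {g′ : Term Z′ W′} →
                f ≋ f′ → g ≋ g′ → f ⊗ g ≋ f′ ⊗ g′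

      ⨾-assoc     : ∀ {X Y Z W} (f : Term X Y) (g : Term Y Z) (h : Term Z W) →
                    (f ⨾ g) ⨾ h ≋ f ⨾ (g ⨾ h)
      ⨾-identityˡ : ∀ {X Y} (f : Term X Y) → id ⨾ f ≋ f
      ⨾-identityʳ : ∀ {X Y} (f : Term X Y) → f ⨾ id ≋ f
      ⊗-assoc     : ∀ {X X′ Y Y′ Z Z′} (f : Term X X′) (g : Term Y Y′) (h : Term Z Z′) →
                    (f ⊗ g) ⊗ h ≋ f ⊗ (g ⊗ h)
      ⊗-identityˡ : ∀ {X Y} (f : Term X Y) → 1[ [] ] ⊗ f ≋ f
      ⊗-identityʳ : ∀ {X Y} (f : Term X Y) → f ⊗ 1[ [] ] ≋ f
      ⊗-id        : ∀ X Y → 1[ X ] ⊗ 1[ Y ] ≋ 1[ X ++ Y ]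
      ⊗-⨾         : ∀ {X Y Z X′ Y′ Z′}
                    (f : Term X Y) (g : Term Y Z) (f′ : Term X′ Y′) (g′ : Term Y′ Z′) →
                    (f ⨾ g) ⊗ (f′ ⨾ g′) ≋ (f ⊗ f′) ⨾ (g ⊗ g′)
      spatial     : ∀ (h : Term [] []) X → h ⊗ 1[ X ] ≋ 1[ X ] ⊗ h

      -- f ↦ f° and f ↦ f• have to respect the equality of morphisms of 𝔸
      °-cong : ∀ {A B} {f g : Hom A B} → f 𝔸.≈ g → f ⟨°⟩ ≋ g ⟨°⟩
      •-cong : ∀ {A B} {f g : Hom A B} → f 𝔸.≈ g → f ⟨•⟩ ≋ g ⟨•⟩

      ◁⨾▷     : ∀ p A B → ◁ p A B ⨾ ▷ p A B ≋ 1[ (A ⊗₀ B) ^ p ]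
      ▷⨾◁     : ∀ p A B → ▷ p A B ⨾ ◁ p A B ≋ 1[ A ^ p ++ B ^ p ]
      ▷-assoc : ∀ p A B C →
                (▷ p A B ⊗ 1[ C ^ p ]) ⨾ ▷ p (A ⊗₀ B) C
                  ≋ (1[ A ^ p ] ⊗ ▷ p B C) ⨾ ▷ p A (B ⊗₀ C)
      ◁-assoc : ∀ p A B C →
                ◁ p (A ⊗₀ B) C ⨾ (◁ p A B ⊗ 1[ C ^ p ])
                  ≋ ◁ p A (B ⊗₀ C) ⨾ (1[ A ^ p ] ⊗ ◁ p B C)

      ι⨾κ : ∀ p → ι p ⨾ κ p ≋ 1[ [] ]
      κ⨾ι : ∀ p → κ p ⨾ ι p ≋ 1[ unit ^ p ]

      ι-▷ˡ : ∀ p A → (ι p ⊗ 1[ A ^ p ]) ⨾ ▷ p unit A ≋ 1[ A ^ p ]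
      ι-▷ʳ : ∀ p A → (1[ A ^ p ] ⊗ ι p) ⨾ ▷ p A unit ≋ 1[ A ^ p ]
      ◁-κˡ : ∀ p A → ◁ p unit A ⨾ (κ p ⊗ 1[ A ^ p ]) ≋ 1[ A ^ p ]
      ◁-κʳ : ∀ p A → ◁ p A unit ⨾ (1[ A ^ p ] ⊗ κ p) ≋ 1[ A ^ p ]
      -- here (I ⊗ I)^p is identified with I^p
      ι-◁  : ∀ p →
             ι p ⨾ subst (λ Z → Term (Z ^ p) (unit ^ p ++ unit ^ p)) (𝔸.⊗₀-identityˡ unit)
                         (◁ p unit unit)
               ≋ ι p ⊗ ι p
      ▷-κ  : ∀ p →
             subst (λ Z → Term (unit ^ p ++ unit ^ p) (Z ^ p)) (𝔸.⊗₀-identityˡ unit)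
                   (▷ p unit unit) ⨾ κ p
               ≋ κ p ⊗ κ p

      σ°-naturalˡ : ∀ {A B} (f : Hom A B) C →
                    (f ⟨°⟩ ⊗ 1[ C ° ]) ⨾ σ ○ B C ≋ σ ○ A C ⨾ (1[ C ° ] ⊗ f ⟨°⟩)
      σ°-naturalʳ : ∀ {A B} (f : Hom A B) C →
                    (1[ C ° ] ⊗ f ⟨°⟩) ⨾ σ ○ C B ≋ σ ○ C A ⨾ (f ⟨°⟩ ⊗ 1[ C ° ])
      σ•-naturalˡ : ∀ {A B} (f : Hom A B) C →
                    (f ⟨•⟩ ⊗ 1[ C • ]) ⨾ σ ● A C ≋ σ ● B C ⨾ (1[ C • ] ⊗ f ⟨•⟩)
      σ•-naturalʳ : ∀ {A B} (f : Hom A B) C →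
                    (1[ C • ] ⊗ f ⟨•⟩) ⨾ σ ● C A ≋ σ ● C B ⨾ (f ⟨•⟩ ⊗ 1[ C • ])

      ▷-σˡ : ∀ p A B C →
             (▷ p A B ⊗ 1[ C ^ p ]) ⨾ σ p (A ⊗₀ B) C
               ≋ (1[ A ^ p ] ⊗ σ p B C) ⨾ (σ p A C ⊗ 1[ B ^ p ]) ⨾ (1[ C ^ p ] ⊗ ▷ p A B)
      ▷-σʳ : ∀ p A B C →
             (1[ A ^ p ] ⊗ ▷ p B C) ⨾ σ p A (B ⊗₀ C)
               ≋ (σ p A B ⊗ 1[ C ^ p ]) ⨾ (1[ B ^ p ] ⊗ σ p A C) ⨾ (▷ p B C ⊗ 1[ A ^ p ])
      σ-◁ˡ : ∀ p A B C →
             σ p (A ⊗₀ B) C ⨾ (1[ C ^ p ] ⊗ ◁ p A B)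
               ≋ (◁ p A B ⊗ 1[ C ^ p ]) ⨾ (1[ A ^ p ] ⊗ σ p B C) ⨾ (σ p A C ⊗ 1[ B ^ p ])
      σ-◁ʳ : ∀ p A B C →
             σ p A (B ⊗₀ C) ⨾ (◁ p B C ⊗ 1[ A ^ p ])
               ≋ (1[ A ^ p ] ⊗ ◁ p B C) ⨾ (σ p A B ⊗ 1[ C ^ p ]) ⨾ (1[ B ^ p ] ⊗ σ p A C)

      ι-σˡ : ∀ p A → (ι p ⊗ 1[ A ^ p ]) ⨾ σ p unit A ≋ 1[ A ^ p ] ⊗ ι p
      ι-σʳ : ∀ p A → (1[ A ^ p ] ⊗ ι p) ⨾ σ p A unit ≋ ι p ⊗ 1[ A ^ p ]
      σ-κˡ : ∀ p A → σ p unit A ⨾ (1[ A ^ p ] ⊗ κ p) ≋ κ p ⊗ 1[ A ^ p ]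
      σ-κʳ : ∀ p A → σ p A unit ⨾ (κ p ⊗ 1[ A ^ p ]) ≋ 1[ A ^ p ] ⊗ κ p

      snake°    : ∀ A → (1[ A ° ] ⊗ η A) ⨾ (ε A ⊗ 1[ A ° ]) ≋ 1[ A ° ]
      snake•    : ∀ A → (η A ⊗ 1[ A • ]) ⨾ (1[ A • ] ⊗ ε A) ≋ 1[ A • ]
      η-natural : ∀ {A B} (f : Hom A B) →
                  η A ⨾ (1[ A • ] ⊗ f ⟨°⟩) ≋ η B ⨾ (f ⟨•⟩ ⊗ 1[ B ° ])
      ε-natural : ∀ {A B} (f : Hom A B) →
                  (f ⟨°⟩ ⊗ 1[ B • ]) ⨾ ε B ≋ (1[ A ° ] ⊗ f ⟨•⟩) ⨾ ε A

      N-σ : ∀ A B →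
            N A B ⨾ (1[ B • ++ A • ] ⊗ σ ○ A B) ≋ N B A ⨾ (σ ● A B ⊗ 1[ B ° ++ A ° ])
      E-σ : ∀ A B →
            (σ ○ A B ⊗ 1[ A • ++ B • ]) ⨾ E B A ≋ (1[ A ° ++ B ° ] ⊗ σ ● A B) ⨾ E A B

      η-◁● : ∀ A B →
             η (A ⊗₀ B) ⨾ (◁ ● A B ⊗ 1[ (A ⊗₀ B) ° ])
               ≋ N B A ⨾ (1[ A • ++ B • ] ⊗ σ ○ B A) ⨾ (1[ A • ++ B • ] ⊗ ▷ ○ A B)
      η-◁○ : ∀ A B →
             η (A ⊗₀ B) ⨾ (1[ (A ⊗₀ B) • ] ⊗ ◁ ○ A B)
               ≋ N A B ⨾ (σ ● B A ⊗ 1[ A ° ++ B ° ]) ⨾ (▷ ● A B ⊗ 1[ A ° ++ B ° ])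
      ▷○-ε : ∀ A B →
             (▷ ○ A B ⊗ 1[ (A ⊗₀ B) • ]) ⨾ ε (A ⊗₀ B)
               ≋ (1[ A ° ++ B ° ] ⊗ ◁ ● A B) ⨾ (1[ A ° ++ B ° ] ⊗ σ ● A B) ⨾ E A B
      ▷●-ε : ∀ A B →
             (1[ (A ⊗₀ B) ° ] ⊗ ▷ ● A B) ⨾ ε (A ⊗₀ B)
               ≋ (◁ ○ A B ⊗ 1[ A • ++ B • ]) ⨾ (σ ○ A B ⊗ 1[ A • ++ B • ]) ⨾ E B A

      °-⨾  : ∀ {A B C} (f : Hom A B) (g : Hom B C) → f ⟨°⟩ ⨾ g ⟨°⟩ ≋ (f 𝔸.⨾ g) ⟨°⟩
      °-⊗  : ∀ {A A′ B B′} (f : Hom A A′) (g : Hom B B′) →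
             ◁ ○ A B ⨾ (f ⟨°⟩ ⊗ g ⟨°⟩) ⨾ ▷ ○ A′ B′ ≋ (f 𝔸.⊗₁ g) ⟨°⟩
      °-id : ∀ A → 𝔸.id {A} ⟨°⟩ ≋ 1[ A ° ]
      °-σ  : ∀ A B → ▷ ○ A B ⨾ 𝔸.σ A B ⟨°⟩ ⨾ ◁ ○ B A ≋ σ ○ A B
      •-⨾  : ∀ {A B C} (f : Hom A B) (g : Hom B C) → g ⟨•⟩ ⨾ f ⟨•⟩ ≋ (f 𝔸.⨾ g) ⟨•⟩
      •-⊗  : ∀ {A A′ B B′} (f : Hom A A′) (g : Hom B B′) →
             ◁ ● A′ B′ ⨾ (f ⟨•⟩ ⊗ g ⟨•⟩) ⨾ ▷ ● A B ≋ (f 𝔸.⊗₁ g) ⟨•⟩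
      •-id : ∀ A → 𝔸.id {A} ⟨•⟩ ≋ 1[ A • ]
      •-σ  : ∀ A B → ▷ ● A B ⨾ 𝔸.σ B A ⟨•⟩ ⨾ ◁ ● B A ≋ σ ● A B

    ≋-boundaries : ∀ {X Y X′ Y′} {f : Term X Y} {g : Term X′ Y′} →
                   f ≋ g → X ≡ X′ × Y ≡ Y′
    ≋-boundaries ≋-refl = refl , refl
    ≋-boundaries (≋-sym h) = let p , q = ≋-boundaries h in sym p , sym q
    ≋-boundaries (≋-trans h k) = let p , q = ≋-boundaries h ; p′ , q′ = ≋-boundaries k in trans p p′ , trans q q′
    ≋-boundaries (⨾-cong h k) = let p , _ = ≋-boundaries h ; _ , q = ≋-boundaries k in p , q
    ≋-boundaries (⊗-cong h k) = let p , q = ≋-boundaries h ; p′ , q′ = ≋-boundaries k in cong₂ _++_ p p′ , cong₂ _++_ q q′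
    ≋-boundaries (⨾-assoc _ _ _) = refl , refl
    ≋-boundaries (⨾-identityˡ _) = refl , refl
    ≋-boundaries (⨾-identityʳ _) = refl , refl
    ≋-boundaries (⊗-assoc {X} {X′} {Y} {Y′} {Z} {Z′} _ _ _) = ++-assoc X Y Z , ++-assoc X′ Y′ Z′
    ≋-boundaries (⊗-identityˡ _) = refl , refl
    ≋-boundaries (⊗-identityʳ {X} {Y} _) = ++-identityʳ X , ++-identityʳ Y
    ≋-boundaries (⊗-id _ _) = refl , refl
    ≋-boundaries (⊗-⨾ _ _ _ _) = refl , refl
    ≋-boundaries (spatial _ X) = sym (++-identityʳ X) , sym (++-identityʳ X)
    ≋-boundaries (°-cong _) = refl , refl
    ≋-boundaries (•-cong _) = refl , refl
    ≋-boundaries (◁⨾▷ _ _ _) = refl , refl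
    ≋-boundaries (▷⨾◁ _ _ _) = refl , refl
    ≋-boundaries (▷-assoc p A B C) = refl , cong (_^ p) (𝔸.⊗₀-assoc A B C)
    ≋-boundaries (◁-assoc p A B C) = cong (_^ p) (𝔸.⊗₀-assoc A B C) , refl
    ≋-boundaries (ι⨾κ _) = refl , refl
    ≋-boundaries (κ⨾ι _) = refl , refl
    ≋-boundaries (ι-▷ˡ p A) = refl , cong (_^ p) (𝔸.⊗₀-identityˡ A)
    ≋-boundaries (ι-▷ʳ p A) = refl , cong (_^ p) (𝔸.⊗₀-identityʳ A)
    ≋-boundaries (◁-κˡ p A) = cong (_^ p) (𝔸.⊗₀-identityˡ A) , refl
    ≋-boundaries (◁-κʳ p A) = cong (_^ p) (𝔸.⊗₀-identityʳ A) , refl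
    ≋-boundaries (ι-◁ _) = refl , refl
    ≋-boundaries (▷-κ _) = refl , refl
    ≋-boundaries (σ°-naturalˡ _ _) = refl , refl
    ≋-boundaries (σ°-naturalʳ _ _) = refl , refl
    ≋-boundaries (σ•-naturalˡ _ _) = refl , refl
    ≋-boundaries (σ•-naturalʳ _ _) = refl , refl
    ≋-boundaries (▷-σˡ _ _ _ _) = refl , refl
    ≋-boundaries (▷-σʳ _ _ _ _) = refl , refl
    ≋-boundaries (σ-◁ˡ _ _ _ _) = refl , refl
    ≋-boundaries (σ-◁ʳ _ _ _ _) = refl , refl
    ≋-boundaries (ι-σˡ _ _) = refl , refl
    ≋-boundaries (ι-σʳ _ _) = refl , refl
    ≋-boundaries (σ-κˡ _ _) = refl , refl
    ≋-boundaries (σ-κʳ _ _) = refl , refl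
    ≋-boundaries (snake° _) = refl , refl
    ≋-boundaries (snake• _) = refl , refl
    ≋-boundaries (η-natural _) = refl , refl
    ≋-boundaries (ε-natural _) = refl , refl
    ≋-boundaries (N-σ _ _) = refl , refl
    ≋-boundaries (E-σ _ _) = refl , refl
    ≋-boundaries (η-◁● _ _) = refl , refl
    ≋-boundaries (η-◁○ _ _) = refl , refl
    ≋-boundaries (▷○-ε _ _) = refl , refl
    ≋-boundaries (▷●-ε _ _) = refl , refl
    ≋-boundaries (°-⨾ _ _) = refl , refl
    ≋-boundaries (°-⊗ _ _) = refl , refl
    ≋-boundaries (°-id _) = refl , refl
    ≋-boundaries (°-σ _ _) = refl , refl
    ≋-boundaries (•-⨾ _ _) = refl , refl
    ≋-boundaries (•-⊗ _ _) = refl , refl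
    ≋-boundaries (•-id _) = refl , refl
    ≋-boundaries (•-σ _ _) = refl , refl

    subst₂-≋ : ∀ {X Y X′ Y′ X″ Y″} (p : X ≡ X′) (q : Y ≡ Y′)
               {f : Term X Y} {g : Term X″ Y″} → f ≋ g → subst₂ Term p q f ≋ g
    subst₂-≋ refl refl h = h

  𝐓 : StrictMonoidalCategory o (o ⊔ ℓ) (o ⊔ ℓ ⊔ e)
  𝐓 = record
    { Obj          = Edge
    ; _⊗₀_         = _++_
    ; unit         = []
    ; ⊗₀-isMonoid  = ++-isMonoid
    ; Hom          = Term
    ; _≈_          = λ f g → f ≋ g
    ; ≈-equiv      = record { refl = ≋-refl ; sym = ≋-sym ; trans = ≋-trans }
    ; id           = id
    ; _⨾_          = _⨾_
    ; ⨾-cong       = ⨾-cong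
    ; ⨾-assoc      = ⨾-assoc
    ; ⨾-identityˡ  = ⨾-identityˡ
    ; ⨾-identityʳ  = ⨾-identityʳ
    ; _⊗₁_         = _⊗_
    ; ⊗₁-cong      = ⊗-cong
    ; ⊗₁-id        = ⊗-id _ _
    ; ⊗₁-⨾         = ⊗-⨾
    ; ⊗₁-assoc     = λ f g h → subst₂-≋ _ _ (⊗-assoc f g h)
    ; ⊗₁-identityˡ = λ f → subst₂-≋ _ _ (⊗-identityˡ f)
    ; ⊗₁-identityʳ = λ f → subst₂-≋ _ _ (⊗-identityʳ f)
    }
    where open Presentation

  𝐓-spatial : Spatial 𝐓
  𝐓-spatial h X = subst₂-≋ _ _ (≋-sym (subst₂-≋ _ _ (≋-sym (spatial h X))))
    where open Presentation

  module Functor where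
    open FreeCornering
    open Presentation using (Term; id; _⨾_; _⊗_; _⟨°⟩; _⟨•⟩; ◁; ▷; ι; κ; σ; η; ε)
    private
      module T = StrictMonoidalCategory 𝐓
      module HC = StrictMonoidalCategory (𝐇 𝒞)

    -- A corner placed beside an identity cell 1_B.  The cells 1_B ∣ α and
    -- α ∣ 1_B have B ⊗ I or I ⊗ B on one side, which is identified with B.
    infix 6 _∣ˢ_ _ˢ∣_ _∣ʳ_ _ʳ∣_
    _∣ˢ_ : ∀ {A Y} B → Cell A unit [] Y → Cell (B ⊗₀ A) B [] Y
    _ˢ∣_ : ∀ {A X} → Cell A unit X [] → ∀ B → Cell (A ⊗₀ B) B X []
    _∣ʳ_ : ∀ {A Y} B → Cell unit A [] Y → Cell B (B ⊗₀ A) [] Y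
    _ʳ∣_ : ∀ {A X} → Cell unit A X [] → ∀ B → Cell B (A ⊗₀ B) X []
    B ∣ˢ α = cast Cell refl (𝔸.⊗₀-identityʳ B) refl refl (idᴴ B ∣ α)
    α ˢ∣ B = cast Cell refl (𝔸.⊗₀-identityˡ B) refl refl (α ∣ idᴴ B)
    B ∣ʳ α = cast Cell (𝔸.⊗₀-identityʳ B) refl refl refl (idᴴ B ∣ α)
    α ʳ∣ B = cast Cell (𝔸.⊗₀-identityˡ B) refl refl refl (α ∣ idᴴ B)

    M₁ : ∀ {X Y} → Term X Y → HC.Hom X Y
    M₁ id               = HC.id
    M₁ (f ⨾ g)          = M₁ f HC.⨾ M₁ g
    M₁ (f ⊗ g)          = M₁ f HC.⊗₁ M₁ g
    M₁ (_⟨°⟩ {A} {B} f) = r° A / ⌜ f ⌝ / s° B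
    M₁ (_⟨•⟩ {A} {B} f) = r• A / ⌜ f ⌝ / s• B
    M₁ (◁ ○ A B)        = r° (A ⊗₀ B) / ⌜ 𝔸.σ A B ⌝ / B ∣ˢ s° A / s° B
    M₁ (▷ ○ A B)        = r° A / r° B ʳ∣ A / ⌜ 𝔸.σ B A ⌝ / s° (A ⊗₀ B)
    M₁ (◁ ● A B)        = r• A / A ∣ʳ r• B / s• (A ⊗₀ B)
    M₁ (▷ ● A B)        = r• (A ⊗₀ B) / s• A ˢ∣ B / s• B
    M₁ (ι ○)            = s° unit
    M₁ (κ ○)            = r° unit
    M₁ (ι ●)            = r• unit
    M₁ (κ ●)            = s• unit
    M₁ (σ ○ A B)        = r° A / r° B ʳ∣ A / ⌜ 𝔸.σ B A ⌝ / A ∣ˢ s° B / s° A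
    M₁ (σ ● A B)        = r• B / B ∣ʳ r• A / ⌜ 𝔸.σ B A ⌝ / s• A ˢ∣ B / s• B
    M₁ (η A)            = r• A / s° A
    M₁ (ε A)            = r° A / s• A

    -- M₁ is defined on terms; it descends to 𝐓 when it respects its equations.
    M-WellDefined : Set (o ⊔ ℓ ⊔ e)
    M-WellDefined = ∀ {X Y} {f g : Term X Y} → f T.≈ g → M₁ f HC.≈ M₁ g

    M : M-WellDefined → StrictMonoidalFunctor 𝐓 (𝐇 𝒞)
    M M₁-cong = record
      { F₀      = λ X → X
      ; F₀-unit = refl
      ; F₀-⊗    = λ _ _ → refl
      ; F₁      = M₁
      ; F₁-cong = M₁-cong
      ; F₁-id   = ≋-refl
      ; F₁-⨾    = λ _ _ → ≋-refl
      ; F₁-⊗    = λ _ _ → ≋-refl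
      }

{-# OPTIONS --safe #-}
module Submission where

-- Every generator of 𝐓 is sent by M to a cell R / ⌜ v ⌝ / S, where R and S are
-- built from corners.  By yanking, such cells compose as their middle parts v
-- do, so every equation of 𝐓 but one becomes a coherence law of 𝔸.  The
-- exception is spatiality: it holds because a vertical wire can be pulled
-- through any cell, so that scalars can be moved past all wires.
--
-- For fullness and faithfulness, a cell α with top A, bottom B, left X and
-- right Y is bent into a term A ° ++ X → Y ++ B ° that represents
-- r° A / α / s° B.  The double category laws hold for these terms in 𝐓, the
-- horizontal composite of cells being formed with (A ⊗ C)° ≅ C° ⊗ A°, so
-- bending respects the equations of 𝒞.  Conjugating by ι ○ and κ ○ then gives
-- an inverse of M on morphisms.  That it fixes the black generators follows
-- from duality: they are the mates of the white ones.

open import Defs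
open import Level using (_⊔_)
open import Data.List.Base using ([]; _∷_; [_]; _++_)
open import Data.List.Properties using (++-assoc; ++-identityʳ)
open import Data.Product.Base using (Σ-syntax; ∃-syntax; _×_; _,_)
open import Relation.Binary.Structures using (IsEquivalence)
open import Relation.Binary.PropositionalEquality using (_≡_; refl; sym; trans; cong; subst; subst₂)


module Coherence {o ℓ e} (𝔸 : SymmetricStrictMonoidalCategory o ℓ e) where
  open SymmetricStrictMonoidalCategory 𝔸
  private module ≈ {A B} = IsEquivalence (≈-equiv {A} {B})

  infix 4 _≈ʰ_
  data _≈ʰ_ {A B} (f : Hom A B) : ∀ {A′ B′} → Hom A′ B′ → Set (ℓ ⊔ e) where
    ⌊_⌋ : ∀ {g : Hom A B} → f ≈ g → f ≈ʰ g

  ≈ʰ-refl : ∀ {A B} {f : Hom A B} → f ≈ʰ f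
  ≈ʰ-refl = ⌊ ≈.refl ⌋

  ≈ʰ-sym : ∀ {A B A′ B′} {f : Hom A B} {g : Hom A′ B′} → f ≈ʰ g → g ≈ʰ f
  ≈ʰ-sym ⌊ p ⌋ = ⌊ ≈.sym p ⌋

  infixr 3 _∙_
  _∙_ : ∀ {A B A′ B′ A″ B″} {f : Hom A B} {g : Hom A′ B′} {h : Hom A″ B″} →
        f ≈ʰ g → g ≈ʰ h → f ≈ʰ h
  ⌊ p ⌋ ∙ ⌊ q ⌋ = ⌊ ≈.trans p q ⌋

  ⨾-congʰ : ∀ {A B C A′ B′ C′} {f : Hom A B} {g : Hom B C} {f′ : Hom A′ B′} {g′ : Hom B′ C′} →
            f ≈ʰ f′ → g ≈ʰ g′ → f ⨾ g ≈ʰ f′ ⨾ g′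
  ⨾-congʰ ⌊ p ⌋ ⌊ q ⌋ = ⌊ ⨾-cong p q ⌋

  idʰ : ∀ {A B} → A ≡ B → id {A} ≈ʰ id {B}
  idʰ refl = ≈ʰ-refl

  recast : ∀ {A B A′ B′} → A ≡ A′ → B ≡ B′ → Hom A B → Hom A′ B′
  recast = subst₂ Hom

  recastʰ : ∀ {A B A′ B′} (p : A ≡ A′) (q : B ≡ B′) {f : Hom A B} → recast p q f ≈ʰ f
  recastʰ refl refl = ≈ʰ-refl

  ⊗-identityˡʰ : ∀ {A B} (f : Hom A B) → id {unit} ⊗₁ f ≈ʰ f
  ⊗-identityˡʰ f = ≈ʰ-sym (recastʰ _ _) ∙ ⌊ ⊗₁-identityˡ f ⌋

  ⊗-identityʳʰ : ∀ {A B} (f : Hom A B) → f ⊗₁ id {unit} ≈ʰ f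
  ⊗-identityʳʰ f = ≈ʰ-sym (recastʰ _ _) ∙ ⌊ ⊗₁-identityʳ f ⌋

  private
    subst-domʰ : ∀ {A A′ B} (p : A ≡ A′) {f : Hom A B} → subst (λ Z → Hom Z B) p f ≈ʰ f
    subst-domʰ refl = ≈ʰ-refl

  σσʰ : ∀ A B → σ A B ⨾ σ B A ≈ʰ id {A ⊗₀ B}
  σσʰ A B = ⌊ σ-involutive A B ⌋

  hexagonˡ : ∀ A B C {c : Hom (A ⊗₀ C ⊗₀ B) ((C ⊗₀ A) ⊗₀ B)} → c ≈ʰ σ A C ⊗₁ id {B} →
             σ (A ⊗₀ B) C ≈ʰ (id {A} ⊗₁ σ B C) ⨾ c
  hexagonˡ A B C {c} h =
    ≈ʰ-sym (recastʰ (⊗₀-assoc A B C) (sym (⊗₀-assoc C A B))) ∙ ⌊ σ-hexagon A B C ⌋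
      ∙ ⨾-congʰ ≈ʰ-refl (subst-domʰ (⊗₀-assoc A C B) ∙ ≈ʰ-sym h)

  private
    ⨾-inverse-unique : ∀ {A B} {f f′ : Hom A B} {g : Hom B A} → f ⨾ g ≈ id → g ⨾ f′ ≈ id → f ≈ f′
    ⨾-inverse-unique {f = f} {f′} {g} p q =
      ≈.trans (≈.sym (⨾-identityʳ f)) (≈.trans (⨾-cong ≈.refl (≈.sym q))
        (≈.trans (≈.sym (⨾-assoc f g f′)) (≈.trans (⨾-cong p ≈.refl) (⨾-identityˡ f′))))

    ⨾-inverse-uniqueʰ : ∀ {A B A′ B′} {f : Hom A B} {f′ : Hom A′ B′} {g : Hom B A} {g′ : Hom B′ A′} →
      A ≡ A′ → B ≡ B′ → g ≈ʰ g′ → f ⨾ g ≈ id → g′ ⨾ f′ ≈ id → f ≈ʰ f′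
    ⨾-inverse-uniqueʰ refl refl ⌊ r ⌋ p q = ⌊ ⨾-inverse-unique p (≈.trans (⨾-cong r ≈.refl) q) ⌋

    middle-cancel : ∀ {A B C} {f : Hom A B} {g : Hom B C} {g′ : Hom C B} {f′ : Hom B A} →
      g ⨾ g′ ≈ id → f ⨾ f′ ≈ id → (f ⨾ g) ⨾ (g′ ⨾ f′) ≈ id
    middle-cancel {f = f} {g} {g′} {f′} p q =
      ≈.trans (⨾-assoc _ _ _) (≈.trans (⨾-cong ≈.refl (≈.trans (≈.sym (⨾-assoc _ _ _))
        (≈.trans (⨾-cong p ≈.refl) (⨾-identityˡ _)))) q)

    σ⊗id-inverse : ∀ A B C → (σ A B ⊗₁ id {C}) ⨾ (σ B A ⊗₁ id {C}) ≈ id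
    σ⊗id-inverse A B C = ≈.trans (≈.sym (⊗₁-⨾ _ _ _ _))
      (≈.trans (⊗₁-cong (σ-involutive A B) (⨾-identityˡ id)) ⊗₁-id)

    id⊗σ-inverse : ∀ A B C → (id {C} ⊗₁ σ A B) ⨾ (id {C} ⊗₁ σ B A) ≈ id
    id⊗σ-inverse A B C = ≈.trans (≈.sym (⊗₁-⨾ _ _ _ _))
      (≈.trans (⊗₁-cong (⨾-identityˡ id) (σ-involutive A B)) ⊗₁-id)

    recast-inverse : ∀ {A B A′ B′} (p : A ≡ A′)
          (q : B ≡ B′) {f : Hom A B} {g : Hom B A} {f′ : Hom A′ B′} {g′ : Hom B′ A′} →
      f′ ≈ʰ f → g′ ≈ʰ g → f ⨾ g ≈ id → f′ ⨾ g′ ≈ id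
    recast-inverse refl refl ⌊ p ⌋ ⌊ q ⌋ r = ≈.trans (⨾-cong p q) r

  hexagonʳ : ∀ A B C {c : Hom ((B ⊗₀ A) ⊗₀ C) (B ⊗₀ C ⊗₀ A)} → c ≈ʰ id {B} ⊗₁ σ A C →
             σ A (B ⊗₀ C) ≈ʰ (σ A B ⊗₁ id {C}) ⨾ c
  hexagonʳ A B C {c} h = ≈ʰ-sym
    (⨾-inverse-uniqueʰ (⊗₀-assoc A B C) (sym (⊗₀-assoc B C A)) inv-eq
      (middle-cancel (recast-inverse (sym (⊗₀-assoc B A C)) refl h (recastʰ refl _) (id⊗σ-inverse A C B))
            (σ⊗id-inverse A B C))
      (σ-involutive (B ⊗₀ C) A))
    where
    d : Hom (B ⊗₀ C ⊗₀ A) ((B ⊗₀ A) ⊗₀ C)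
    d = recast refl (sym (⊗₀-assoc B A C)) (id {B} ⊗₁ σ C A)
    inv-eq : d ⨾ (σ B A ⊗₁ id {C}) ≈ʰ σ (B ⊗₀ C) A
    inv-eq = ⨾-congʰ (recastʰ refl _) (≈ʰ-sym (recastʰ (⊗₀-assoc B A C) refl))
      ∙ ≈ʰ-sym (hexagonˡ B C A (recastʰ _ refl))

  σ-naturalʰ : ∀ {A A′ B B′} (f : Hom A A′) (g : Hom B B′) → (f ⊗₁ g) ⨾ σ A′ B′ ≈ʰ σ A B ⨾ (g ⊗₁ f)
  σ-naturalʰ f g = ⌊ σ-natural f g ⌋

  ⨾-assocʰ : ∀ {A B C D} (f : Hom A B) (g : Hom B C) (h : Hom C D) → (f ⨾ g) ⨾ h ≈ʰ f ⨾ (g ⨾ h)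
  ⨾-assocʰ f g h = ⌊ ⨾-assoc f g h ⌋

  yang-baxter : ∀ A B C → (id {C} ⊗₁ σ A B) ⨾ σ C (B ⊗₀ A) ≈ʰ (σ C A ⊗₁ id {B}) ⨾ σ (A ⊗₀ C) B
  yang-baxter A B C = σ-naturalʰ (id {C}) (σ A B)
    ∙ ⨾-congʰ (hexagonʳ C A B (recastʰ (sym (⊗₀-assoc A C B)) refl)) (≈ʰ-sym (recastʰ (⊗₀-assoc A B C) refl))
    ∙ ⨾-assocʰ _ _ _
    ∙ ⨾-congʰ ≈ʰ-refl (⨾-congʰ (recastʰ _ refl) (recastʰ (⊗₀-assoc A B C) refl
          ∙ ≈ʰ-sym (recastʰ (⊗₀-assoc A B C) refl))
                       ∙ ≈ʰ-sym (hexagonˡ A C B (recastʰ _ refl)))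

  yang-baxter′ : ∀ A B C → σ (A ⊗₀ B) C ⨾ (id {C} ⊗₁ σ A B) ≈ʰ σ A (B ⊗₀ C) ⨾ (σ B C ⊗₁ id {A})
  yang-baxter′ A B C = ≈ʰ-sym (σ-naturalʰ (σ A B) (id {C}))
    ∙ ≈ʰ-sym (yang-baxter B C A) ∙ σ-naturalʰ (id {A}) (σ B C)

  private
    idempotent : ∀ {A B} {f : Hom A B} {f′ : Hom B A} {g : Hom A A} → A ≡ B → f ⨾ f′ ≈ id → 
      g ≈ʰ f → f ≈ʰ g ⨾ f → f ≈ʰ id {B}
    idempotent {f = f} {f′} refl p ⌊ q ⌋ ⌊ r ⌋ = ⌊ ≈.trans (≈.sym (⨾-identityʳ f))
      (≈.trans (⨾-cong ≈.refl (≈.sym p)) (≈.trans (≈.sym (⨾-assoc _ _ _))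
        (≈.trans (⨾-cong (≈.trans (⨾-cong (≈.sym q) ≈.refl) (≈.sym r)) ≈.refl) p))) ⌋

  σ-congʰ : ∀ {A A′ B B′} → A ≡ A′ → B ≡ B′ → σ A B ≈ʰ σ A′ B′
  σ-congʰ refl refl = ≈ʰ-refl

  σ-unitˡ : ∀ A → σ unit A ≈ʰ id {A}
  σ-unitˡ A = idempotent I⊗A≡A⊗I (σ-involutive unit A) (recastʰ refl _)
    (σ-congʰ (sym (⊗₀-identityˡ unit)) refl
      ∙ hexagonˡ unit unit A (recastʰ (⊗₀-assoc unit A unit) refl)
      ∙ ⨾-congʰ (⊗-identityˡʰ _ ∙ ≈ʰ-sym (recastʰ refl (sym I⊗A≡A⊗I)))
                (recastʰ (⊗₀-assoc unit A unit) refl ∙ ⊗-identityʳʰ _))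
    ∙ idʰ (⊗₀-identityʳ A)
    where
    I⊗A≡A⊗I : unit ⊗₀ A ≡ A ⊗₀ unit
    I⊗A≡A⊗I = trans (⊗₀-identityˡ A) (sym (⊗₀-identityʳ A))

  σ-unitʳ : ∀ A → σ A unit ≈ʰ id {A}
  σ-unitʳ A = ≈ʰ-sym ⌊ ⨾-identityʳ _ ⌋
    ∙ ⨾-congʰ ≈ʰ-refl (idʰ (⊗₀-identityˡ A) ∙ ≈ʰ-sym (σ-unitˡ A))
    ∙ σσʰ A unit ∙ idʰ (⊗₀-identityʳ A)

  ⊗-idʰ : ∀ {A B} → id {A} ⊗₁ id {B} ≈ʰ id {A ⊗₀ B}
  ⊗-idʰ = ⌊ ⊗₁-id ⌋

  ⨾-idˡʰ : ∀ {A A′ B C} {f : Hom A′ A} {g : Hom A B} → f ≈ʰ id {C} → f ⨾ g ≈ʰ g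
  ⨾-idˡʰ ⌊ p ⌋ = ⌊ ≈.trans (⨾-cong p ≈.refl) (⨾-identityˡ _) ⌋

  ⨾-idʳʰ : ∀ {A B B′ C} {f : Hom A B} {g : Hom B B′} → g ≈ʰ id {C} → f ⨾ g ≈ʰ f
  ⨾-idʳʰ ⌊ p ⌋ = ⌊ ≈.trans (⨾-cong ≈.refl p) (⨾-identityʳ _) ⌋

  hexagonʳ-⨾ : ∀ {A B C D D′ D″} {w : Hom ((B ⊗₀ C) ⊗₀ A) D} {w′ : Hom (B ⊗₀ C ⊗₀ A) D′}
               {u : Hom ((B ⊗₀ A) ⊗₀ C) D″} → w′ ≈ʰ w → u ≈ʰ (id {B} ⊗₁ σ A C) ⨾ w′ →
               (σ A B ⊗₁ id {C}) ⨾ u ≈ʰ σ A (B ⊗₀ C) ⨾ w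
  hexagonʳ-⨾ {A} {B} {C} p q =
    ⨾-congʰ ≈ʰ-refl (q ∙ ⨾-congʰ (≈ʰ-sym (recastʰ (sym (⊗₀-assoc B A C)) refl)) ≈ʰ-refl)
    ∙ ≈ʰ-sym (⨾-assocʰ _ _ _) ∙ ⨾-congʰ (≈ʰ-sym (hexagonʳ A B C (recastʰ _ refl))) p

  hexagonˡ-⨾ : ∀ {A B C D D′ D″} {w : Hom (C ⊗₀ A ⊗₀ B) D} {w′ : Hom ((C ⊗₀ A) ⊗₀ B) D′}
               {u : Hom (A ⊗₀ C ⊗₀ B) D″} → w′ ≈ʰ w → u ≈ʰ (σ A C ⊗₁ id {B}) ⨾ w′ →
               (id {A} ⊗₁ σ B C) ⨾ u ≈ʰ σ (A ⊗₀ B) C ⨾ w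
  hexagonˡ-⨾ {A} {B} {C} p q =
    ⨾-congʰ ≈ʰ-refl (q ∙ ⨾-congʰ (≈ʰ-sym (recastʰ (⊗₀-assoc A C B) refl)) ≈ʰ-refl)
    ∙ ≈ʰ-sym (⨾-assocʰ _ _ _) ∙ ⨾-congʰ (≈ʰ-sym (hexagonˡ A B C (recastʰ _ refl))) p

module Corners {o ℓ e} (𝔸 : SymmetricStrictMonoidalCategory o ℓ e) where
  private module 𝔸 = SymmetricStrictMonoidalCategory 𝔸
  open 𝔸 using (Obj; unit; _⊗₀_; Hom)
  open Coherence 𝔸 using (_≈ʰ_; ⌊_⌋)
  open FreeCornering 𝔸
  open Functor 𝔸
  private module HC = StrictMonoidalCategory (𝐇 (𝒞 𝔸))

  infixr 3 _∙_
  _∙_ : ∀ {A B X Y A′ B′ X′ Y′ A″ B″ X″ Y″}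
        {α : Cell A B X Y} {β : Cell A′ B′ X′ Y′} {γ : Cell A″ B″ X″ Y″} →
        α ≋ β → β ≋ γ → α ≋ γ
  _∙_ = ≋-trans

  ⌜⌝-congʰ : ∀ {A B A′ B′} {f : Hom A B} {g : Hom A′ B′} → f ≈ʰ g → ⌜ f ⌝ ≋ ⌜ g ⌝
  ⌜⌝-congʰ ⌊ p ⌋ = ⌜⌝-cong p

  uncast : ∀ {A B X Y A′ B′ X′ Y′} {p : A ≡ A′} {q : B ≡ B′} {r : X ≡ X′} {s : Y ≡ Y′}
           {α : Cell A B X Y} → cast Cell p q r s α ≋ α
  uncast {p = p} {q} {r} {s} = cast-≋ p q r s ≋-refl

  ⨾≋∣ : ∀ {X Y Z} {α : HC.Hom X Y} {β : HC.Hom Y Z} → α HC.⨾ β ≋ α ∣ β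
  ⨾≋∣ = uncast

  idᴴ-cong : ∀ {A B} → A ≡ B → idᴴ A ≋ idᴴ B
  idᴴ-cong refl = ≋-refl

  idᴴ-∣-identityˡ : ∀ {A B Y} (α : Cell A B [] Y) → idᴴ unit ∣ α ≋ α
  idᴴ-∣-identityˡ α = ∣-cong idᴴ≋idⱽ ≋-refl ∙ ∣-identityˡ α

  idᴴ-∣-identityʳ : ∀ {A B X} (α : Cell A B X []) → α ∣ idᴴ unit ≋ α
  idᴴ-∣-identityʳ α = ∣-cong ≋-refl idᴴ≋idⱽ ∙ ∣-identityʳ α

  idⱽ-/-identityˡ : ∀ {B X Y} (α : Cell unit B X Y) → idⱽ [] / α ≋ α
  idⱽ-/-identityˡ α = /-cong (≋-sym idᴴ≋idⱽ) ≋-refl ∙ /-identityˡ α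

  idⱽ-/-identityʳ : ∀ {A X Y} (α : Cell A unit X Y) → α / idⱽ [] ≋ α
  idⱽ-/-identityʳ α = /-cong ≋-refl (≋-sym idᴴ≋idⱽ) ∙ /-identityʳ α

  slideˡ : ∀ {A B X Y} (α : Cell A unit [] Y) (β : Cell unit B X []) → α / β ≋ β ∣ α
  slideˡ α β = ≋-sym (∣-cong (≋-sym (/-identityˡ β)) (≋-sym (/-identityʳ α))
    ∙ interchange (idᴴ unit) β α (idᴴ unit)
    ∙ /-cong (idᴴ-∣-identityˡ α) (idᴴ-∣-identityʳ β))

  slideʳ : ∀ {A B X Y} (α : Cell A unit X []) (β : Cell unit B [] Y) → α / β ≋ α ∣ β
  slideʳ α β = ≋-sym (∣-cong (≋-sym (/-identityʳ α)) (≋-sym (/-identityˡ β))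
    ∙ interchange α (idᴴ unit) (idᴴ unit) β
    ∙ /-cong (idᴴ-∣-identityʳ α) (idᴴ-∣-identityˡ β))

  cut° : ∀ {A B C D U V U′ W W′ X Y Z} {S : Cell A unit [] X} {R : Cell unit B X []} {v : Cell A B [] []}
         {γ : Cell C A W Y} {δ : Cell B D Z W′} {α : Cell C unit U V} {β : Cell unit D V U′} →
         S ∣ R ≋ v → α ≋ γ / (S / idⱽ Z) → β ≋ idⱽ Y / (R / δ) → α ∣ β ≋ γ / (v / δ)
  cut° {Y = Y} {Z} {S} {R} {γ = γ} {δ} yank p q = ∣-cong p q
    ∙ interchange γ (S / idⱽ Z) (idⱽ Y) (R / δ)
    ∙ /-cong (∣-identityʳ γ) (interchange S (idⱽ Z) R δ ∙ /-cong yank (∣-identityˡ δ))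

  cut• : ∀ {A B C D U V U′ W W′ X Y Z} {R : Cell unit B [] X} {S : Cell A unit X []} {v : Cell A B [] []}
         {γ : Cell C A Y W} {δ : Cell B D W′ Z} {α : Cell unit D U V} {β : Cell C unit V U′} →
         R ∣ S ≋ v → α ≋ idⱽ Y / (R / δ) → β ≋ γ / (S / idⱽ Z) → α ∣ β ≋ γ / (v / δ)
  cut• {Y = Y} {Z} {R} {S} {γ = γ} {δ} yank p q = ∣-cong p q
    ∙ interchange (idⱽ Y) (R / δ) γ (S / idⱽ Z)
    ∙ /-cong (∣-identityˡ γ) (interchange R δ S (idⱽ Z) ∙ /-cong yank (∣-identityʳ δ))

  record Companion : Set (o ⊔ ℓ ⊔ e) where
    field
      edge : Edge 𝔸
      obj  : Obj
      R    : Cell unit obj edge []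
      S    : Cell obj unit [] edge
      R/S  : R / S ≋ idⱽ edge
      S∣R  : S ∣ R ≋ idᴴ obj

  record Conjoint : Set (o ⊔ ℓ ⊔ e) where
    field
      edge : Edge 𝔸
      obj  : Obj
      R    : Cell unit obj [] edge
      S    : Cell obj unit edge []
      R/S  : R / S ≋ idⱽ edge
      R∣S  : R ∣ S ≋ idᴴ obj

  -- Since S slides past R′, the order of the objects is reversed.
  beside° : ∀ {A B A′ B′ X X′ Y Y′ L L′ N N′} {v : Hom A B} {w : Hom A′ B′}
            {R : Cell unit A X []} {S : Cell B unit [] Y} {R′ : Cell unit A′ X′ []} {S′ : Cell B′ unit [] Y′}
            {α : Cell unit unit L N} {β : Cell unit unit L′ N′} →
            α ≋ R / ⌜ v ⌝ / S → β ≋ R′ / ⌜ w ⌝ / S′ →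
            α / β ≋ (R / (R′ ʳ∣ A)) / ⌜ w 𝔸.⊗₁ v ⌝ / ((B′ ∣ˢ S) / S′)
  beside° {A} {B} {A′} {B′} {v = v} {w} {R} {S} {R′} {S′} p q = /-cong p q
    ∙ /-assoc R _ _
    ∙ /-cong ≋-refl
        (/-cong ≋-refl (≋-sym (/-assoc R′ ⌜ w ⌝ S′))
          ∙ ≋-sym (/-assoc (⌜ v ⌝ / S) (R′ / ⌜ w ⌝) S′)
          ∙ /-cong inner ≋-refl
          ∙ /-assoc (R′ ʳ∣ A) _ S′ ∙ /-cong ≋-refl (/-assoc ⌜ w 𝔸.⊗₁ v ⌝ (B′ ∣ˢ S) S′))
    ∙ ≋-sym (/-assoc R (R′ ʳ∣ A) _)
    where
    inner : (⌜ v ⌝ / S) / (R′ / ⌜ w ⌝) ≋ (R′ ʳ∣ A) / ⌜ w 𝔸.⊗₁ v ⌝ / (B′ ∣ˢ S)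
    inner = slideˡ (⌜ v ⌝ / S) (R′ / ⌜ w ⌝)
      ∙ ∣-cong (/-cong ≋-refl (≋-sym (/-identityʳ ⌜ w ⌝))) (≋-sym (/-identityˡ (⌜ v ⌝ / S)))
      ∙ interchange R′ (⌜ w ⌝ / idᴴ B′) (idᴴ A) (⌜ v ⌝ / S)
      ∙ /-cong (≋-sym uncast)
          (interchange ⌜ w ⌝ (idᴴ B′) ⌜ v ⌝ S ∙ /-cong (⌜⌝-⊗ w v) (≋-sym uncast))

  beside• : ∀ {A B A′ B′ X X′ Y Y′ L L′ N N′} {v : Hom A B} {w : Hom A′ B′}
            {R : Cell unit A [] X} {S : Cell B unit Y []} {R′ : Cell unit A′ [] X′} {S′ : Cell B′ unit Y′ []}
            {α : Cell unit unit L N} {β : Cell unit unit L′ N′} →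
            α ≋ R / ⌜ v ⌝ / S → β ≋ R′ / ⌜ w ⌝ / S′ →
            α / β ≋ (R / (A ∣ʳ R′)) / ⌜ v 𝔸.⊗₁ w ⌝ / ((S ˢ∣ B′) / S′)
  beside• {A} {B} {A′} {B′} {v = v} {w} {R} {S} {R′} {S′} p q = /-cong p q
    ∙ /-assoc R _ _
    ∙ /-cong ≋-refl
        (/-cong ≋-refl (≋-sym (/-assoc R′ ⌜ w ⌝ S′))
          ∙ ≋-sym (/-assoc (⌜ v ⌝ / S) (R′ / ⌜ w ⌝) S′)
          ∙ /-cong inner ≋-refl
          ∙ /-assoc (A ∣ʳ R′) _ S′ ∙ /-cong ≋-refl (/-assoc ⌜ v 𝔸.⊗₁ w ⌝ (S ˢ∣ B′) S′))
    ∙ ≋-sym (/-assoc R (A ∣ʳ R′) _)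
    where
    inner : (⌜ v ⌝ / S) / (R′ / ⌜ w ⌝) ≋ (A ∣ʳ R′) / ⌜ v 𝔸.⊗₁ w ⌝ / (S ˢ∣ B′)
    inner = slideʳ (⌜ v ⌝ / S) (R′ / ⌜ w ⌝)
      ∙ ∣-cong (≋-sym (/-identityˡ (⌜ v ⌝ / S))) (/-cong ≋-refl (≋-sym (/-identityʳ ⌜ w ⌝)))
      ∙ interchange (idᴴ A) (⌜ v ⌝ / S) R′ (⌜ w ⌝ / idᴴ B′)
      ∙ /-cong (≋-sym uncast)
          (interchange ⌜ v ⌝ S ⌜ w ⌝ (idᴴ B′) ∙ /-cong (⌜⌝-⊗ v w) (≋-sym uncast))

  /-⌜id⌝ : ∀ {A B C X Y X′ Y′} (α : Cell B A X Y) (β : Cell A C X′ Y′) → α / β ≋ α / ⌜ 𝔸.id ⌝ / β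
  /-⌜id⌝ α β = /-cong ≋-refl (≋-sym (/-cong (⌜⌝-id _) ≋-refl ∙ /-identityˡ β))

  rep-id° : (P : Companion) → let open Companion P in idⱽ edge ≋ R / ⌜ 𝔸.id ⌝ / S
  rep-id° P = ≋-sym R/S ∙ /-⌜id⌝ R S
    where open Companion P

  rep-id• : (P : Conjoint) → let open Conjoint P in idⱽ edge ≋ R / ⌜ 𝔸.id ⌝ / S
  rep-id• P = ≋-sym R/S ∙ /-⌜id⌝ R S
    where open Conjoint P

  infixr 7 _⊙_ _⊛_
  _⊙_ : Companion → Companion → Companion
  P ⊙ Q = record
    { edge = P.edge ++ Q.edge
    ; obj  = Q.obj ⊗₀ P.obj
    ; R    = P.R / (Q.R ʳ∣ P.obj)
    ; S    = (Q.obj ∣ˢ P.S) / Q.S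
    ; R/S  = /-cong ≋-refl (≋-sym (/-cong (⌜⌝-cong 𝔸.⊗₁-id ∙ ⌜⌝-id _) ≋-refl ∙ /-identityˡ _))
             ∙ ≋-sym (beside° (rep-id° P) (rep-id° Q)) ∙ idⱽ-/ P.edge Q.edge
    ; S∣R  = interchange (Q.obj ∣ˢ P.S) Q.S P.R (Q.R ʳ∣ P.obj)
             ∙ /-cong (∣-cong uncast ≋-refl ∙ ∣-assoc _ _ _ ∙ ∣-cong ≋-refl P.S∣R ∙ idᴴ-∣ _ _)
                      (∣-cong ≋-refl uncast ∙ ≋-sym (∣-assoc _ _ _) ∙ ∣-cong Q.S∣R ≋-refl ∙ idᴴ-∣ _ _)
             ∙ /-identityˡ _
    }
    where
    module P = Companion P
    module Q = Companion Q

  _⊛_ : Conjoint → Conjoint → Conjoint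
  P ⊛ Q = record
    { edge = P.edge ++ Q.edge
    ; obj  = P.obj ⊗₀ Q.obj
    ; R    = P.R / (P.obj ∣ʳ Q.R)
    ; S    = (P.S ˢ∣ Q.obj) / Q.S
    ; R/S  = /-cong ≋-refl (≋-sym (/-cong (⌜⌝-cong 𝔸.⊗₁-id ∙ ⌜⌝-id _) ≋-refl ∙ /-identityˡ _))
             ∙ ≋-sym (beside• (rep-id• P) (rep-id• Q)) ∙ idⱽ-/ P.edge Q.edge
    ; R∣S  = interchange P.R (P.obj ∣ʳ Q.R) (P.S ˢ∣ Q.obj) Q.S
             ∙ /-cong (∣-cong ≋-refl uncast ∙ ≋-sym (∣-assoc _ _ _) ∙ ∣-cong P.R∣S ≋-refl ∙ idᴴ-∣ _ _)
                      (∣-cong uncast ≋-refl ∙ ∣-assoc _ _ _ ∙ ∣-cong ≋-refl Q.R∣S ∙ idᴴ-∣ _ _)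
             ∙ /-identityˡ _
    }
    where
    module P = Conjoint P
    module Q = Conjoint Q

  ⟨_⟩° : Obj → Companion
  ⟨ A ⟩° = record { R = r° A ; S = s° A ; R/S = yank-°-/ A ; S∣R = yank-°-∣ A }

  ⟨_⟩• : Obj → Conjoint
  ⟨ A ⟩• = record { R = r• A ; S = s• A ; R/S = yank-•-/ A ; R∣S = yank-•-∣ A }

  I° : Companion
  I° = record
    { R = idᴴ unit ; S = idᴴ unit ; R/S = /-identityˡ _ ∙ idᴴ≋idⱽ ; S∣R = idᴴ-∣-identityˡ _ }

  I• : Conjoint
  I• = record
    { R = idᴴ unit ; S = idᴴ unit ; R/S = /-identityˡ _ ∙ idᴴ≋idⱽ ; R∣S = idᴴ-∣-identityˡ _ }

  module _ (P : Companion) where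
    open Companion P

    rep-⨾°ʷ : ∀ {A B X Y U V W L N} {T : Cell unit A X Y} {v : Hom A obj} {w : Hom obj B} {E : Cell B unit U V}
             {α : Cell unit unit L N} {β : Cell unit unit N W} →
             α ≋ (T / ⌜ v ⌝ / S) / idⱽ U → β ≋ idⱽ Y / (R / ⌜ w ⌝ / E) →
             α HC.⨾ β ≋ T / ⌜ v 𝔸.⨾ w ⌝ / E
    rep-⨾°ʷ {U = U} {T = T} {v} {w} {E} p q = ⨾≋∣
      ∙ cut° v/S∣R (p ∙ /-assoc T _ (idⱽ U)) q
      ∙ /-cong ≋-refl (≋-sym (/-assoc ⌜ v ⌝ ⌜ w ⌝ E) ∙ /-cong (⌜⌝-⨾ v w) ≋-refl)
      where
      v/S∣R : (⌜ v ⌝ / S) ∣ R ≋ ⌜ v ⌝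
      v/S∣R = ∣-cong ≋-refl (≋-sym (/-identityˡ R)) ∙ interchange ⌜ v ⌝ S (idᴴ unit) R
        ∙ /-cong (idᴴ-∣-identityʳ _) S∣R ∙ /-identityʳ _

    rep-⨾° : ∀ {A B X V W L N} {T : Cell unit A X []} {v : Hom A obj} {w : Hom obj B} {E : Cell B unit [] V}
             {α : Cell unit unit L N} {β : Cell unit unit N W} →
             α ≋ T / ⌜ v ⌝ / S → β ≋ R / ⌜ w ⌝ / E → α HC.⨾ β ≋ T / ⌜ v 𝔸.⨾ w ⌝ / E
    rep-⨾° p q = rep-⨾°ʷ (p ∙ ≋-sym (idⱽ-/-identityʳ _)) (q ∙ ≋-sym (idⱽ-/-identityˡ _))

  module _ (P : Conjoint) where
    open Conjoint P

    rep-⨾•ʷ : ∀ {A B X Y U V W L N} {T : Cell unit A X Y} {v : Hom A obj} {w : Hom obj B} {E : Cell B unit U V}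
             {α : Cell unit unit L N} {β : Cell unit unit N W} →
             α ≋ idⱽ X / (R / ⌜ w ⌝ / E) → β ≋ (T / ⌜ v ⌝ / S) / idⱽ V →
             α HC.⨾ β ≋ T / ⌜ v 𝔸.⨾ w ⌝ / E
    rep-⨾•ʷ {V = V} {T = T} {v} {w} {E} p q = ⨾≋∣
      ∙ cut• R∣v/S p (q ∙ /-assoc T _ (idⱽ V))
      ∙ /-cong ≋-refl (≋-sym (/-assoc ⌜ v ⌝ ⌜ w ⌝ E) ∙ /-cong (⌜⌝-⨾ v w) ≋-refl)
      where
      R∣v/S : R ∣ (⌜ v ⌝ / S) ≋ ⌜ v ⌝
      R∣v/S = ∣-cong (≋-sym (/-identityˡ R)) ≋-refl ∙ interchange (idᴴ unit) R ⌜ v ⌝ S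
        ∙ /-cong (idᴴ-∣-identityˡ _) R∣S ∙ /-identityʳ _

    rep-⨾• : ∀ {A B Y U W L N} {T : Cell unit A [] Y} {v : Hom A obj} {w : Hom obj B} {E : Cell B unit U []}
             {α : Cell unit unit L N} {β : Cell unit unit N W} →
             α ≋ R / ⌜ w ⌝ / E → β ≋ T / ⌜ v ⌝ / S → α HC.⨾ β ≋ T / ⌜ v 𝔸.⨾ w ⌝ / E
    rep-⨾• p q = rep-⨾•ʷ (p ∙ ≋-sym (idⱽ-/-identityˡ _)) (q ∙ ≋-sym (idⱽ-/-identityʳ _))

  rep-cong : ∀ {A B A′ B′ X Y Z W X′ Y′ Z′ W′} {T : Cell unit A X Y} {v : Hom A B} {E : Cell B unit Z W}
             {T′ : Cell unit A′ X′ Y′} {v′ : Hom A′ B′} {E′ : Cell B′ unit Z′ W′} →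
             T ≋ T′ → v ≈ʰ v′ → E ≋ E′ → T / ⌜ v ⌝ / E ≋ T′ / ⌜ v′ ⌝ / E′
  rep-cong t p e = /-cong t (/-cong (⌜⌝-congʰ p) e)

  record _≅°_ (P Q : Companion) : Set (o ⊔ ℓ ⊔ e) where
    private module P = Companion P
    private module Q = Companion Q
    field
      R≋ : P.R ≋ Q.R
      S≋ : P.S ≋ Q.S

    obj≡ : P.obj ≡ Q.obj
    obj≡ = let (_ , p) , _ = ≋-boundaries R≋ in p

  record _≅•_ (P Q : Conjoint) : Set (o ⊔ ℓ ⊔ e) where
    private module P = Conjoint P
    private module Q = Conjoint Q
    field
      R≋ : P.R ≋ Q.R
      S≋ : P.S ≋ Q.S

    obj≡ : P.obj ≡ Q.obj
    obj≡ = let (_ , p) , _ = ≋-boundaries R≋ in p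

  ≅°-sym : ∀ {P Q} → P ≅° Q → Q ≅° P
  ≅°-sym h = record { R≋ = ≋-sym R≋ ; S≋ = ≋-sym S≋ } where open _≅°_ h

  ≅•-sym : ∀ {P Q} → P ≅• Q → Q ≅• P
  ≅•-sym h = record { R≋ = ≋-sym R≋ ; S≋ = ≋-sym S≋ } where open _≅•_ h

  ⊙-assoc : ∀ P Q T → ((P ⊙ Q) ⊙ T) ≅° (P ⊙ (Q ⊙ T))
  ⊙-assoc P Q T = record
    { R≋ = /-assoc _ _ _ ∙ /-cong ≋-refl (≋-sym
        (uncast ∙ ∣-cong ≋-refl (≋-sym (/-identityˡ _)) ∙ interchange _ _ _ _
          ∙ /-cong (≋-sym uncast)
              (∣-cong uncast ≋-refl ∙ ∣-assoc _ _ _ ∙ ∣-cong ≋-refl (idᴴ-∣ _ _) ∙ ≋-sym uncast)))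
    ; S≋ = ≋-sym (≋-sym (/-assoc _ _ _) ∙ /-cong (≋-sym
        (uncast ∙ ∣-cong (≋-sym (/-identityˡ _)) ≋-refl ∙ interchange _ _ _ _
          ∙ /-cong
              (∣-cong ≋-refl uncast ∙ ≋-sym (∣-assoc _ _ _) ∙ ∣-cong (idᴴ-∣ _ _) ≋-refl ∙ ≋-sym uncast)
              (≋-sym uncast)))
        ≋-refl)
    }

  ⊛-assoc : ∀ P Q T → ((P ⊛ Q) ⊛ T) ≅• (P ⊛ (Q ⊛ T))
  ⊛-assoc P Q T = record
    { R≋ = /-assoc _ _ _ ∙ /-cong ≋-refl (≋-sym
        (uncast ∙ ∣-cong (≋-sym (/-identityˡ _)) ≋-refl ∙ interchange _ _ _ _
          ∙ /-cong (≋-sym uncast)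
              (∣-cong ≋-refl uncast ∙ ≋-sym (∣-assoc _ _ _) ∙ ∣-cong (idᴴ-∣ _ _) ≋-refl ∙ ≋-sym uncast)))
    ; S≋ = ≋-sym (≋-sym (/-assoc _ _ _) ∙ /-cong (≋-sym
        (uncast ∙ ∣-cong ≋-refl (≋-sym (/-identityˡ _)) ∙ interchange _ _ _ _
          ∙ /-cong
              (∣-cong uncast ≋-refl ∙ ∣-assoc _ _ _ ∙ ∣-cong ≋-refl (idᴴ-∣ _ _) ∙ ≋-sym uncast)
              (≋-sym uncast)))
        ≋-refl)
    }

  ⊙-identityˡ : ∀ P → (I° ⊙ P) ≅° P
  ⊙-identityˡ P = record
    { R≋ = /-identityˡ _ ∙ uncast ∙ idᴴ-∣-identityʳ _
    ; S≋ = /-cong (uncast ∙ idᴴ-∣ _ unit ∙ idᴴ-cong (𝔸.⊗₀-identityʳ _)) ≋-refl ∙ /-identityˡ _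
    }

  ⊙-identityʳ : ∀ P → (P ⊙ I°) ≅° P
  ⊙-identityʳ P = record
    { R≋ = /-cong ≋-refl (uncast ∙ idᴴ-∣ unit _ ∙ idᴴ-cong (𝔸.⊗₀-identityˡ _)) ∙ /-identityʳ _
    ; S≋ = /-identityʳ _ ∙ uncast ∙ idᴴ-∣-identityˡ _
    }

  ⊛-identityˡ : ∀ P → (I• ⊛ P) ≅• P
  ⊛-identityˡ P = record
    { R≋ = /-identityˡ _ ∙ uncast ∙ idᴴ-∣-identityˡ _
    ; S≋ = /-cong (uncast ∙ idᴴ-∣ unit _ ∙ idᴴ-cong (𝔸.⊗₀-identityˡ _)) ≋-refl ∙ /-identityˡ _
    }

  ⊛-identityʳ : ∀ P → (P ⊛ I•) ≅• P
  ⊛-identityʳ P = record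
    { R≋ = /-cong ≋-refl (uncast ∙ idᴴ-∣ _ unit ∙ idᴴ-cong (𝔸.⊗₀-identityʳ _)) ∙ /-identityʳ _
    ; S≋ = /-identityʳ _ ∙ uncast ∙ idᴴ-∣-identityʳ _
    }

module Crossing {o ℓ e} (𝔸 : SymmetricStrictMonoidalCategory o ℓ e) where
  open SymmetricStrictMonoidalCategory 𝔸 using
        (Obj; unit; _⊗₀_; Hom; _⊗₁_; id; σ; ⊗₀-identityˡ; ⊗₀-identityʳ; ⊗₀-assoc)
  open Coherence 𝔸 renaming (_∙_ to _◾_)
  open FreeCornering 𝔸
  open Functor 𝔸
  open Corners 𝔸

  χ₁ : ∀ A p C → Cell C C [ A , p ] [ A , p ]
  χ₁ A ○ C = (r° A ʳ∣ C) / ⌜ σ A C ⌝ / (C ∣ˢ s° A)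
  χ₁ A ● C = (C ∣ʳ r• A) / ⌜ σ C A ⌝ / (s• A ˢ∣ C)

  χ : ∀ X C → Cell C C X X
  χ []            C = idᴴ C
  χ ((A , p) ∷ X) C = χ₁ A p C / χ X C

  χ-++ : ∀ X Y C → χ (X ++ Y) C ≋ χ X C / χ Y C
  χ-++ [] Y C = ≋-sym (/-identityˡ _)
  χ-++ ((A , p) ∷ X) Y C = /-cong ≋-refl (χ-++ X Y C) ∙ ≋-sym (/-assoc (χ₁ A p C) (χ X C) (χ Y C))

  private
    χ₁≋χ : ∀ A p C → χ [ A , p ] C ≋ χ₁ A p C
    χ₁≋χ A p C = /-identityʳ _

    ⌜σσ⌝-cancelˡ : ∀ {A B C X Y} (α : Cell (A ⊗₀ B) C X Y) → ⌜ σ A B ⌝ / ⌜ σ B A ⌝ / α ≋ α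
    ⌜σσ⌝-cancelˡ α = ≋-sym (/-assoc _ _ α) ∙ /-cong (⌜⌝-⨾ _ _ ∙ ⌜⌝-congʰ (σσʰ _ _) ∙ ⌜⌝-id _) ≋-refl ∙ /-identityˡ α

    ⌜σσ⌝-cancelʳ : ∀ {A B C X Y} (α : Cell C (A ⊗₀ B) X Y) → (α / ⌜ σ A B ⌝) / ⌜ σ B A ⌝ ≋ α
    ⌜σσ⌝-cancelʳ α = /-assoc α _ _ ∙ /-cong ≋-refl (⌜⌝-⨾ _ _ ∙ ⌜⌝-congʰ (σσʰ _ _) ∙ ⌜⌝-id _) ∙ /-identityʳ α

    ⌜σ⌝-unitʳ : ∀ {C D} → C ≡ D → ⌜ σ C unit ⌝ ≋ idᴴ D
    ⌜σ⌝-unitʳ refl = ⌜⌝-congʰ (σ-unitʳ _) ∙ ⌜⌝-id _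

  crossing : ∀ {A B X Y} (α : Cell A B X Y) C →
             (χ X C ∣ α) / ⌜ σ C B ⌝ ≋ ⌜ σ C A ⌝ / (α ∣ χ Y C)
  crossing (_∣_ {A} {B} {A′} {B′} {X} {Y} {Z} α β) C =
    /-cong (≋-sym (∣-assoc (χ X C) α β)) (⌜⌝-congʰ (hexagonʳ C B B′ {c} (recastʰ _ refl))
          ∙ ≋-sym (⌜⌝-⨾ _ c) ∙ /-cong (≋-sym (⌜⌝-⊗ (σ C B) id)) ≋-refl)
    ∙ ≋-sym (/-assoc ((χ X C ∣ α) ∣ β) (⌜ σ C B ⌝ ∣ ⌜ id ⌝) ⌜ c ⌝)
    ∙ /-cong
        (≋-sym (interchange (χ X C ∣ α) ⌜ σ C B ⌝ β ⌜ id ⌝)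
          ∙ ∣-cong (crossing α C) (/-cong ≋-refl (⌜⌝-id _) ∙ /-identityʳ β ∙ ≋-sym (/-identityˡ β)
                ∙ /-cong (≋-sym (⌜⌝-id _)) ≋-refl)
          ∙ interchange ⌜ σ C A ⌝ (α ∣ χ Y C) ⌜ id ⌝ β)
        ≋-refl
    ∙ /-assoc (⌜ σ C A ⌝ ∣ ⌜ id ⌝) ((α ∣ χ Y C) ∣ β) ⌜ c ⌝
    ∙ /-cong (⌜⌝-⊗ (σ C A) id)
        (/-cong (∣-assoc α (χ Y C) β) (⌜⌝-congʰ (recastʰ _ refl) ∙ ≋-sym (⌜⌝-⊗ id (σ C B′)))
          ∙ ≋-sym (interchange α ⌜ id ⌝ (χ Y C ∣ β) ⌜ σ C B′ ⌝)
          ∙ ∣-cong (/-cong ≋-refl (⌜⌝-id _) ∙ /-identityʳ α ∙ ≋-sym (/-identityˡ α)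
                ∙ /-cong (≋-sym (⌜⌝-id _)) ≋-refl) (crossing β C)
          ∙ interchange ⌜ id ⌝ α ⌜ σ C A′ ⌝ (β ∣ χ Z C)
          ∙ /-cong (⌜⌝-⊗ id (σ C A′) ∙ ⌜⌝-congʰ (≈ʰ-sym (recastʰ (sym (⊗₀-assoc A C A′)) refl))) ≋-refl)
    ∙ ≋-sym (/-assoc ⌜ σ C A ⊗₁ id ⌝ ⌜ c′ ⌝ (α ∣ (β ∣ χ Z C)))
    ∙ /-cong (⌜⌝-⨾ _ c′ ∙ ⌜⌝-congʰ (≈ʰ-sym (hexagonʳ C A A′ {c′} (recastʰ _ refl)))) (≋-sym (∣-assoc α β (χ Z C)))
    where
    c : Hom ((B ⊗₀ C) ⊗₀ B′) (B ⊗₀ B′ ⊗₀ C)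
    c = recast (sym (⊗₀-assoc B C B′)) refl (id ⊗₁ σ C B′)
    c′ : Hom ((A ⊗₀ C) ⊗₀ A′) (A ⊗₀ A′ ⊗₀ C)
    c′ = recast (sym (⊗₀-assoc A C A′)) refl (id ⊗₁ σ C A′)
  crossing (_/_ {A} {B} {D} {X} {Y} {Z} {W} α β) C =
    /-cong (∣-cong (χ-++ X Z C) ≋-refl ∙ interchange (χ X C) (χ Z C) α β) ≋-refl
    ∙ /-assoc (χ X C ∣ α) (χ Z C ∣ β) ⌜ σ C D ⌝
    ∙ /-cong ≋-refl (crossing β C)
    ∙ ≋-sym (/-assoc (χ X C ∣ α) ⌜ σ C B ⌝ (β ∣ χ W C))
    ∙ /-cong (crossing α C) ≋-refl
    ∙ /-assoc ⌜ σ C A ⌝ (α ∣ χ Y C) (β ∣ χ W C)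
    ∙ /-cong ≋-refl (≋-sym (interchange α β (χ Y C) (χ W C)) ∙ ∣-cong ≋-refl (≋-sym (χ-++ Y W C)))
  crossing (idᴴ A) C = /-cong (idᴴ-∣ C A) ≋-refl ∙ /-identityˡ _ ∙ ≋-sym (/-identityʳ _)
        ∙ /-cong ≋-refl (≋-sym (idᴴ-∣ A C))
  crossing (idⱽ X) C =
    /-cong (∣-identityʳ _) (⌜σ⌝-unitʳ refl) ∙ /-identityʳ _
    ∙ ≋-sym (/-cong (⌜σ⌝-unitʳ refl) (∣-identityˡ _) ∙ /-identityˡ _)
  crossing (s° A) C =
    /-cong ≋-refl (⌜σ⌝-unitʳ (sym (⊗₀-identityʳ C))) ∙ /-identityʳ _ ∙ ≋-sym uncast ∙ ≋-sym (⌜σσ⌝-cancelˡ (C ∣ˢ s° A))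
    ∙ /-cong ≋-refl (≋-sym
        (∣-cong (≋-sym (/-identityʳ (s° A))) (χ₁≋χ A ○ C)
          ∙ interchange (s° A) (idᴴ unit) (r° A ʳ∣ C) (⌜ σ A C ⌝ / (C ∣ˢ s° A))
          ∙ /-cong (∣-cong ≋-refl uncast ∙ ≋-sym (∣-assoc _ _ _) ∙ ∣-cong (yank-°-∣ A) ≋-refl ∙ idᴴ-∣ A C)
                   (idᴴ-∣-identityˡ _)
          ∙ /-identityˡ _))
  crossing (r° A) C =
    /-cong (∣-cong (χ₁≋χ A ○ C) (≋-sym (/-identityˡ _ ∙ /-identityˡ (r° A)))
      ∙ interchange (r° A ʳ∣ C) (⌜ σ A C ⌝ / (C ∣ˢ s° A)) (idᴴ unit) (idᴴ unit / r° A)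
      ∙ /-cong (idᴴ-∣-identityʳ _) (interchange ⌜ σ A C ⌝ (C ∣ˢ s° A) (idᴴ unit) (r° A)
          ∙ /-cong (idᴴ-∣-identityʳ _) (∣-cong uncast ≋-refl ∙ ∣-assoc _ _ _ ∙ ∣-cong ≋-refl (yank-°-∣ A) ∙ idᴴ-∣ C A)
          ∙ /-identityʳ _)) ≋-refl
    ∙ ⌜σσ⌝-cancelʳ (r° A ʳ∣ C) ∙ uncast
    ∙ ≋-sym (/-cong (⌜σ⌝-unitʳ (sym (⊗₀-identityˡ C))) ≋-refl ∙ /-identityˡ _)
  crossing (s• A) C =
    /-cong (∣-cong (χ₁≋χ A ● C) (≋-sym (/-identityʳ (s• A)))
      ∙ interchange (C ∣ʳ r• A) (⌜ σ C A ⌝ / (s• A ˢ∣ C)) (s• A) (idᴴ unit)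
      ∙ /-cong (∣-cong uncast ≋-refl ∙ ∣-assoc _ _ _ ∙ ∣-cong ≋-refl (yank-•-∣ A) ∙ idᴴ-∣ C A) (idᴴ-∣-identityʳ _)
      ∙ /-identityˡ _) (⌜σ⌝-unitʳ refl) ∙ /-identityʳ _ ∙ /-cong ≋-refl uncast
  crossing (r• A) C = ≋-sym
    (/-cong (⌜σ⌝-unitʳ refl)
      (∣-cong (≋-sym (/-identityˡ _ ∙ /-identityˡ (r• A))) (χ₁≋χ A ● C)
        ∙ interchange (idᴴ unit) (idᴴ unit / r• A) (C ∣ʳ r• A) (⌜ σ C A ⌝ / (s• A ˢ∣ C))
        ∙ /-cong (idᴴ-∣-identityˡ _) (interchange (idᴴ unit) (r• A) ⌜ σ C A ⌝ (s• A ˢ∣ C)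
            ∙ /-cong (idᴴ-∣-identityˡ _) (∣-cong ≋-refl uncast ∙ ≋-sym (∣-assoc _ _ _)
                  ∙ ∣-cong (yank-•-∣ A) ≋-refl ∙ idᴴ-∣ A C)
            ∙ /-identityʳ _))
      ∙ /-identityˡ _ ∙ /-cong uncast ≋-refl)
  crossing ⌜ f ⌝ C = /-cong (∣-cong (≋-sym (⌜⌝-id C)) ≋-refl ∙ ⌜⌝-⊗ id f) ≋-refl ∙ ⌜⌝-⨾ _ _
        ∙ ⌜⌝-congʰ (σ-naturalʰ id f)
    ∙ ≋-sym (⌜⌝-⨾ _ _) ∙ /-cong ≋-refl (≋-sym (⌜⌝-⊗ f id) ∙ ∣-cong ≋-refl (⌜⌝-id C))

  idᴴ-∣-comm : ∀ (h : Cell unit unit [] []) C → idᴴ C ∣ h ≋ h ∣ idᴴ C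
  idᴴ-∣-comm h C =
    ≋-sym (/-cong ≋-refl (⌜σ⌝-unitʳ (sym (⊗₀-identityʳ C))) ∙ /-identityʳ _)
    ∙ crossing h C
    ∙ /-cong (⌜σ⌝-unitʳ (sym (⊗₀-identityˡ C))) ≋-refl ∙ /-identityˡ _

  /-idⱽ-comm : ∀ (h : Cell unit unit [] []) X → h / idⱽ X ≋ idⱽ X / h
  /-idⱽ-comm h [] = idⱽ-/-identityʳ h ∙ ≋-sym (idⱽ-/-identityˡ h)
  /-idⱽ-comm h ((A , p) ∷ X) =
    /-cong ≋-refl (≋-sym (idⱽ-/ [ A , p ] X))
    ∙ ≋-sym (/-assoc h _ _) ∙ /-cong (single p) ≋-refl ∙ /-assoc (idⱽ [ A , p ]) h (idⱽ X)
    ∙ /-cong ≋-refl (/-idⱽ-comm h X) ∙ ≋-sym (/-assoc (idⱽ [ A , p ]) (idⱽ X) h)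
    ∙ /-cong (idⱽ-/ [ A , p ] X) ≋-refl
    where
    hᴬ : Cell A A [] []
    hᴬ = cast Cell (⊗₀-identityʳ A) (⊗₀-identityʳ A) refl refl (idᴴ A ∣ h)

    past : ∀ {Y Y′ Z Z′} (r : Cell unit A Y Y′) (s : Cell A unit Z Z′) →
           h / r ≋ r / hᴬ → hᴬ / s ≋ s / h → h / (r / s) ≋ (r / s) / h
    past r s p q = ≋-sym (/-assoc h r s) ∙ /-cong p ≋-refl ∙ /-assoc r hᴬ s
      ∙ /-cong ≋-refl q ∙ ≋-sym (/-assoc r s h)

    single : ∀ p → h / idⱽ [ A , p ] ≋ idⱽ [ A , p ] / h
    single ○ = /-cong ≋-refl (≋-sym (yank-°-/ A))
      ∙ past (r° A) (s° A)
          (slideˡ h (r° A) ∙ ∣-cong (≋-sym (/-identityʳ (r° A))) (≋-sym (/-identityˡ h))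
            ∙ interchange (r° A) (idᴴ A) (idᴴ unit) h ∙ /-cong (idᴴ-∣-identityʳ (r° A)) (≋-sym uncast))
          (≋-sym (slideˡ (s° A) h ∙ ∣-cong (≋-sym (/-identityʳ h)) (≋-sym (/-identityˡ (s° A)))
            ∙ interchange h (idᴴ unit) (idᴴ A) (s° A)
            ∙ /-cong (≋-sym (idᴴ-∣-comm h A) ∙ ≋-sym uncast) (idᴴ-∣-identityˡ (s° A))))
      ∙ /-cong (yank-°-/ A) ≋-refl
    single ● = /-cong ≋-refl (≋-sym (yank-•-/ A))
      ∙ past (r• A) (s• A)
          (slideʳ h (r• A) ∙ ∣-cong (≋-sym (/-identityˡ h)) (≋-sym (/-identityʳ (r• A)))
            ∙ interchange (idᴴ unit) h (r• A) (idᴴ A)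
            ∙ /-cong (idᴴ-∣-identityˡ (r• A)) (≋-sym (idᴴ-∣-comm h A) ∙ ≋-sym uncast))
          (≋-sym (slideʳ (s• A) h ∙ ∣-cong (≋-sym (/-identityˡ (s• A))) (≋-sym (/-identityʳ h))
            ∙ interchange (idᴴ A) (s• A) h (idᴴ unit) ∙ /-cong (≋-sym uncast) (idᴴ-∣-identityʳ (s• A))))
      ∙ /-cong (yank-•-/ A) ≋-refl

module Soundness {o ℓ e} (𝔸 : SymmetricStrictMonoidalCategory o ℓ e) where
  private module 𝔸 = SymmetricStrictMonoidalCategory 𝔸
  open 𝔸 using (Obj; unit; _⊗₀_; Hom; _⊗₁_; _⨾_; id)
  open Coherence 𝔸 renaming (_∙_ to _◾_)
  open FreeCornering 𝔸
  open Functor 𝔸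
  open Corners 𝔸
  private module HC = StrictMonoidalCategory (𝐇 (𝒞 𝔸))
  module T = Presentation 𝔸
  open T using (Term; 1[_]; ◁; ▷; ι; κ; σ; η; ε; N; E; _⟨°⟩; _⟨•⟩)

  module _ (P Q : Companion) where
    private module P = Companion P
    private module Q = Companion Q

    rep-⨾°≅ : ∀ {A B X V W L N} {T : Cell unit A X []} {v : Hom A P.obj} {w : Hom Q.obj B} {E : Cell B unit [] V}
              {α : Cell unit unit L N} {β : Cell unit unit N W} (eq : Q ≅° P) →
              α ≋ T / ⌜ v ⌝ / P.S → β ≋ Q.R / ⌜ w ⌝ / E →
              α HC.⨾ β ≋ T / ⌜ v ⨾ recast (_≅°_.obj≡ eq) refl w ⌝ / E
    rep-⨾°≅ eq p q = rep-⨾° P p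
      (q ∙ rep-cong (_≅°_.R≋ eq) (≈ʰ-sym (recastʰ (_≅°_.obj≡ eq) refl)) ≋-refl)

  module _ (P Q : Conjoint) where
    private module P = Conjoint P
    private module Q = Conjoint Q

    rep-⨾•≅ : ∀ {A B Y U W L N} {T : Cell unit A [] Y} {v : Hom A Q.obj} {w : Hom P.obj B} {E : Cell B unit U []}
              {α : Cell unit unit L N} {β : Cell unit unit N W} (eq : P ≅• Q) →
              α ≋ P.R / ⌜ w ⌝ / E → β ≋ T / ⌜ v ⌝ / Q.S →
              α HC.⨾ β ≋ T / ⌜ v ⨾ recast (_≅•_.obj≡ eq) refl w ⌝ / E
    rep-⨾•≅ eq p q = rep-⨾• Q
      (p ∙ rep-cong (_≅•_.R≋ eq) (≈ʰ-sym (recastʰ (_≅•_.obj≡ eq) refl)) ≋-refl) q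

  ⟨⟩°-cong : ∀ {A B} → A ≡ B → ⟨ A ⟩° ≅° ⟨ B ⟩°
  ⟨⟩°-cong refl = record { R≋ = ≋-refl ; S≋ = ≋-refl }

  ⟨⟩•-cong : ∀ {A B} → A ≡ B → ⟨ A ⟩• ≅• ⟨ B ⟩•
  ⟨⟩•-cong refl = record { R≋ = ≋-refl ; S≋ = ≋-refl }

  module C (P : Companion) = Companion P
  module J (P : Conjoint) = Conjoint P

  rep-▷○ : ∀ A B → M₁ (▷ ○ A B) ≋ C.R (⟨ A ⟩° ⊙ ⟨ B ⟩°) / ⌜ 𝔸.σ B A ⌝ / s° (A ⊗₀ B)
  rep-▷○ A B = ≋-sym (/-assoc _ _ _)

  rep-σ○ : ∀ A B → M₁ (σ ○ A B) ≋ C.R (⟨ A ⟩° ⊙ ⟨ B ⟩°) / ⌜ 𝔸.σ B A ⌝ / C.S (⟨ B ⟩° ⊙ ⟨ A ⟩°)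
  rep-σ○ A B = ≋-sym (/-assoc _ _ _)

  rep-◁● : ∀ A B → M₁ (◁ ● A B) ≋ J.R (⟨ A ⟩• ⊛ ⟨ B ⟩•) / ⌜ id ⌝ / s• (A ⊗₀ B)
  rep-◁● A B = ≋-sym (/-assoc _ _ _) ∙ /-⌜id⌝ _ _

  rep-▷● : ∀ A B → M₁ (▷ ● A B) ≋ r• (A ⊗₀ B) / ⌜ id ⌝ / J.S (⟨ A ⟩• ⊛ ⟨ B ⟩•)
  rep-▷● A B = /-⌜id⌝ _ _

  rep-σ● : ∀ A B → M₁ (σ ● A B) ≋ J.R (⟨ B ⟩• ⊛ ⟨ A ⟩•) / ⌜ 𝔸.σ B A ⌝ / J.S (⟨ A ⟩• ⊛ ⟨ B ⟩•)
  rep-σ● A B = ≋-sym (/-assoc _ _ _)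

  rep-ι○ : M₁ (ι ○) ≋ idᴴ unit / ⌜ id ⌝ / s° unit
  rep-ι○ = ≋-sym (/-identityˡ _) ∙ /-⌜id⌝ _ _

  rep-κ○ : M₁ (κ ○) ≋ r° unit / ⌜ id ⌝ / idᴴ unit
  rep-κ○ = ≋-sym (/-identityʳ _) ∙ /-⌜id⌝ _ _

  rep-ι● : M₁ (ι ●) ≋ r• unit / ⌜ id ⌝ / idᴴ unit
  rep-ι● = ≋-sym (/-identityʳ _) ∙ /-⌜id⌝ _ _

  rep-κ● : M₁ (κ ●) ≋ idᴴ unit / ⌜ id ⌝ / s• unit
  rep-κ● = ≋-sym (/-identityˡ _) ∙ /-⌜id⌝ _ _

  rep-η : ∀ A → M₁ (η A) ≋ r• A / ⌜ id ⌝ / s° A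
  rep-η A = /-⌜id⌝ _ _

  rep-ε : ∀ A → M₁ (ε A) ≋ r° A / ⌜ id ⌝ / s• A
  rep-ε A = /-⌜id⌝ _ _

  rep-N : ∀ A B → M₁ (N A B) ≋ J.R (⟨ B ⟩• ⊛ ⟨ A ⟩•) / ⌜ id ⌝ / C.S (⟨ A ⟩° ⊙ ⟨ B ⟩°)
  rep-N A B = ⨾≋∣
    ∙ interchange (r• B) (s° B) (idⱽ (B ∷• [])) ((r• A / s° A) / idⱽ (B ∷° []))
    ∙ /-cong (∣-identityʳ _)
        (∣-cong (≋-sym (/-identityˡ _ ∙ /-identityˡ _)) (/-assoc _ _ _)
          ∙ interchange (idᴴ B) (idᴴ B / s° B) (r• A) (s° A / idⱽ (B ∷° []))
          ∙ /-cong (≋-sym uncast) (interchange (idᴴ B) (s° B) (s° A) (idⱽ (B ∷° []))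
             ∙ /-cong (≋-sym uncast) (∣-identityʳ _)))
    ∙ ≋-sym (/-assoc _ _ _) ∙ /-⌜id⌝ _ _
    where
    _∷°_ _∷•_ : Obj → Edge 𝔸 → Edge 𝔸
    A ∷° X = (A , ○) ∷ X
    A ∷• X = (A , ●) ∷ X

  rep-E : ∀ A B → M₁ (E A B) ≋ C.R (⟨ A ⟩° ⊙ ⟨ B ⟩°) / ⌜ id ⌝ / J.S (⟨ B ⟩• ⊛ ⟨ A ⟩•)
  rep-E A B = ⨾≋∣
    ∙ interchange (idⱽ (A ∷° [])) ((r° B / s• B) / idⱽ (A ∷• [])) (r° A) (s• A)
    ∙ /-cong (∣-identityˡ _)
        (∣-cong (/-assoc _ _ _) (≋-sym (/-identityˡ _ ∙ /-identityˡ _))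
          ∙ interchange (r° B) (s• B / idⱽ (A ∷• [])) (idᴴ A) (idᴴ A / s• A)
          ∙ /-cong (≋-sym uncast) (interchange (s• B) (idⱽ (A ∷• [])) (idᴴ A) (s• A)
             ∙ /-cong (≋-sym uncast) (∣-identityˡ _)))
    ∙ ≋-sym (/-assoc _ _ _) ∙ /-⌜id⌝ _ _
    where
    _∷°_ _∷•_ : Obj → Edge 𝔸 → Edge 𝔸
    A ∷° X = (A , ○) ∷ X
    A ∷• X = (A , ●) ∷ X

  besideˡ° : ∀ {A B X Y L N} C {v : Hom A B} {R : Cell unit A X []} {S : Cell B unit [] Y} {α : Cell unit unit L N} →
             α ≋ R / ⌜ v ⌝ / S → idⱽ [ C , ○ ] / α ≋ (r° C / (R ʳ∣ C)) / ⌜ v ⊗₁ id ⌝ / ((B ∣ˢ s° C) / S)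
  besideˡ° C p = beside° (rep-id° ⟨ C ⟩°) p

  besideʳ° : ∀ {A B X Y L N} C {v : Hom A B} {R : Cell unit A X []} {S : Cell B unit [] Y} {α : Cell unit unit L N} →
             α ≋ R / ⌜ v ⌝ / S → α / idⱽ [ C , ○ ] ≋ (R / (r° C ʳ∣ A)) / ⌜ id ⊗₁ v ⌝ / ((C ∣ˢ S) / s° C)
  besideʳ° C p = beside° p (rep-id° ⟨ C ⟩°)

  besideˡ• : ∀ {A B X Y L N} C {v : Hom A B} {R : Cell unit A [] X} {S : Cell B unit Y []} {α : Cell unit unit L N} →
             α ≋ R / ⌜ v ⌝ / S → idⱽ [ C , ● ] / α ≋ (r• C / (C ∣ʳ R)) / ⌜ id ⊗₁ v ⌝ / ((s• C ˢ∣ B) / S)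
  besideˡ• C p = beside• (rep-id• ⟨ C ⟩•) p

  besideʳ• : ∀ {A B X Y L N} C {v : Hom A B} {R : Cell unit A [] X} {S : Cell B unit Y []} {α : Cell unit unit L N} →
             α ≋ R / ⌜ v ⌝ / S → α / idⱽ [ C , ● ] ≋ (R / (A ∣ʳ r• C)) / ⌜ v ⊗₁ id ⌝ / ((S ˢ∣ C) / s• C)
  besideʳ• C p = beside• p (rep-id• ⟨ C ⟩•)

  below : ∀ {A X X′ Y Y′} {α : Cell unit A X Y} {β : Cell unit A X′ Y′} → α ≋ β → α ≋ idⱽ [] / β
  below p = p ∙ ≋-sym (idⱽ-/-identityˡ _)

  above : ∀ {A X X′ Y Y′} {α : Cell A unit X Y} {β : Cell A unit X′ Y′} → α ≋ β → α ≋ β / idⱽ []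
  above p = p ∙ ≋-sym (idⱽ-/-identityʳ _)

  infix 0 _⟫_⟪_
  _⟫_⟪_ : ∀ {X Y X′ Y′ L N L′ N′} {α : Cell unit unit X Y} {β : Cell unit unit X′ Y′}
        {γ : Cell unit unit L N} {δ : Cell unit unit L′ N′} →
      α ≋ γ → γ ≋ δ → β ≋ δ → α ≋ β
  p ⟫ q ⟪ r = p ∙ q ∙ ≋-sym r

  open _≅°_ renaming (R≋ to R°≋; S≋ to S°≋; obj≡ to obj°≡)
  open _≅•_ renaming (R≋ to R•≋; S≋ to S•≋; obj≡ to obj•≡)

  M₁-subst-dom : ∀ {A B W} p (eq : A ≡ B) {f : Term [ A , p ] W} →
                 M₁ (subst (λ Z → Term [ Z , p ] W) eq f) ≋ M₁ f
  M₁-subst-dom p refl = ≋-refl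

  M₁-subst-cod : ∀ {A B W} p (eq : A ≡ B) {f : Term W [ A , p ]} →
                 M₁ (subst (λ Z → Term W [ Z , p ]) eq f) ≋ M₁ f
  M₁-subst-cod p refl = ≋-refl

  private
    I⊗I≡I : unit ⊗₀ unit ≡ unit
    I⊗I≡I = 𝔸.⊗₀-identityˡ unit

  module _ (spatial : ∀ (h : Cell unit unit [] []) X → h / idⱽ X ≋ idⱽ X / h) where

    M₁-resp : ∀ {X Y X′ Y′} {f : Term X Y} {g : Term X′ Y′} → f T.≋ g → M₁ f ≋ M₁ g
    M₁-resp T.≋-refl = ≋-refl
    M₁-resp (T.≋-sym p) = ≋-sym (M₁-resp p)
    M₁-resp (T.≋-trans p q) = M₁-resp p ∙ M₁-resp q
    M₁-resp (T.⨾-cong p q) = ⨾≋∣ ∙ ∣-cong (M₁-resp p) (M₁-resp q) ∙ ≋-sym ⨾≋∣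
    M₁-resp (T.⊗-cong p q) = /-cong (M₁-resp p) (M₁-resp q)
    M₁-resp (T.⨾-assoc f g h) = HC.⨾-assoc (M₁ f) (M₁ g) (M₁ h)
    M₁-resp (T.⨾-identityˡ f) = HC.⨾-identityˡ (M₁ f)
    M₁-resp (T.⨾-identityʳ f) = HC.⨾-identityʳ (M₁ f)
    M₁-resp (T.⊗-assoc f g h) = /-assoc (M₁ f) (M₁ g) (M₁ h)
    M₁-resp (T.⊗-identityˡ f) = idⱽ-/-identityˡ (M₁ f)
    M₁-resp (T.⊗-identityʳ f) = idⱽ-/-identityʳ (M₁ f)
    M₁-resp (T.⊗-id X Y) = idⱽ-/ X Y
    M₁-resp (T.⊗-⨾ f g f′ g′) = HC.⊗₁-⨾ (M₁ f) (M₁ g) (M₁ f′) (M₁ g′)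
    M₁-resp (T.spatial h X) = spatial (M₁ h) X
    M₁-resp (T.°-cong p) = rep-cong ≋-refl ⌊ p ⌋ ≋-refl
    M₁-resp (T.•-cong p) = rep-cong ≋-refl ⌊ p ⌋ ≋-refl
    M₁-resp (T.◁⨾▷ ○ A B) = rep-⨾° (⟨ A ⟩° ⊙ ⟨ B ⟩°) ≋-refl (rep-▷○ A B)
      ⟫ rep-cong ≋-refl (σσʰ A B) ≋-refl ⟪ rep-id° ⟨ A ⊗₀ B ⟩°
    M₁-resp (T.◁⨾▷ ● A B) = rep-⨾• (⟨ A ⟩• ⊛ ⟨ B ⟩•) (rep-◁● A B) (rep-▷● A B)
      ⟫ rep-cong ≋-refl (⨾-idˡʰ ≈ʰ-refl) ≋-refl ⟪ rep-id• ⟨ A ⊗₀ B ⟩•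
    M₁-resp (T.▷⨾◁ ○ A B) = rep-⨾° ⟨ A ⊗₀ B ⟩° (rep-▷○ A B) ≋-refl
      ⟫ rep-cong ≋-refl (σσʰ B A) ≋-refl ⟪ rep-id° (⟨ A ⟩° ⊙ ⟨ B ⟩°)
    M₁-resp (T.▷⨾◁ ● A B) = rep-⨾• ⟨ A ⊗₀ B ⟩• (rep-▷● A B) (rep-◁● A B)
      ⟫ rep-cong ≋-refl (⨾-idˡʰ ≈ʰ-refl) ≋-refl ⟪ rep-id• (⟨ A ⟩• ⊛ ⟨ B ⟩•)
    M₁-resp (T.▷-assoc ○ A B C) =
      rep-⨾° (⟨ A ⊗₀ B ⟩° ⊙ ⟨ C ⟩°) (besideʳ° C (rep-▷○ A B)) (rep-▷○ _ C)
      ⟫ rep-cong (R°≋ (⊙-assoc ⟨ A ⟩° ⟨ B ⟩° ⟨ C ⟩°)) (yang-baxter B A C) (S°≋ (⟨⟩°-cong (𝔸.⊗₀-assoc A B C)))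
      ⟪ rep-⨾° (⟨ A ⟩° ⊙ ⟨ B ⊗₀ C ⟩°) (besideˡ° A (rep-▷○ B C)) (rep-▷○ A _)
    M₁-resp (T.▷-assoc ● A B C) =
      rep-⨾• (⟨ A ⊗₀ B ⟩• ⊛ ⟨ C ⟩•) (besideʳ• C (rep-▷● A B)) (rep-▷● _ C)
      ⟫ rep-cong (R•≋ (⟨⟩•-cong (𝔸.⊗₀-assoc A B C)))
          (⨾-idˡʰ ≈ʰ-refl ◾ ⊗-idʰ ◾ idʰ (𝔸.⊗₀-assoc A B C) ◾ ≈ʰ-sym (⨾-idˡʰ ≈ʰ-refl ◾ ⊗-idʰ))
          (S•≋ (⊛-assoc ⟨ A ⟩• ⟨ B ⟩• ⟨ C ⟩•))
      ⟪ rep-⨾• (⟨ A ⟩• ⊛ ⟨ B ⊗₀ C ⟩•) (besideˡ• A (rep-▷● B C)) (rep-▷● A _)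
    M₁-resp (T.◁-assoc ○ A B C) =
      rep-⨾° (⟨ A ⊗₀ B ⟩° ⊙ ⟨ C ⟩°) ≋-refl (besideʳ° C ≋-refl)
      ⟫ rep-cong (R°≋ (⟨⟩°-cong (𝔸.⊗₀-assoc A B C))) (yang-baxter′ A B C) (S°≋ (⊙-assoc ⟨ A ⟩° ⟨ B ⟩° ⟨ C ⟩°))
      ⟪ rep-⨾° (⟨ A ⟩° ⊙ ⟨ B ⊗₀ C ⟩°) ≋-refl (besideˡ° A ≋-refl)
    M₁-resp (T.◁-assoc ● A B C) =
      rep-⨾• (⟨ A ⊗₀ B ⟩• ⊛ ⟨ C ⟩•) (rep-◁● _ C) (besideʳ• C (rep-◁● A B))
      ⟫ rep-cong (R•≋ (⊛-assoc ⟨ A ⟩• ⟨ B ⟩• ⟨ C ⟩•))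
          (⨾-idʳʰ ≈ʰ-refl ◾ ⊗-idʰ ◾ idʰ (𝔸.⊗₀-assoc A B C) ◾ ≈ʰ-sym (⨾-idʳʰ ≈ʰ-refl ◾ ⊗-idʰ))
          (S•≋ (⟨⟩•-cong (𝔸.⊗₀-assoc A B C)))
      ⟪ rep-⨾• (⟨ A ⟩• ⊛ ⟨ B ⊗₀ C ⟩•) (rep-◁● A _) (besideˡ• A (rep-◁● B C))
    M₁-resp (T.ι⨾κ ○) = rep-⨾° ⟨ unit ⟩° rep-ι○ rep-κ○
      ⟫ rep-cong ≋-refl (⨾-idˡʰ ≈ʰ-refl) ≋-refl ⟪ rep-id° I°
    M₁-resp (T.ι⨾κ ●) = rep-⨾• ⟨ unit ⟩• rep-ι● rep-κ●
      ⟫ rep-cong ≋-refl (⨾-idˡʰ ≈ʰ-refl) ≋-refl ⟪ rep-id• I•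
    M₁-resp (T.κ⨾ι ○) = rep-⨾° I° rep-κ○ rep-ι○
      ⟫ rep-cong ≋-refl (⨾-idˡʰ ≈ʰ-refl) ≋-refl ⟪ rep-id° ⟨ unit ⟩°
    M₁-resp (T.κ⨾ι ●) = rep-⨾• I• rep-κ● rep-ι●
      ⟫ rep-cong ≋-refl (⨾-idˡʰ ≈ʰ-refl) ≋-refl ⟪ rep-id• ⟨ unit ⟩•
    M₁-resp (T.ι-▷ˡ ○ A) =
      rep-⨾° (⟨ unit ⟩° ⊙ ⟨ A ⟩°) (besideʳ° A rep-ι○) (rep-▷○ unit A)
      ⟫ rep-cong (R°≋ (⊙-identityˡ ⟨ A ⟩°)) (⨾-idˡʰ ⊗-idʰ ◾ σ-unitʳ A) (S°≋ (⟨⟩°-cong (𝔸.⊗₀-identityˡ A)))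
      ⟪ rep-id° ⟨ A ⟩°
    M₁-resp (T.ι-▷ˡ ● A) =
      rep-⨾• (⟨ unit ⟩• ⊛ ⟨ A ⟩•) (besideʳ• A rep-ι●) (rep-▷● unit A)
      ⟫ rep-cong (R•≋ (⟨⟩•-cong (𝔸.⊗₀-identityˡ A))) (⨾-idˡʰ ≈ʰ-refl ◾ ⊗-identityˡʰ id) (S•≋ (⊛-identityˡ ⟨ A ⟩•))
      ⟪ rep-id• ⟨ A ⟩•
    M₁-resp (T.ι-▷ʳ ○ A) =
      rep-⨾° (⟨ A ⟩° ⊙ ⟨ unit ⟩°) (besideˡ° A rep-ι○) (rep-▷○ A unit)
      ⟫ rep-cong (R°≋ (⊙-identityʳ ⟨ A ⟩°)) (⨾-idˡʰ ⊗-idʰ ◾ σ-unitˡ A) (S°≋ (⟨⟩°-cong (𝔸.⊗₀-identityʳ A)))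
      ⟪ rep-id° ⟨ A ⟩°
    M₁-resp (T.ι-▷ʳ ● A) =
      rep-⨾• (⟨ A ⟩• ⊛ ⟨ unit ⟩•) (besideˡ• A rep-ι●) (rep-▷● A unit)
      ⟫ rep-cong (R•≋ (⟨⟩•-cong (𝔸.⊗₀-identityʳ A))) (⨾-idˡʰ ≈ʰ-refl ◾ ⊗-identityʳʰ id) (S•≋ (⊛-identityʳ ⟨ A ⟩•))
      ⟪ rep-id• ⟨ A ⟩•
    M₁-resp (T.◁-κˡ ○ A) =
      rep-⨾° (⟨ unit ⟩° ⊙ ⟨ A ⟩°) ≋-refl (besideʳ° A rep-κ○)
      ⟫ rep-cong (R°≋ (⟨⟩°-cong (𝔸.⊗₀-identityˡ A))) (⨾-idʳʰ ⊗-idʰ ◾ σ-unitˡ A) (S°≋ (⊙-identityˡ ⟨ A ⟩°))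
      ⟪ rep-id° ⟨ A ⟩°
    M₁-resp (T.◁-κˡ ● A) =
      rep-⨾• (⟨ unit ⟩• ⊛ ⟨ A ⟩•) (rep-◁● unit A) (besideʳ• A rep-κ●)
      ⟫ rep-cong (R•≋ (⊛-identityˡ ⟨ A ⟩•)) (⨾-idʳʰ ≈ʰ-refl ◾ ⊗-identityˡʰ id) (S•≋ (⟨⟩•-cong (𝔸.⊗₀-identityˡ A)))
      ⟪ rep-id• ⟨ A ⟩•
    M₁-resp (T.◁-κʳ ○ A) =
      rep-⨾° (⟨ A ⟩° ⊙ ⟨ unit ⟩°) ≋-refl (besideˡ° A rep-κ○)
      ⟫ rep-cong (R°≋ (⟨⟩°-cong (𝔸.⊗₀-identityʳ A))) (⨾-idʳʰ ⊗-idʰ ◾ σ-unitʳ A) (S°≋ (⊙-identityʳ ⟨ A ⟩°))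
      ⟪ rep-id° ⟨ A ⟩°
    M₁-resp (T.◁-κʳ ● A) =
      rep-⨾• (⟨ A ⟩• ⊛ ⟨ unit ⟩•) (rep-◁● A unit) (besideˡ• A rep-κ●)
      ⟫ rep-cong (R•≋ (⊛-identityʳ ⟨ A ⟩•)) (⨾-idʳʰ ≈ʰ-refl ◾ ⊗-identityʳʰ id) (S•≋ (⟨⟩•-cong (𝔸.⊗₀-identityʳ A)))
      ⟪ rep-id• ⟨ A ⟩•
    M₁-resp (T.ι-◁ ○) =
      rep-⨾° ⟨ unit ⟩° rep-ι○ (M₁-subst-dom ○ I⊗I≡I
        ∙ rep-cong (R°≋ (⟨⟩°-cong I⊗I≡I)) (≈ʰ-sym (recastʰ I⊗I≡I refl)) ≋-refl)
      ⟫ rep-cong (≋-sym (R°≋ (⊙-identityˡ I°)))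
          (⨾-idˡʰ ≈ʰ-refl ◾ recastʰ I⊗I≡I refl ◾ σ-unitˡ unit ◾ ≈ʰ-sym (⊗-identityˡʰ id)) ≋-refl
      ⟪ beside° rep-ι○ rep-ι○
    M₁-resp (T.ι-◁ ●) =
      rep-⨾• ⟨ unit ⟩• rep-ι● (M₁-subst-dom ● I⊗I≡I ∙ rep-◁● unit unit
        ∙ rep-cong ≋-refl (≈ʰ-sym (recastʰ refl I⊗I≡I)) (S•≋ (⟨⟩•-cong I⊗I≡I)))
      ⟫ rep-cong ≋-refl (⨾-idʳʰ ≈ʰ-refl ◾ recastʰ refl I⊗I≡I ◾ ≈ʰ-sym ⊗-idʰ) (≋-sym (S•≋ (⊛-identityˡ I•)))
      ⟪ beside• rep-ι● rep-ι●
    M₁-resp (T.▷-κ ○) =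
      rep-⨾° ⟨ unit ⟩° (M₁-subst-cod ○ I⊗I≡I ∙ rep-▷○ unit unit
        ∙ rep-cong ≋-refl (≈ʰ-sym (recastʰ refl I⊗I≡I)) (S°≋ (⟨⟩°-cong I⊗I≡I))) rep-κ○
      ⟫ rep-cong ≋-refl
          (⨾-idʳʰ ≈ʰ-refl ◾ recastʰ refl I⊗I≡I ◾ σ-unitˡ unit ◾ ≈ʰ-sym (⊗-identityˡʰ id))
          (≋-sym (S°≋ (⊙-identityˡ I°)))
      ⟪ beside° rep-κ○ rep-κ○
    M₁-resp (T.▷-κ ●) =
      rep-⨾• ⟨ unit ⟩• (M₁-subst-cod ● I⊗I≡I ∙ rep-▷● unit unit
        ∙ rep-cong (R•≋ (⟨⟩•-cong I⊗I≡I)) (≈ʰ-sym (recastʰ I⊗I≡I refl)) ≋-refl) rep-κ●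
      ⟫ rep-cong (≋-sym (R•≋ (⊛-identityˡ I•))) (⨾-idˡʰ ≈ʰ-refl ◾ recastʰ I⊗I≡I refl ◾ ≈ʰ-sym ⊗-idʰ) ≋-refl
      ⟪ beside• rep-κ● rep-κ●
    M₁-resp (T.σ°-naturalˡ {A} {B} f C) =
      rep-⨾° (⟨ B ⟩° ⊙ ⟨ C ⟩°) (besideʳ° C ≋-refl) (rep-σ○ B C)
      ⟫ rep-cong ≋-refl (σ-naturalʰ id f) ≋-refl
      ⟪ rep-⨾° (⟨ C ⟩° ⊙ ⟨ A ⟩°) (rep-σ○ A C) (besideˡ° C ≋-refl)
    M₁-resp (T.σ°-naturalʳ {A} {B} f C) =
      rep-⨾° (⟨ C ⟩° ⊙ ⟨ B ⟩°) (besideˡ° C ≋-refl) (rep-σ○ C B)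
      ⟫ rep-cong ≋-refl (σ-naturalʰ f id) ≋-refl
      ⟪ rep-⨾° (⟨ A ⟩° ⊙ ⟨ C ⟩°) (rep-σ○ C A) (besideʳ° C ≋-refl)
    M₁-resp (T.σ•-naturalˡ {A} {B} f C) =
      rep-⨾• (⟨ A ⟩• ⊛ ⟨ C ⟩•) (besideʳ• C ≋-refl) (rep-σ● A C)
      ⟫ rep-cong ≋-refl (≈ʰ-sym (σ-naturalʰ id f)) ≋-refl
      ⟪ rep-⨾• (⟨ C ⟩• ⊛ ⟨ B ⟩•) (rep-σ● B C) (besideˡ• C ≋-refl)
    M₁-resp (T.σ•-naturalʳ {A} {B} f C) =
      rep-⨾• (⟨ C ⟩• ⊛ ⟨ A ⟩•) (besideˡ• C ≋-refl) (rep-σ● C A)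
      ⟫ rep-cong ≋-refl (≈ʰ-sym (σ-naturalʰ f id)) ≋-refl
      ⟪ rep-⨾• (⟨ B ⟩• ⊛ ⟨ C ⟩•) (rep-σ● C B) (besideʳ• C ≋-refl)
    M₁-resp (T.▷-σˡ ○ A B C) =
      rep-⨾° (⟨ A ⊗₀ B ⟩° ⊙ ⟨ C ⟩°) (besideʳ° C (rep-▷○ A B)) (rep-σ○ _ C)
      ⟫ rep-cong (R°≋ (⊙-assoc ⟨ A ⟩° ⟨ B ⟩° ⟨ C ⟩°))
          (σ-naturalʰ id (𝔸.σ B A) ◾ ≈ʰ-sym (hexagonʳ-⨾ (recastʰ _ refl) (recastʰ _ refl))) ≋-refl
      ⟪ rep-⨾°≅ (⟨ A ⟩° ⊙ ⟨ C ⟩° ⊙ ⟨ B ⟩°) ((⟨ A ⟩° ⊙ ⟨ C ⟩°) ⊙ ⟨ B ⟩°) (⊙-assoc ⟨ A ⟩° ⟨ C ⟩° ⟨ B ⟩°)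
          (besideˡ° A (rep-σ○ B C))
          (rep-⨾°≅ ((⟨ C ⟩° ⊙ ⟨ A ⟩°) ⊙ ⟨ B ⟩°) (⟨ C ⟩° ⊙ ⟨ A ⟩° ⊙ ⟨ B ⟩°) (≅°-sym (⊙-assoc ⟨ C ⟩° ⟨ A ⟩° ⟨ B ⟩°))
            (besideʳ° B (rep-σ○ A C)) (besideˡ° C (rep-▷○ A B)))
    M₁-resp (T.▷-σˡ ● A B C) =
      rep-⨾• (⟨ A ⊗₀ B ⟩• ⊛ ⟨ C ⟩•) (besideʳ• C (rep-▷● A B)) (rep-σ● _ C)
      ⟫ rep-cong ≋-refl
          (⨾-idʳʰ ⊗-idʰ ◾ hexagonʳ C A B (recastʰ _ refl)
            ◾ ⨾-congʰ (≈ʰ-sym (⨾-idˡʰ ⊗-idʰ ◾ recastʰ _ refl)) (recastʰ (sym (𝔸.⊗₀-assoc A C B)) refl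
                  ◾ ≈ʰ-sym (recastʰ _ refl)))
          (S•≋ (⊛-assoc ⟨ A ⟩• ⟨ B ⟩• ⟨ C ⟩•))
      ⟪ rep-⨾•≅ (⟨ A ⟩• ⊛ ⟨ C ⟩• ⊛ ⟨ B ⟩•) ((⟨ A ⟩• ⊛ ⟨ C ⟩•) ⊛ ⟨ B ⟩•) (≅•-sym (⊛-assoc ⟨ A ⟩• ⟨ C ⟩• ⟨ B ⟩•))
          (besideˡ• A (rep-σ● B C))
          (rep-⨾•≅ ((⟨ C ⟩• ⊛ ⟨ A ⟩•) ⊛ ⟨ B ⟩•) (⟨ C ⟩• ⊛ ⟨ A ⟩• ⊛ ⟨ B ⟩•) (⊛-assoc ⟨ C ⟩• ⟨ A ⟩• ⟨ B ⟩•)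
            (besideʳ• B (rep-σ● A C)) (besideˡ• C (rep-▷● A B)))
    M₁-resp (T.▷-σʳ ○ A B C) =
      rep-⨾° (⟨ A ⟩° ⊙ ⟨ B ⊗₀ C ⟩°) (besideˡ° A (rep-▷○ B C)) (rep-σ○ A _)
      ⟫ rep-cong (≋-sym (R°≋ (⊙-assoc ⟨ A ⟩° ⟨ B ⟩° ⟨ C ⟩°)))
          (σ-naturalʰ (𝔸.σ C B) id ◾ ≈ʰ-sym (hexagonˡ-⨾ (recastʰ _ refl) (recastʰ _ refl))) ≋-refl
      ⟪ rep-⨾°≅ ((⟨ B ⟩° ⊙ ⟨ A ⟩°) ⊙ ⟨ C ⟩°) (⟨ B ⟩° ⊙ ⟨ A ⟩° ⊙ ⟨ C ⟩°) (≅°-sym (⊙-assoc ⟨ B ⟩° ⟨ A ⟩° ⟨ C ⟩°))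
          (besideʳ° C (rep-σ○ A B))
          (rep-⨾°≅ (⟨ B ⟩° ⊙ ⟨ C ⟩° ⊙ ⟨ A ⟩°) ((⟨ B ⟩° ⊙ ⟨ C ⟩°) ⊙ ⟨ A ⟩°) (⊙-assoc ⟨ B ⟩° ⟨ C ⟩° ⟨ A ⟩°)
            (besideˡ° B (rep-σ○ A C)) (besideʳ° A (rep-▷○ B C)))
    M₁-resp (T.▷-σʳ ● A B C) =
      rep-⨾• (⟨ A ⟩• ⊛ ⟨ B ⊗₀ C ⟩•) (besideˡ• A (rep-▷● B C)) (rep-σ● A _)
      ⟫ rep-cong ≋-refl
          (⨾-idʳʰ ⊗-idʰ ◾ hexagonˡ B C A (recastʰ _ refl)
            ◾ ⨾-congʰ (≈ʰ-sym (⨾-idˡʰ ⊗-idʰ ◾ recastʰ _ refl)) (recastʰ (𝔸.⊗₀-assoc B A C) refl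
                  ◾ ≈ʰ-sym (recastʰ _ refl)))
          (≋-sym (S•≋ (⊛-assoc ⟨ A ⟩• ⟨ B ⟩• ⟨ C ⟩•)))
      ⟪ rep-⨾•≅ ((⟨ B ⟩• ⊛ ⟨ A ⟩•) ⊛ ⟨ C ⟩•) (⟨ B ⟩• ⊛ ⟨ A ⟩• ⊛ ⟨ C ⟩•) (⊛-assoc ⟨ B ⟩• ⟨ A ⟩• ⟨ C ⟩•)
          (besideʳ• C (rep-σ● A B))
          (rep-⨾•≅ (⟨ B ⟩• ⊛ ⟨ C ⟩• ⊛ ⟨ A ⟩•) ((⟨ B ⟩• ⊛ ⟨ C ⟩•) ⊛ ⟨ A ⟩•) (≅•-sym (⊛-assoc ⟨ B ⟩• ⟨ C ⟩• ⟨ A ⟩•))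
            (besideˡ• B (rep-σ● A C)) (besideʳ• A (rep-▷● B C)))
    M₁-resp (T.σ-◁ˡ ○ A B C) =
      rep-⨾° (⟨ C ⟩° ⊙ ⟨ A ⊗₀ B ⟩°) (rep-σ○ _ C) (besideˡ° C ≋-refl)
      ⟫ rep-cong ≋-refl
          (≈ʰ-sym (⨾-congʰ ≈ʰ-refl (recastʰ _ refl ◾ ≈ʰ-sym (hexagonʳ C B A (recastʰ _ refl)))
                ◾ σ-naturalʰ id (𝔸.σ A B)))
          (≋-sym (S°≋ (⊙-assoc ⟨ C ⟩° ⟨ A ⟩° ⟨ B ⟩°)))
      ⟪ rep-⨾°≅ ((⟨ A ⟩° ⊙ ⟨ B ⟩°) ⊙ ⟨ C ⟩°) (⟨ A ⟩° ⊙ ⟨ B ⟩° ⊙ ⟨ C ⟩°) (≅°-sym (⊙-assoc ⟨ A ⟩° ⟨ B ⟩° ⟨ C ⟩°))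
          (besideʳ° C ≋-refl)
          (rep-⨾°≅ (⟨ A ⟩° ⊙ ⟨ C ⟩° ⊙ ⟨ B ⟩°) ((⟨ A ⟩° ⊙ ⟨ C ⟩°) ⊙ ⟨ B ⟩°) (⊙-assoc ⟨ A ⟩° ⟨ C ⟩° ⟨ B ⟩°)
            (besideˡ° A (rep-σ○ B C)) (besideʳ° B (rep-σ○ A C)))
    M₁-resp (T.σ-◁ˡ ● A B C) =
      rep-⨾• (⟨ C ⟩• ⊛ ⟨ A ⊗₀ B ⟩•) (rep-σ● _ C) (besideˡ• C (rep-◁● A B))
      ⟫ rep-cong (≋-sym (R•≋ (⊛-assoc ⟨ C ⟩• ⟨ A ⟩• ⟨ B ⟩•)))
          (⨾-idˡʰ ⊗-idʰ ◾ hexagonʳ C A B (recastʰ _ refl)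
            ◾ ≈ʰ-sym (⨾-idʳʰ (recastʰ _ refl ◾ ⊗-idʰ)))
          ≋-refl
      ⟪ rep-⨾•≅ ((⟨ A ⟩• ⊛ ⟨ B ⟩•) ⊛ ⟨ C ⟩•) (⟨ A ⟩• ⊛ ⟨ B ⟩• ⊛ ⟨ C ⟩•) (⊛-assoc ⟨ A ⟩• ⟨ B ⟩• ⟨ C ⟩•)
          (besideʳ• C (rep-◁● A B))
          (rep-⨾•≅ (⟨ A ⟩• ⊛ ⟨ C ⟩• ⊛ ⟨ B ⟩•) ((⟨ A ⟩• ⊛ ⟨ C ⟩•) ⊛ ⟨ B ⟩•) (≅•-sym (⊛-assoc ⟨ A ⟩• ⟨ C ⟩• ⟨ B ⟩•))
            (besideˡ• A (rep-σ● B C)) (besideʳ• B (rep-σ● A C)))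
    M₁-resp (T.σ-◁ʳ ○ A B C) =
      rep-⨾° (⟨ B ⊗₀ C ⟩° ⊙ ⟨ A ⟩°) (rep-σ○ A _) (besideʳ° A ≋-refl)
      ⟫ rep-cong ≋-refl
          (≈ʰ-sym (⨾-congʰ ≈ʰ-refl (recastʰ _ refl ◾ ≈ʰ-sym (hexagonˡ C B A (recastʰ _ refl)))
                ◾ σ-naturalʰ (𝔸.σ B C) id))
          (S°≋ (⊙-assoc ⟨ B ⟩° ⟨ C ⟩° ⟨ A ⟩°))
      ⟪ rep-⨾°≅ (⟨ A ⟩° ⊙ ⟨ B ⟩° ⊙ ⟨ C ⟩°) ((⟨ A ⟩° ⊙ ⟨ B ⟩°) ⊙ ⟨ C ⟩°) (⊙-assoc ⟨ A ⟩° ⟨ B ⟩° ⟨ C ⟩°)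
          (besideˡ° A ≋-refl)
          (rep-⨾°≅ ((⟨ B ⟩° ⊙ ⟨ A ⟩°) ⊙ ⟨ C ⟩°) (⟨ B ⟩° ⊙ ⟨ A ⟩° ⊙ ⟨ C ⟩°) (≅°-sym (⊙-assoc ⟨ B ⟩° ⟨ A ⟩° ⟨ C ⟩°))
            (besideʳ° C (rep-σ○ A B)) (besideˡ° B (rep-σ○ A C)))
    M₁-resp (T.σ-◁ʳ ● A B C) =
      rep-⨾• (⟨ B ⊗₀ C ⟩• ⊛ ⟨ A ⟩•) (rep-σ● A _) (besideʳ• A (rep-◁● B C))
      ⟫ rep-cong (R•≋ (⊛-assoc ⟨ B ⟩• ⟨ C ⟩• ⟨ A ⟩•))
          (⨾-idˡʰ ⊗-idʰ ◾ hexagonˡ B C A (recastʰ _ refl)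
            ◾ ≈ʰ-sym (⨾-idʳʰ (recastʰ _ refl ◾ ⊗-idʰ)))
          ≋-refl
      ⟪ rep-⨾•≅ (⟨ A ⟩• ⊛ ⟨ B ⟩• ⊛ ⟨ C ⟩•) ((⟨ A ⟩• ⊛ ⟨ B ⟩•) ⊛ ⟨ C ⟩•) (≅•-sym (⊛-assoc ⟨ A ⟩• ⟨ B ⟩• ⟨ C ⟩•))
          (besideˡ• A (rep-◁● B C))
          (rep-⨾•≅ ((⟨ B ⟩• ⊛ ⟨ A ⟩•) ⊛ ⟨ C ⟩•) (⟨ B ⟩• ⊛ ⟨ A ⟩• ⊛ ⟨ C ⟩•) (⊛-assoc ⟨ B ⟩• ⟨ A ⟩• ⟨ C ⟩•)
            (besideʳ• C (rep-σ● A B)) (besideˡ• B (rep-σ● A C)))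
    M₁-resp (T.ι-σˡ ○ A) =
      rep-⨾° (⟨ unit ⟩° ⊙ ⟨ A ⟩°) (besideʳ° A rep-ι○) (rep-σ○ unit A)
      ⟫ rep-cong (R°≋ (⊙-identityˡ ⟨ A ⟩°) ∙ ≋-sym (R°≋ (⊙-identityʳ ⟨ A ⟩°)))
          (⨾-idˡʰ ⊗-idʰ ◾ σ-unitʳ A ◾ ≈ʰ-sym (⊗-identityˡʰ id)) ≋-refl
      ⟪ besideˡ° A rep-ι○
    M₁-resp (T.ι-σˡ ● A) =
      rep-⨾• (⟨ unit ⟩• ⊛ ⟨ A ⟩•) (besideʳ• A rep-ι●) (rep-σ● unit A)
      ⟫ rep-cong ≋-refl (⨾-idʳʰ ⊗-idʰ ◾ σ-unitʳ A ◾ ≈ʰ-sym (⊗-identityʳʰ id))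
          (S•≋ (⊛-identityˡ ⟨ A ⟩•) ∙ ≋-sym (S•≋ (⊛-identityʳ ⟨ A ⟩•)))
      ⟪ besideˡ• A rep-ι●
    M₁-resp (T.ι-σʳ ○ A) =
      rep-⨾° (⟨ A ⟩° ⊙ ⟨ unit ⟩°) (besideˡ° A rep-ι○) (rep-σ○ A unit)
      ⟫ rep-cong (R°≋ (⊙-identityʳ ⟨ A ⟩°) ∙ ≋-sym (R°≋ (⊙-identityˡ ⟨ A ⟩°)))
          (⨾-idˡʰ ⊗-idʰ ◾ σ-unitˡ A ◾ ≈ʰ-sym (⊗-identityʳʰ id)) ≋-refl
      ⟪ besideʳ° A rep-ι○
    M₁-resp (T.ι-σʳ ● A) =
      rep-⨾• (⟨ A ⟩• ⊛ ⟨ unit ⟩•) (besideˡ• A rep-ι●) (rep-σ● A unit)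
      ⟫ rep-cong ≋-refl (⨾-idʳʰ ⊗-idʰ ◾ σ-unitˡ A ◾ ≈ʰ-sym (⊗-identityˡʰ id))
          (S•≋ (⊛-identityʳ ⟨ A ⟩•) ∙ ≋-sym (S•≋ (⊛-identityˡ ⟨ A ⟩•)))
      ⟪ besideʳ• A rep-ι●
    M₁-resp (T.σ-κˡ ○ A) =
      rep-⨾° (⟨ A ⟩° ⊙ ⟨ unit ⟩°) (rep-σ○ unit A) (besideˡ° A rep-κ○)
      ⟫ rep-cong ≋-refl (⨾-idʳʰ ⊗-idʰ ◾ σ-unitʳ A ◾ ≈ʰ-sym (⊗-identityʳʰ id))
          (S°≋ (⊙-identityʳ ⟨ A ⟩°) ∙ ≋-sym (S°≋ (⊙-identityˡ ⟨ A ⟩°)))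
      ⟪ besideʳ° A rep-κ○
    M₁-resp (T.σ-κˡ ● A) =
      rep-⨾• (⟨ A ⟩• ⊛ ⟨ unit ⟩•) (rep-σ● unit A) (besideˡ• A rep-κ●)
      ⟫ rep-cong (R•≋ (⊛-identityʳ ⟨ A ⟩•) ∙ ≋-sym (R•≋ (⊛-identityˡ ⟨ A ⟩•)))
          (⨾-idˡʰ ⊗-idʰ ◾ σ-unitʳ A ◾ ≈ʰ-sym (⊗-identityˡʰ id)) ≋-refl
      ⟪ besideʳ• A rep-κ●
    M₁-resp (T.σ-κʳ ○ A) =
      rep-⨾° (⟨ unit ⟩° ⊙ ⟨ A ⟩°) (rep-σ○ A unit) (besideʳ° A rep-κ○)
      ⟫ rep-cong ≋-refl (⨾-idʳʰ ⊗-idʰ ◾ σ-unitˡ A ◾ ≈ʰ-sym (⊗-identityˡʰ id))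
          (S°≋ (⊙-identityˡ ⟨ A ⟩°) ∙ ≋-sym (S°≋ (⊙-identityʳ ⟨ A ⟩°)))
      ⟪ besideˡ° A rep-κ○
    M₁-resp (T.σ-κʳ ● A) =
      rep-⨾• (⟨ unit ⟩• ⊛ ⟨ A ⟩•) (rep-σ● A unit) (besideʳ• A rep-κ●)
      ⟫ rep-cong (R•≋ (⊛-identityˡ ⟨ A ⟩•) ∙ ≋-sym (R•≋ (⊛-identityʳ ⟨ A ⟩•)))
          (⨾-idˡʰ ⊗-idʰ ◾ σ-unitˡ A ◾ ≈ʰ-sym (⊗-identityʳʰ id)) ≋-refl
      ⟪ besideˡ• A rep-κ●
    M₁-resp (T.snake° A) =
      rep-⨾•ʷ ⟨ A ⟩• {v = id} {E = s° A} (/-cong ≋-refl (rep-η A)) (/-cong (rep-ε A) ≋-refl)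
      ⟫ rep-cong ≋-refl (⨾-idˡʰ ≈ʰ-refl) ≋-refl ⟪ rep-id° ⟨ A ⟩°
    M₁-resp (T.snake• A) =
      rep-⨾°ʷ ⟨ A ⟩° {v = id} {E = s• A} (/-cong (rep-η A) ≋-refl) (/-cong ≋-refl (rep-ε A))
      ⟫ rep-cong ≋-refl (⨾-idˡʰ ≈ʰ-refl) ≋-refl ⟪ rep-id• ⟨ A ⟩•
    M₁-resp (T.η-natural {A} {B} f) =
      rep-⨾°ʷ ⟨ A ⟩° {v = id} (above (rep-η A)) ≋-refl
      ⟫ rep-cong ≋-refl (⨾-idˡʰ ≈ʰ-refl ◾ ≈ʰ-sym (⨾-idʳʰ ≈ʰ-refl)) ≋-refl
      ⟪ rep-⨾•ʷ ⟨ B ⟩• {w = id} (below (rep-η B)) ≋-refl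
    M₁-resp (T.ε-natural {A} {B} f) =
      rep-⨾°ʷ ⟨ B ⟩° {w = id} ≋-refl (below (rep-ε B))
      ⟫ rep-cong ≋-refl (⨾-idʳʰ ≈ʰ-refl ◾ ≈ʰ-sym (⨾-idˡʰ ≈ʰ-refl)) ≋-refl
      ⟪ rep-⨾•ʷ ⟨ A ⟩• {v = id} ≋-refl (above (rep-ε A))
    M₁-resp (T.N-σ A B) =
      rep-⨾°ʷ (⟨ A ⟩° ⊙ ⟨ B ⟩°) (above (rep-N A B)) (/-cong ≋-refl (rep-σ○ A B))
      ⟫ rep-cong ≋-refl (⨾-idˡʰ ≈ʰ-refl ◾ ≈ʰ-sym (⨾-idʳʰ ≈ʰ-refl)) ≋-refl
      ⟪ rep-⨾•ʷ (⟨ A ⟩• ⊛ ⟨ B ⟩•) (below (rep-N B A)) (/-cong (rep-σ● A B) ≋-refl)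
    M₁-resp (T.E-σ A B) =
      rep-⨾°ʷ (⟨ B ⟩° ⊙ ⟨ A ⟩°) (/-cong (rep-σ○ A B) ≋-refl) (below (rep-E B A))
      ⟫ rep-cong ≋-refl (⨾-idʳʰ ≈ʰ-refl ◾ ≈ʰ-sym (⨾-idˡʰ ≈ʰ-refl)) ≋-refl
      ⟪ rep-⨾•ʷ (⟨ B ⟩• ⊛ ⟨ A ⟩•) (/-cong ≋-refl (rep-σ● A B)) (above (rep-E A B))
    M₁-resp (T.η-◁● A B) =
      rep-⨾•ʷ ⟨ A ⊗₀ B ⟩• (below (rep-η _)) (/-cong (rep-◁● A B) ≋-refl)
      ⟫ rep-cong ≋-refl (⨾-idˡʰ ≈ʰ-refl ◾ ≈ʰ-sym (⨾-congʰ (⨾-idˡʰ ≈ʰ-refl) ≈ʰ-refl ◾ σσʰ A B)) ≋-refl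
      ⟪ ≋-sym (HC.⨾-assoc (M₁ (N B A)) _ _)
        ∙ rep-⨾°ʷ (⟨ A ⟩° ⊙ ⟨ B ⟩°)
            (above (rep-⨾°ʷ (⟨ B ⟩° ⊙ ⟨ A ⟩°) (above (rep-N B A)) (/-cong ≋-refl (rep-σ○ B A))))
            (/-cong ≋-refl (rep-▷○ A B))
    M₁-resp (T.η-◁○ A B) =
      rep-⨾°ʷ ⟨ A ⊗₀ B ⟩° (above (rep-η _)) ≋-refl
      ⟫ rep-cong ≋-refl (≈ʰ-sym (⨾-congʰ ≈ʰ-refl (⨾-idʳʰ ≈ʰ-refl))) ≋-refl
      ⟪ ≋-sym (HC.⨾-assoc (M₁ (N A B)) _ _)
        ∙ rep-⨾•ʷ (⟨ A ⟩• ⊛ ⟨ B ⟩•)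
            (below (rep-⨾•ʷ (⟨ B ⟩• ⊛ ⟨ A ⟩•) (below (rep-N A B)) (/-cong (rep-σ● B A) ≋-refl)))
            (/-cong (rep-▷● A B) ≋-refl)
    M₁-resp (T.▷○-ε A B) =
      rep-⨾°ʷ ⟨ A ⊗₀ B ⟩° (/-cong (rep-▷○ A B) ≋-refl) (below (rep-ε _))
      ⟫ rep-cong ≋-refl (≈ʰ-sym (⨾-congʰ (⨾-idˡʰ ≈ʰ-refl) ≈ʰ-refl)) ≋-refl
      ⟪ rep-⨾•ʷ (⟨ A ⟩• ⊛ ⟨ B ⟩•) (/-cong ≋-refl (rep-◁● A B))
          (above (rep-⨾•ʷ (⟨ B ⟩• ⊛ ⟨ A ⟩•) (/-cong ≋-refl (rep-σ● A B)) (above (rep-E A B))))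
    M₁-resp (T.▷●-ε A B) =
      rep-⨾•ʷ ⟨ A ⊗₀ B ⟩• (/-cong ≋-refl (rep-▷● A B)) (above (rep-ε _))
      ⟫ rep-cong ≋-refl (⨾-idʳʰ ≈ʰ-refl ◾ ≈ʰ-sym (⨾-congʰ ≈ʰ-refl (⨾-idʳʰ ≈ʰ-refl) ◾ σσʰ A B)) ≋-refl
      ⟪ rep-⨾°ʷ (⟨ A ⟩° ⊙ ⟨ B ⟩°) ≋-refl
          (below (rep-⨾°ʷ (⟨ B ⟩° ⊙ ⟨ A ⟩°) (/-cong (rep-σ○ A B) ≋-refl) (below (rep-E B A))))
    M₁-resp (T.°-⨾ {B = B} f g) = rep-⨾° ⟨ B ⟩° ≋-refl ≋-refl
    M₁-resp (T.°-⊗ {A} {A′} {B} {B′} f g) =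
      rep-⨾° (⟨ A ⟩° ⊙ ⟨ B ⟩°) ≋-refl
        (rep-⨾° (⟨ A′ ⟩° ⊙ ⟨ B′ ⟩°) (beside° {v = f} {w = g} ≋-refl ≋-refl) (rep-▷○ A′ B′))
      ∙ rep-cong ≋-refl
          (⨾-congʰ ≈ʰ-refl (σ-naturalʰ g f) ◾ ≈ʰ-sym (⨾-assocʰ _ _ _) ◾ ⨾-idˡʰ (σσʰ A B)) ≋-refl
    M₁-resp (T.°-id A) = ≋-sym (rep-id° ⟨ A ⟩°)
    M₁-resp (T.°-σ A B) =
      rep-⨾° ⟨ A ⊗₀ B ⟩° (rep-▷○ A B) (rep-⨾° ⟨ B ⊗₀ A ⟩° {v = 𝔸.σ A B} ≋-refl ≋-refl)
      ⟫ rep-cong ≋-refl (⨾-idʳʰ (σσʰ A B)) ≋-refl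
      ⟪ rep-σ○ A B
    M₁-resp (T.•-⨾ {B = B} f g) = rep-⨾• ⟨ B ⟩• ≋-refl ≋-refl
    M₁-resp (T.•-⊗ {A} {A′} {B} {B′} f g) =
      rep-⨾• (⟨ A′ ⟩• ⊛ ⟨ B′ ⟩•) (rep-◁● A′ B′)
        (rep-⨾• (⟨ A ⟩• ⊛ ⟨ B ⟩•) (beside• {v = f} {w = g} ≋-refl ≋-refl) (rep-▷● A B))
      ∙ rep-cong ≋-refl (⨾-idʳʰ ≈ʰ-refl ◾ ⨾-idˡʰ ≈ʰ-refl) ≋-refl
    M₁-resp (T.•-id A) = ≋-sym (rep-id• ⟨ A ⟩•)
    M₁-resp (T.•-σ A B) =
      rep-⨾• ⟨ A ⊗₀ B ⟩• (rep-▷● A B) (rep-⨾• ⟨ B ⊗₀ A ⟩• {w = 𝔸.σ B A} ≋-refl (rep-◁● B A))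
      ⟫ rep-cong ≋-refl (⨾-idʳʰ ≈ʰ-refl ◾ ⨾-idˡʰ ≈ʰ-refl) ≋-refl
      ⟪ rep-σ● A B

module Bending {o ℓ e} (𝔸 : SymmetricStrictMonoidalCategory o ℓ e) where
  private module 𝔸 = SymmetricStrictMonoidalCategory 𝔸
  open 𝔸 using (Obj; unit; _⊗₀_; Hom)
  open Coherence 𝔸 using (_≈ʰ_; ⌊_⌋; yang-baxter′; σ-unitˡ; σ-unitʳ)
  open Presentation 𝔸
  module C = FreeCornering 𝔸
  open C using (Cell; _∣_; _/_; idᴴ; idⱽ; s°; r°; s•; r•; ⌜_⌝)

  infixr 3 _∙_
  _∙_ : ∀ {X Y X′ Y′ X″ Y″} {f : Term X Y} {g : Term X′ Y′} {h : Term X″ Y″} → f ≋ g → g ≋ h → f ≋ h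
  _∙_ = ≋-trans

  uncast : ∀ {X Y X′ Y′} {p : X ≡ X′} {q : Y ≡ Y′} {f : Term X Y} → subst₂ Term p q f ≋ f
  uncast {p = p} {q} = subst₂-≋ p q ≋-refl

  at2 : ∀ {X Y Z W X′ Y′ Z′ W′} {f : Term X Y} {g : Term Y Z} {m : Term Z W}
        {f′ : Term X′ Y′} {g′ : Term Y′ Z′} {m′ : Term Z′ W′} →
        f ⨾ g ≋ f′ ⨾ g′ → m ≋ m′ → f ⨾ g ⨾ m ≋ f′ ⨾ g′ ⨾ m′
  at2 p q = ≋-sym (⨾-assoc _ _ _) ∙ ⨾-cong p q ∙ ⨾-assoc _ _ _

  push : ∀ {X Y Z W X′ Y′ W′} {f : Term X Y} {g : Term Y Z} {m : Term Z W}
         {f′ : Term X′ Y′} {g′ : Term Y′ Z} {m′ : Term Y′ W′} →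
         f ⨾ g ≋ f′ ⨾ g′ → g′ ⨾ m ≋ m′ → f ⨾ g ⨾ m ≋ f′ ⨾ m′
  push p q = at2 p ≋-refl ∙ ⨾-cong ≋-refl q

  merge : ∀ {X Y Z W X′ Z′ W′} {f : Term X Y} {g : Term Y Z} {m : Term Z W} {h : Term X′ Z′} {m′ : Term Z′ W′} →
          f ⨾ g ≋ h → m ≋ m′ → f ⨾ g ⨾ m ≋ h ⨾ m′
  merge p q = ≋-sym (⨾-assoc _ _ _) ∙ ⨾-cong p q

  split : ∀ {X Y Z W X′ Z′ W′} {f : Term X Y} {g : Term Y Z} {m : Term Z W} {h : Term X′ Z′} {m′ : Term Z′ W′} →
          h ≋ f ⨾ g → m′ ≋ m → h ⨾ m′ ≋ f ⨾ g ⨾ m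
  split p q = ⨾-cong p q ∙ ⨾-assoc _ _ _

  cancel : ∀ {X Y Z W X′ W′} {f : Term X Y} {g : Term Y Z} {m : Term Z W} {m′ : Term X′ W′} →
           f ⨾ g ≋ 1[ X′ ] → m ≋ m′ → f ⨾ g ⨾ m ≋ m′
  cancel p q = merge p q ∙ ⨾-identityˡ _

  ◂-⨾ : ∀ {X Y Z} P {f : Term X Y} {g : Term Y Z} → 1[ P ] ⊗ (f ⨾ g) ≋ (1[ P ] ⊗ f) ⨾ (1[ P ] ⊗ g)
  ◂-⨾ P = ⊗-cong (≋-sym (⨾-identityˡ _)) ≋-refl ∙ ⊗-⨾ _ _ _ _

  ▸-⨾ : ∀ {X Y Z} P {f : Term X Y} {g : Term Y Z} → (f ⨾ g) ⊗ 1[ P ] ≋ (f ⊗ 1[ P ]) ⨾ (g ⊗ 1[ P ])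
  ▸-⨾ P = ⊗-cong ≋-refl (≋-sym (⨾-identityˡ _)) ∙ ⊗-⨾ _ _ _ _

  ◂-++ : ∀ {X Y} P Q (f : Term X Y) → 1[ P ++ Q ] ⊗ f ≋ 1[ P ] ⊗ (1[ Q ] ⊗ f)
  ◂-++ P Q f = ⊗-cong (≋-sym (⊗-id P Q)) ≋-refl ∙ ⊗-assoc _ _ _

  ▸-++ : ∀ {X Y} P Q (f : Term X Y) → f ⊗ 1[ P ++ Q ] ≋ (f ⊗ 1[ P ]) ⊗ 1[ Q ]
  ▸-++ P Q f = ⊗-cong ≋-refl (≋-sym (⊗-id P Q)) ∙ ≋-sym (⊗-assoc _ _ _)

  exchange : ∀ {X Y Z W} (f : Term X Y) (g : Term Z W) →
             (f ⊗ 1[ Z ]) ⨾ (1[ Y ] ⊗ g) ≋ (1[ X ] ⊗ g) ⨾ (f ⊗ 1[ W ])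
  exchange f g = ≋-sym (⊗-⨾ f _ _ g) ∙ ⊗-cong (⨾-identityʳ f ∙ ≋-sym (⨾-identityˡ f)) (⨾-identityˡ g
        ∙ ≋-sym (⨾-identityʳ g))
    ∙ ⊗-⨾ _ f g _

  ° : Obj → Edge 𝔸
  ° A = [ A , ○ ]

  -- When cells are bent, A ↦ A° has to be strong monoidal for the reversed tensor
  -- product; the symmetry of 𝔸 provides this.
  dec : ∀ A C → Term (° (A ⊗₀ C)) (° C ++ ° A)
  dec A C = 𝔸.σ A C ⟨°⟩ ⨾ ◁ ○ C A

  mul : ∀ B D → Term (° D ++ ° B) (° (B ⊗₀ D))
  mul B D = ▷ ○ D B ⨾ 𝔸.σ D B ⟨°⟩

  -- The context Z makes the boundaries of composites agree on the nose.
  bend : ∀ {A B X Y} → Cell A B X Y → ∀ Z → Term ((A , ○) ∷ X ++ Z) (Y ++ (B , ○) ∷ Z)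
  bend (_∣_ {A} {B} {C} {D} {X} {Y} {W} α β) Z =
    (dec A C ⊗ 1[ X ++ Z ]) ⨾ (1[ ° C ] ⊗ bend α Z) ⨾ bend β ((B , ○) ∷ Z) ⨾ (1[ W ] ⊗ mul B D ⊗ 1[ Z ])
  bend (_/_ {A} {X = X} {Y} {X′} {Y′} α β) Z =
    subst₂ Term (cong ((A , ○) ∷_) (sym (++-assoc X X′ Z))) (sym (++-assoc Y Y′ _))
      (bend α (X′ ++ Z) ⨾ (1[ Y ] ⊗ bend β Z))
  bend (idᴴ A) Z = 1[ (A , ○) ∷ Z ]
  bend (idⱽ X) Z = (κ ○ ⊗ 1[ X ++ Z ]) ⨾ (1[ X ] ⊗ ι ○ ⊗ 1[ Z ])
  bend (s° A)  Z = 1[ ° A ] ⊗ ι ○ ⊗ 1[ Z ]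
  bend (r° A)  Z = κ ○ ⊗ 1[ (A , ○) ∷ Z ]
  bend (s• A)  Z = (ε A ⊗ 1[ Z ]) ⨾ (ι ○ ⊗ 1[ Z ])
  bend (r• A)  Z = (κ ○ ⊗ 1[ Z ]) ⨾ (η A ⊗ 1[ Z ])
  bend ⌜ f ⌝   Z = f ⟨°⟩ ⊗ 1[ Z ]

  bend-natural : ∀ {A B X Y Z Z′} (α : Cell A B X Y) (g : Term Z Z′) →
                 (1[ (A , ○) ∷ X ] ⊗ g) ⨾ bend α Z′ ≋ bend α Z ⨾ (1[ Y ] ⊗ 1[ ° B ] ⊗ g)
  bend-natural {Z = Z} {Z′} (_∣_ {A} {B} {C} {D} {X} {Y} {W} α β) g =
    push (⨾-cong (◂-++ (° (A ⊗₀ C)) X g) ≋-refl ∙ ≋-sym (exchange (dec A C) (1[ X ] ⊗ g))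
          ∙ ⨾-cong ≋-refl (≋-sym (◂-++ (° C ++ ° A) X g) ∙ ◂-++ (° C) ((A , ○) ∷ X) g))
      (push (≋-sym (◂-⨾ (° C)) ∙ ⊗-cong ≋-refl (bend-natural α g) ∙ ◂-⨾ (° C))
        (push (⨾-cong (≋-sym (◂-++ (° C) Y _)) ≋-refl ∙ bend-natural β (1[ ° B ] ⊗ g))
           (≋-sym (◂-⨾ W) ∙ ⊗-cong ≋-refl
              (⨾-cong (≋-sym (◂-++ (° D) (° B) g)) ≋-refl ∙ ≋-sym (exchange (mul B D) g)) ∙ ◂-⨾ W)))
    ∙ ⨾-cong ≋-refl (⨾-cong ≋-refl (≋-sym (⨾-assoc _ _ _)) ∙ ≋-sym (⨾-assoc _ _ _)) ∙ ≋-sym (⨾-assoc _ _ _)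
  bend-natural {Z = Z} {Z′} (_/_ {A} {B} {X = X} {Y} {X′} {Y′} α β) g =
    ⨾-cong (◂-++ ((A , ○) ∷ X) X′ g) uncast
    ∙ at2 (bend-natural α (1[ X′ ] ⊗ g))
        (≋-refl)
    ∙ ⨾-cong ≋-refl (≋-sym (◂-⨾ Y) ∙ ⊗-cong ≋-refl (⨾-cong (≋-sym (◂-++ (° B) X′ g)) ≋-refl
          ∙ bend-natural β g) ∙ ◂-⨾ Y)
    ∙ ≋-sym (⨾-assoc _ _ _)
    ∙ ⨾-cong (≋-sym uncast) (≋-sym (◂-++ Y Y′ _))
  bend-natural (idᴴ A) g = ⨾-identityʳ _ ∙ ≋-sym (⊗-identityˡ _) ∙ ≋-sym (⨾-identityˡ _)
  bend-natural (idⱽ X) g =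
    at2 (⨾-cong (◂-++ (° unit) X g) ≋-refl ∙ ≋-sym (exchange (κ ○) (1[ X ] ⊗ g)) ∙ ⨾-cong ≋-refl (⊗-identityˡ _))
        (≋-refl)
    ∙ ⨾-cong ≋-refl (≋-sym (◂-⨾ X) ∙ ⊗-cong ≋-refl (⨾-cong (≋-sym (⊗-identityˡ g)) ≋-refl
          ∙ ≋-sym (exchange (ι ○) g)) ∙ ◂-⨾ X)
    ∙ ≋-sym (⨾-assoc _ _ _)
  bend-natural (s° A) g = ≋-sym (◂-⨾ (° A)) ∙ ⊗-cong ≋-refl (⨾-cong (≋-sym (⊗-identityˡ g)) ≋-refl
        ∙ ≋-sym (exchange (ι ○) g)) ∙ ◂-⨾ (° A)
  bend-natural (r° A) g = ⨾-cong (◂-++ (° unit) (° A) g) ≋-refl ∙ ≋-sym (exchange (κ ○) (1[ ° A ] ⊗ g))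
  bend-natural (s• A) g =
    at2 (≋-sym (exchange (ε A) g)) ≋-refl
    ∙ ⨾-cong ≋-refl (≋-sym (exchange (ι ○) g)) ∙ ≋-sym (⨾-assoc _ _ _)
    ∙ ⨾-cong ≋-refl (≋-sym (⊗-identityˡ _))
  bend-natural (r• A) g =
    at2 (≋-sym (exchange (κ ○) g)) ≋-refl
    ∙ ⨾-cong ≋-refl (≋-sym (exchange (η A) g)) ∙ ≋-sym (⨾-assoc _ _ _)
    ∙ ⨾-cong ≋-refl (◂-++ [ A , ● ] (° A) g)
  bend-natural ⌜ f ⌝ g = ≋-sym (exchange (f ⟨°⟩) g) ∙ ⨾-cong ≋-refl (≋-sym (⊗-identityˡ _))

  ⟨°⟩-congʰ : ∀ {A B A′ B′} {f : Hom A B} {g : Hom A′ B′} → f ≈ʰ g → f ⟨°⟩ ≋ g ⟨°⟩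
  ⟨°⟩-congʰ ⌊ p ⌋ = °-cong p

  1-cong : ∀ {X Y} → X ≡ Y → 1[ X ] ≋ 1[ Y ]
  1-cong refl = ≋-refl

  absorbʳ : ∀ {X Y Z W} {f : Term X Y} {k : Term Y Z} → k ≋ 1[ W ] → f ⨾ k ≋ f
  absorbʳ p with refl , refl ← ≋-boundaries p = ⨾-cong ≋-refl p ∙ ⨾-identityʳ _

  absorbˡ : ∀ {X Y Z W} {k : Term X Y} {f : Term Y Z} → k ≋ 1[ W ] → k ⨾ f ≋ f
  absorbˡ p with refl , refl ← ≋-boundaries p = ⨾-cong p ≋-refl ∙ ⨾-identityˡ _

  inverse-unique : ∀ {X Y X′ Y′} {f : Term X Y} {g : Term Y X} {g′ : Term Y X′} {f′ : Term X′ Y} →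
                   f ⨾ g ≋ 1[ X ] → g′ ⨾ f′ ≋ 1[ Y′ ] → f ≋ f′ → g ≋ g′
  inverse-unique p q r with refl , _ ← ≋-boundaries r =
    ≋-sym (absorbˡ q) ∙ ⨾-assoc _ _ _ ∙ absorbʳ (⨾-cong (≋-sym r) ≋-refl ∙ p)

  ◂id▸ : ∀ {X Y B} P Q {k : Term X Y} → k ≋ 1[ B ] → 1[ P ] ⊗ k ⊗ 1[ Q ] ≋ 1[ P ++ B ++ Q ]
  ◂id▸ P Q p = ⊗-cong ≋-refl (⊗-cong p ≋-refl ∙ ⊗-id _ Q) ∙ ⊗-id P _

  ▸id : ∀ {X Y B} Q {k : Term X Y} → k ≋ 1[ B ] → k ⊗ 1[ Q ] ≋ 1[ B ++ Q ]
  ▸id Q p = ⊗-cong p ≋-refl ∙ ⊗-id _ Q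

  ◂▸-⨾ : ∀ {X Y Z} P Q {f : Term X Y} {g : Term Y Z} →
         (1[ P ] ⊗ f ⊗ 1[ Q ]) ⨾ (1[ P ] ⊗ g ⊗ 1[ Q ]) ≋ 1[ P ] ⊗ (f ⨾ g) ⊗ 1[ Q ]
  ◂▸-⨾ P Q = ≋-sym (◂-⨾ P) ∙ ⊗-cong ≋-refl (≋-sym (▸-⨾ Q))

  ◁-natural : ∀ {A A′ B B′} (f : Hom A A′) (g : Hom B B′) →
              (f 𝔸.⊗₁ g) ⟨°⟩ ⨾ ◁ ○ A′ B′ ≋ ◁ ○ A B ⨾ (f ⟨°⟩ ⊗ g ⟨°⟩)
  ◁-natural f g = ⨾-cong (≋-sym (°-⊗ f g)) ≋-refl ∙ ⨾-assoc _ _ _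
    ∙ ⨾-cong ≋-refl (⨾-assoc _ _ _ ∙ absorbʳ (▷⨾◁ ○ _ _))

  σ°σ° : ∀ A B → 𝔸.σ A B ⟨°⟩ ⨾ 𝔸.σ B A ⟨°⟩ ≋ 1[ ° (A ⊗₀ B) ]
  σ°σ° A B = °-⨾ _ _ ∙ °-cong (𝔸.σ-involutive A B) ∙ °-id _

  ⟨°⟩-⊗id : ∀ {A B} C (f : Hom A B) → f ⟨°⟩ ⊗ 1[ ° C ] ≋ f ⟨°⟩ ⊗ 𝔸.id {C} ⟨°⟩
  ⟨°⟩-⊗id C f = ⊗-cong ≋-refl (≋-sym (°-id C))

  dec-mul : ∀ B D → dec B D ⨾ mul B D ≋ 1[ ° (B ⊗₀ D) ]
  dec-mul B D = ⨾-assoc _ _ _ ∙ ⨾-cong ≋-refl (cancel (◁⨾▷ ○ D B) ≋-refl) ∙ σ°σ° B D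

  mul-dec : ∀ B D → mul B D ⨾ dec B D ≋ 1[ ° D ++ ° B ]
  mul-dec B D = ⨾-assoc _ _ _ ∙ ⨾-cong ≋-refl (cancel (σ°σ° D B) ≋-refl) ∙ ▷⨾◁ ○ D B

  dec-coassoc : ∀ A B C → dec (A ⊗₀ B) C ⨾ (1[ ° C ] ⊗ dec A B) ≋ dec A (B ⊗₀ C) ⨾ (dec B C ⊗ 1[ ° A ])
  dec-coassoc A B C =
    ⨾-assoc _ _ _
    ∙ ⨾-cong ≋-refl (⨾-cong ≋-refl (◂-⨾ (° C))
        ∙ push (⨾-cong ≋-refl (⊗-cong (≋-sym (°-id C)) ≋-refl) ∙ ≋-sym (◁-natural 𝔸.id (𝔸.σ A B))) ≋-refl)
    ∙ merge (°-⨾ _ _ ∙ ⟨°⟩-congʰ (yang-baxter′ A B C) ∙ ≋-sym (°-⨾ _ _)) (≋-sym (◁-assoc ○ C B A))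
    ∙ ⨾-assoc _ _ _
    ∙ ⨾-cong ≋-refl (≋-sym (⨾-cong ≋-refl (▸-⨾ (° A))
        ∙ push (⨾-cong ≋-refl (⟨°⟩-⊗id A _) ∙ ≋-sym (◁-natural (𝔸.σ B C) 𝔸.id)) ≋-refl))
    ∙ ≋-sym (⨾-assoc _ _ _)

  mul-assoc : ∀ A B C → (1[ ° C ] ⊗ mul A B) ⨾ mul (A ⊗₀ B) C ≋ (mul B C ⊗ 1[ ° A ]) ⨾ mul A (B ⊗₀ C)
  mul-assoc A B C = inverse-unique
    (⨾-assoc _ _ _ ∙ ⨾-cong ≋-refl (cancel (≋-sym (◂-⨾ (° C)) ∙ ⊗-cong ≋-refl (dec-mul A B)
          ∙ ⊗-id _ _) ≋-refl) ∙ dec-mul _ C)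
    (⨾-assoc _ _ _ ∙ ⨾-cong ≋-refl (cancel (mul-dec A _) ≋-refl) ∙ ≋-sym (▸-⨾ (° A))
          ∙ ⊗-cong (mul-dec B C) ≋-refl ∙ ⊗-id _ _)
    (dec-coassoc A B C)

  dec-κʳ : ∀ A → dec unit A ⨾ (1[ ° A ] ⊗ κ ○) ≋ 1[ ° A ]
  dec-κʳ A = ⨾-assoc _ _ _ ∙ absorbʳ (◁-κʳ ○ A) ∙ ⟨°⟩-congʰ (σ-unitˡ A) ∙ °-id A

  dec-κˡ : ∀ A → dec A unit ⨾ (κ ○ ⊗ 1[ ° A ]) ≋ 1[ ° A ]
  dec-κˡ A = ⨾-assoc _ _ _ ∙ absorbʳ (◁-κˡ ○ A) ∙ ⟨°⟩-congʰ (σ-unitʳ A) ∙ °-id A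

  ι-mulʳ : ∀ A → (1[ ° A ] ⊗ ι ○) ⨾ mul unit A ≋ 1[ ° A ]
  ι-mulʳ A = ≋-sym (⨾-assoc _ _ _) ∙ absorbˡ (ι-▷ʳ ○ A) ∙ ⟨°⟩-congʰ (σ-unitʳ A) ∙ °-id A

  ι-mulˡ : ∀ A → (ι ○ ⊗ 1[ ° A ]) ⨾ mul A unit ≋ 1[ ° A ]
  ι-mulˡ A = ≋-sym (⨾-assoc _ _ _) ∙ absorbˡ (ι-▷ˡ ○ A) ∙ ⟨°⟩-congʰ (σ-unitˡ A) ∙ °-id A

  dec-natural : ∀ {A B C D} (f : Hom A B) (g : Hom C D) → dec A C ⨾ (g ⟨°⟩ ⊗ f ⟨°⟩) ≋ (f 𝔸.⊗₁ g) ⟨°⟩ ⨾ dec B D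
  dec-natural f g = ⨾-assoc _ _ _ ∙ ⨾-cong ≋-refl (≋-sym (◁-natural g f))
    ∙ at2 (°-⨾ _ _ ∙ ≋-sym (°-cong (𝔸.σ-natural f g)) ∙ ≋-sym (°-⨾ _ _)) ≋-refl

  bend-context : ∀ {A B X Y Z Z′} (α : Cell A B X Y) → Z ≡ Z′ → bend α Z ≋ bend α Z′
  bend-context α refl = ≋-refl

  capped : ∀ {A X Y} → Cell A unit X Y → ∀ Z → Term ((A , ○) ∷ X ++ Z) (Y ++ Z)
  capped {Y = Y} α Z = bend α Z ⨾ (1[ Y ] ⊗ κ ○ ⊗ 1[ Z ])

  flatten : ∀ {X Y} → Cell unit unit X Y → ∀ Z → Term (X ++ Z) (Y ++ Z)
  flatten {X} α Z = (ι ○ ⊗ 1[ X ++ Z ]) ⨾ capped α Z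

module BendingSound {o ℓ e} (𝔸 : SymmetricStrictMonoidalCategory o ℓ e) where
  private module 𝔸 = SymmetricStrictMonoidalCategory 𝔸
  open 𝔸 using (unit; _⊗₀_)
  open Coherence 𝔸 using (⌊_⌋)
  open Presentation 𝔸
  open Bending 𝔸
  open C using (Cell; _∣_; _/_; idᴴ; idⱽ; s°; r°; s•; r•; ⌜_⌝)

  bend-resp : ∀ {A B X Y A′ B′ X′ Y′} {α : Cell A B X Y} {β : Cell A′ B′ X′ Y′} →
              α C.≋ β → ∀ Q → bend α Q ≋ bend β Q
  bend-resp C.≋-refl Q = ≋-refl
  bend-resp (C.≋-sym p) Q = ≋-sym (bend-resp p Q)
  bend-resp (C.≋-trans p q) Q = bend-resp p Q ∙ bend-resp q Q
  bend-resp (C.∣-cong p q) Q with C.≋-boundaries p | C.≋-boundaries q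
  ... | (refl , refl) , (refl , refl) | (refl , refl) , (_ , refl) =
    ⨾-cong ≋-refl (⨾-cong (⊗-cong ≋-refl (bend-resp p Q)) (⨾-cong (bend-resp q _) ≋-refl))
  bend-resp (C./-cong p q) Q with C.≋-boundaries p | C.≋-boundaries q
  ... | (refl , refl) , (refl , refl) | (_ , refl) , (refl , refl) =
    uncast ∙ ⨾-cong (bend-resp p _) (⊗-cong ≋-refl (bend-resp q Q)) ∙ ≋-sym uncast
  bend-resp (C.∣-assoc {A} {A′} {B} {B′} {C} {C′} {X} {Y} {Z} {W} α β γ) Q =
    ⨾-cong ≋-refl (split (◂-⨾ (° C)) ≋-refl ∙ ⨾-cong ≋-refl (split (◂-⨾ (° C)) ≋-refl
      ∙ ⨾-cong ≋-refl (split (◂-⨾ (° C)) ≋-refl ∙ ⨾-cong ≋-refl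
          (push (⨾-cong (≋-sym (◂-++ (° C) Z _)) ≋-refl ∙ bend-natural γ (mul A′ B′ ⊗ 1[ Q ])) 
            (⨾-cong (⊗-cong ≋-refl (≋-sym (⊗-assoc _ _ _))) ≋-refl ∙ ◂▸-⨾ W Q)))))
    ∙ merge (⨾-cong ≋-refl (≋-sym (⊗-assoc _ _ _)) ∙ ≋-sym (▸-⨾ (X ++ Q)) ∙ ⊗-cong (dec-coassoc A B C) ≋-refl)
        (⨾-cong ≋-refl (⨾-cong ≋-refl (⨾-cong ≋-refl (⊗-cong ≋-refl (⊗-cong (mul-assoc A′ B′ C′) ≋-refl)))))
    ∙ ≋-sym
        (⨾-cong ≋-refl (⨾-cong ≋-refl (⨾-assoc _ _ _)
          ∙ push (≋-sym (exchange (dec B C) (bend α Q)))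
              (⨾-cong (◂-++ (° C) (° B) _) (⨾-assoc _ _ _ ∙ ⨾-cong ≋-refl (⨾-assoc _ _ _ ∙ ⨾-cong ≋-refl
                (⨾-cong (⊗-cong ≋-refl (▸-++ (° A′) Q _)) ≋-refl ∙ ◂▸-⨾ W Q)))))
          ∙ merge (⨾-cong ≋-refl (▸-++ (° A) (X ++ Q) _) ∙ ≋-sym (▸-⨾ (X ++ Q))) ≋-refl)
  bend-resp (C.∣-identityˡ {A} {B} {X} {Y} α) Q =
    ⨾-cong ≋-refl (split (◂-⨾ (° A)) ≋-refl ∙ ⨾-cong ≋-refl (push
        (⨾-cong (≋-sym (◂-++ (° A) X _)) ≋-refl ∙ bend-natural α (ι ○ ⊗ 1[ Q ]))
        (⨾-cong (⊗-cong ≋-refl (≋-sym (⊗-assoc _ _ _))) ≋-refl ∙ ◂▸-⨾ Y Q)))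
    ∙ cancel (⨾-cong ≋-refl (≋-sym (⊗-assoc _ _ _)) ∙ ≋-sym (▸-⨾ (X ++ Q)) ∙ ▸id (X ++ Q) (dec-κʳ A)) ≋-refl
    ∙ absorbʳ (◂id▸ Y Q (ι-mulʳ B))
  bend-resp (C.∣-identityʳ {A} {B} {X} {Y} α) Q =
    ⨾-cong ≋-refl (⨾-cong ≋-refl (⨾-assoc _ _ _) ∙ push (≋-sym (exchange (κ ○) (bend α Q)))
      (⨾-cong (⊗-identityˡ _) (⨾-cong (⊗-cong ≋-refl (▸-++ (° B) Q _)) ≋-refl ∙ ◂▸-⨾ Y Q)
        ∙ absorbʳ (◂id▸ Y Q (ι-mulˡ B))))
    ∙ cancel (⨾-cong ≋-refl (▸-++ (° A) (X ++ Q) _) ∙ ≋-sym (▸-⨾ (X ++ Q)) ∙ ▸id (X ++ Q) (dec-κˡ A)) ≋-refl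
  bend-resp (C./-assoc {X = X} {X′} {Y} {Y′} {Z} {Z′} α β γ) Q =
    uncast ∙ ⨾-cong uncast (◂-++ X′ Y′ _) ∙ ⨾-assoc _ _ _
    ∙ ⨾-cong (bend-context α (sym (++-assoc Y Z Q))) (≋-sym (⊗-cong ≋-refl uncast ∙ ◂-⨾ X′))
    ∙ ≋-sym uncast
  bend-resp (C./-identityˡ α) Q = uncast ∙ ⨾-identityˡ _ ∙ ⊗-identityˡ _
  bend-resp (C./-identityʳ {X = X} {Y} α) Q = uncast ∙ absorbʳ (⊗-id Y _)
  bend-resp (C.idᴴ-∣ A B) Q =
    ⨾-cong ≋-refl (absorbˡ (⊗-id (° B) _) ∙ ⨾-identityˡ _ ∙ ⊗-identityˡ _)
    ∙ ≋-sym (▸-⨾ Q) ∙ ▸id Q (dec-mul A B)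
  bend-resp (C.idⱽ-/ X Y) Q =
    uncast ∙ ⨾-assoc _ _ _
    ∙ ⨾-cong ≋-refl (⨾-cong ≋-refl (◂-⨾ X)
        ∙ cancel (≋-sym (◂-⨾ X) ∙ ⊗-cong ≋-refl (≋-sym (▸-⨾ (Y ++ Q)) ∙ ⊗-cong (ι⨾κ ○) ≋-refl
              ∙ ⊗-identityˡ _) ∙ ⊗-id X _) ≋-refl)
    ∙ ⨾-cong (⊗-cong ≋-refl (1-cong (sym (++-assoc X Y Q)))) (≋-sym (◂-++ X Y _))
  bend-resp C.idᴴ≋idⱽ Q = ≋-sym (⨾-cong ≋-refl (⊗-identityˡ _) ∙ ≋-sym (▸-⨾ Q) ∙ ▸id Q (κ⨾ι ○))
  bend-resp (C.interchange {A} {B} {C} {A′} {B′} {C′} {X} {Y} {Z} {X′} {Y′} {Z′} α β γ δ) Q =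
    ⨾-cong (⊗-cong ≋-refl (1-cong (++-assoc X X′ Q)))
      (split (⊗-cong ≋-refl uncast ∙ ◂-⨾ (° A′))
        (⨾-cong uncast (◂-++ Z Z′ _) ∙ ⨾-assoc _ _ _)
      ∙ ⨾-cong ≋-refl (push (⨾-cong (≋-sym (◂-++ (° A′) Y _)) ≋-refl ∙ bend-natural γ (bend β Q)) ≋-refl))
    ∙ ≋-sym (uncast ∙ ⨾-assoc _ _ _ ∙ ⨾-cong ≋-refl (⨾-assoc _ _ _ ∙ ⨾-cong ≋-refl (⨾-assoc _ _ _
        ∙ ⨾-cong ≋-refl (⨾-cong ≋-refl (◂-⨾ Z)
           ∙ cancel (◂▸-⨾ Z (X′ ++ Q) ∙ ◂id▸ Z (X′ ++ Q) (mul-dec B B′))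
               (◂-⨾ Z ∙ ⨾-cong (≋-sym (◂-++ Z (° B′) _) ∙ ◂-++ Z (° B′) _) (◂-⨾ Z))))))
  bend-resp (C.yank-°-∣ A) Q =
    ⨾-cong ≋-refl (push (≋-sym (exchange (κ ○) _))
      (⨾-cong (⊗-identityˡ _ ∙ ≋-sym (⊗-assoc _ _ _)) (⊗-identityˡ _) ∙ ≋-sym (▸-⨾ Q)))
    ∙ cancel (⨾-cong ≋-refl (▸-++ (° A) Q _) ∙ ≋-sym (▸-⨾ Q) ∙ ▸id Q (dec-κˡ A)) (▸id Q (ι-mulʳ A))
  bend-resp (C.yank-°-/ A) Q = uncast ∙ ⨾-cong ≋-refl (⊗-identityˡ _)
  bend-resp (C.yank-•-∣ A) Q =
    ⨾-cong ≋-refl (split (◂-⨾ (° A)) (⨾-assoc _ _ _))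
    ∙ cancel (⨾-cong ≋-refl (≋-sym (⊗-assoc _ _ _)) ∙ ≋-sym (▸-⨾ Q) ∙ ▸id Q (dec-κʳ A)) ≋-refl
    ∙ cancel (⨾-cong (≋-sym (⊗-assoc _ _ _)) (▸-++ (° A) Q _) ∙ ≋-sym (▸-⨾ Q) ∙ ▸id Q (snake° A))
        (⨾-cong (▸-++ (° A) Q _) (⊗-identityˡ _) ∙ ≋-sym (▸-⨾ Q) ∙ ▸id Q (ι-mulˡ A))
  bend-resp (C.yank-•-/ A) Q =
    uncast ∙ ⨾-assoc _ _ _
    ∙ ⨾-cong ≋-refl (⨾-cong ≋-refl (◂-⨾ [ A , ● ])
        ∙ cancel (⨾-cong (▸-++ [ A , ● ] Q _) (≋-sym (⊗-assoc _ _ _)) ∙ ≋-sym (▸-⨾ Q) ∙ ▸id Q (snake• A)) ≋-refl)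
  bend-resp (C.⌜⌝-cong p) Q = ⊗-cong (°-cong p) ≋-refl
  bend-resp (C.⌜⌝-⨾ f g) Q = uncast ∙ ⨾-cong ≋-refl (⊗-identityˡ _) ∙ ≋-sym (▸-⨾ Q) ∙ ⊗-cong (°-⨾ f g) ≋-refl
  bend-resp (C.⌜⌝-id A) Q = ▸id Q (°-id A)
  bend-resp (C.⌜⌝-⊗ {A} {B} {C} {D} f g) Q =
    ⨾-cong ≋-refl (⨾-cong (≋-sym (⊗-assoc _ _ _)) (⨾-cong (▸-++ (° B) Q _) (⊗-identityˡ _) ∙ ≋-sym (▸-⨾ Q))
          ∙ ≋-sym (▸-⨾ Q))
    ∙ ≋-sym (▸-⨾ Q)
    ∙ ⊗-cong
        (⨾-cong ≋-refl (merge (≋-sym (exchange (g ⟨°⟩) (f ⟨°⟩))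
            ∙ ≋-sym (⊗-⨾ _ _ _ _) ∙ ⊗-cong (⨾-identityʳ _) (⨾-identityˡ _)) ≋-refl)
          ∙ merge (dec-natural f g) ≋-refl ∙ ⨾-assoc _ _ _ ∙ absorbʳ (dec-mul B D))
        ≋-refl

module Fullness {o ℓ e} (𝔸 : SymmetricStrictMonoidalCategory o ℓ e) where
  private module 𝔸 = SymmetricStrictMonoidalCategory 𝔸
  open 𝔸 using (unit; _⊗₀_)
  open Coherence 𝔸 using (σσʰ)
  open FreeCornering 𝔸
  open Functor 𝔸
  open Corners 𝔸
  open Soundness 𝔸
  open Bending 𝔸 using (bend; dec; mul; flatten)
  private module HC = StrictMonoidalCategory (𝐇 (𝒞 𝔸))
  open T using (Term; 1[_]; ι; κ)

  M₁-subst₂ : ∀ {X Y X′ Y′} (p : X ≡ X′) (q : Y ≡ Y′) {f : Term X Y} → M₁ (subst₂ Term p q f) ≋ M₁ f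
  M₁-subst₂ refl refl = ≋-refl

  private
    absorb-⌜id⌝ : ∀ {A B C X X′ Y Y′} {α : Cell B A X Y} {β : Cell A C X′ Y′} → α / ⌜ 𝔸.id ⌝ / β ≋ α / β
    absorb-⌜id⌝ = ≋-sym (/-⌜id⌝ _ _)

  M₁-dec : ∀ A C → M₁ (dec A C) ≋ r° (A ⊗₀ C) / Companion.S (⟨ C ⟩° ⊙ ⟨ A ⟩°)
  M₁-dec A C = rep-⨾° ⟨ C ⊗₀ A ⟩° {v = 𝔸.σ A C} ≋-refl ≋-refl
    ∙ rep-cong ≋-refl (σσʰ A C) ≋-refl ∙ absorb-⌜id⌝

  M₁-mul : ∀ B D → M₁ (mul B D) ≋ Companion.R (⟨ D ⟩° ⊙ ⟨ B ⟩°) / s° (B ⊗₀ D)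
  M₁-mul B D = rep-⨾° ⟨ D ⊗₀ B ⟩° {w = 𝔸.σ D B} (rep-▷○ D B) ≋-refl
    ∙ rep-cong ≋-refl (σσʰ B D) ≋-refl ∙ absorb-⌜id⌝

  ∣-top : ∀ {X Y Z} (r : Cell unit unit X []) (β : Cell unit unit Y Z) → (r / idⱽ Y) ∣ β ≋ r / β
  ∣-top {Y = Y} r β = ∣-cong ≋-refl (≋-sym (/-identityˡ β)) ∙ interchange r (idⱽ Y) (idᴴ unit) β
    ∙ /-cong (idᴴ-∣-identityʳ r) (∣-identityˡ β)

  M₁-bend : ∀ {A B X Y} (α : Cell A B X Y) Z → M₁ (bend α Z) ≋ r° A / α / s° B / idⱽ Z
  M₁-bend (_∣_ {A} {B} {C} {D} {X} {Y} {W} α β) Z =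
    HC.⨾-cong ≋-refl (≋-sym (HC.⨾-assoc α′ β′ μ)) ∙ ≋-sym (HC.⨾-assoc δ (α′ HC.⨾ β′) μ) ∙ ⨾≋∣
    ∙ cut° P.S∣R
        (⨾≋∣ ∙ cut° Q.S∣R (/-cong (M₁-dec A C) ≋-refl ∙ /-assoc _ _ _) (middle ∙ ≋-sym (idⱽ-/-identityˡ _))
          ∙ /-cong ≋-refl (/-identityˡ _) ∙ ≋-sym (/-assoc _ _ _))
        (/-cong ≋-refl (/-cong (M₁-mul B D) ≋-refl ∙ /-assoc _ _ _))
    ∙ /-cong ≋-refl (/-identityˡ _) ∙ /-assoc _ _ _
    where
    P Q : Companion
    P = ⟨ D ⟩° ⊙ ⟨ B ⟩°
    Q = ⟨ C ⟩° ⊙ ⟨ A ⟩°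
    module P = Companion P
    module Q = Companion Q

    δ = M₁ (dec A C) / idⱽ (X ++ Z)
    α′ = idⱽ [ C , ○ ] / M₁ (bend α Z)
    β′ = M₁ (bend β ((B , ○) ∷ Z))
    μ = idⱽ W / M₁ (mul B D) / idⱽ Z

    middle : α′ HC.⨾ β′ ≋ Q.R / (α ∣ β) / P.S / idⱽ Z
    middle = ⨾≋∣
      ∙ ∣-cong (/-cong ≋-refl (M₁-bend α Z)) (M₁-bend β ((B , ○) ∷ Z))
      ∙ interchange (idⱽ [ C , ○ ]) (r° A / α / s° B / idⱽ Z) (r° C) (β / s° D / idⱽ ((B , ○) ∷ Z))
      ∙ /-cong (∣-identityˡ _)
          (∣-cong ≋-refl (≋-sym (/-identityˡ _))
            ∙ interchange (r° A) (α / s° B / idⱽ Z) (idᴴ C) (β / s° D / idⱽ ((B , ○) ∷ Z))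
            ∙ /-cong (≋-sym uncast)
                (interchange α (s° B / idⱽ Z) β (s° D / idⱽ ((B , ○) ∷ Z))
                  ∙ /-cong ≋-refl
                      (∣-cong (≋-sym (/-identityˡ _)) ≋-refl
                        ∙ interchange (idᴴ B) (s° B / idⱽ Z) (s° D) (idⱽ ((B , ○) ∷ Z))
                        ∙ /-cong (≋-sym uncast) (∣-identityʳ _) ∙ ≋-sym (/-assoc _ _ _))))
      ∙ ≋-sym (/-assoc _ _ _)
  M₁-bend (_/_ {A} {B} {X = X} {Y} {X′} {Y′} α β) Z =
    M₁-subst₂ (cong ((A , ○) ∷_) (sym (++-assoc X X′ Z))) (sym (++-assoc Y Y′ _)) ∙ ⨾≋∣
    ∙ cut° (yank-°-∣ B) (M₁-bend α (X′ ++ Z) ∙ ≋-sym (/-assoc (r° A) α _)) (/-cong ≋-refl (M₁-bend β Z))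
    ∙ /-cong ≋-refl (/-identityˡ _) ∙ /-assoc (r° A) α _ ∙ /-cong ≋-refl (≋-sym (/-assoc α β _))
  M₁-bend (idᴴ A) Z = ≋-sym (/-cong ≋-refl (/-identityˡ _) ∙ ≋-sym (/-assoc _ _ _)
        ∙ /-cong (yank-°-/ A) ≋-refl ∙ idⱽ-/ _ Z)
  M₁-bend (idⱽ X) Z = ⨾≋∣ ∙ ∣-top (r° unit) _
  M₁-bend (s° A) Z = ≋-sym (≋-sym (/-assoc _ _ _) ∙ /-cong (yank-°-/ A) ≋-refl)
  M₁-bend (r° A) Z = /-cong ≋-refl (≋-sym (≋-sym (/-assoc _ _ _) ∙ /-cong (yank-°-/ A) ≋-refl ∙ idⱽ-/ _ Z))
  M₁-bend (s• A) Z = ⨾≋∣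
    ∙ interchange (r° A / s• A) (idⱽ Z) (s° unit) (idⱽ Z)
    ∙ /-cong (≋-sym (slideʳ (r° A / s• A) (s° unit))) (∣-identityˡ _)
    ∙ /-assoc _ _ _ ∙ /-assoc _ _ _
  M₁-bend (r• A) Z = ⨾≋∣ ∙ ∣-top (r° unit) _ ∙ /-cong ≋-refl (/-assoc _ _ _)
  M₁-bend ⌜ f ⌝ Z = /-assoc _ _ _ ∙ /-cong ≋-refl (/-assoc _ _ _)

  M₁-flatten : ∀ {X Y} (α : Cell unit unit X Y) Z → M₁ (flatten α Z) ≋ α / idⱽ Z
  M₁-flatten α Z = ⨾≋∣
    ∙ cut° {S = s° unit} {R = r° unit} (yank-°-∣ unit) (≋-sym (/-identityˡ _))
        (⨾≋∣ ∙ cut° (yank-°-∣ unit) (M₁-bend α Z ∙ ≋-sym (/-assoc _ _ _))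
                    ≋-refl
          ∙ /-cong ≋-refl (/-identityˡ _) ∙ /-assoc _ _ _ ∙ ≋-sym (idⱽ-/-identityˡ _))
    ∙ /-identityˡ _ ∙ /-identityˡ _

  M₁-surjective : ∀ {X Y} (α : Cell unit unit X Y) → ∃[ f ] M₁ {X} {Y} f ≋ α
  M₁-surjective {X} {Y} α =
    subst₂ Term (++-identityʳ X) (++-identityʳ Y) (flatten α []) ,
    (M₁-subst₂ (++-identityʳ X) (++-identityʳ Y) ∙ M₁-flatten α [] ∙ idⱽ-/-identityʳ α)

module Faithfulness {o ℓ e} (𝔸 : SymmetricStrictMonoidalCategory o ℓ e) where
  private module 𝔸 = SymmetricStrictMonoidalCategory 𝔸
  open 𝔸 using (unit; _⊗₀_; Hom)
  open Coherence 𝔸 using (⌊_⌋)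
  open Presentation 𝔸
  open Bending 𝔸
  open BendingSound 𝔸
  open C using (Cell; _∣_; _/_; idᴴ; idⱽ; s°; r°; s•; r•; ⌜_⌝)
  open Functor 𝔸 using (M₁; _∣ˢ_; _ˢ∣_; _∣ʳ_; _ʳ∣_)

  capped-resp : ∀ {A X Y A′ X′ Y′} {α : Cell A unit X Y} {β : Cell A′ unit X′ Y′} →
                α C.≋ β → ∀ Z → capped α Z ≋ capped β Z
  capped-resp p Z with _ , (_ , refl) ← C.≋-boundaries p = ⨾-cong (bend-resp p Z) ≋-refl

  flatten-resp : ∀ {X Y X′ Y′} {α : Cell unit unit X Y} {β : Cell unit unit X′ Y′} →
                 α C.≋ β → ∀ Z → flatten α Z ≋ flatten β Z
  flatten-resp p Z with _ , (refl , _) ← C.≋-boundaries p = ⨾-cong ≋-refl (capped-resp p Z)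

  capped-/ : ∀ {A B X Y X′ Y′} (α : Cell A B X Y) (β : Cell B unit X′ Y′) Z →
             capped (α / β) Z ≋ bend α (X′ ++ Z) ⨾ (1[ Y ] ⊗ capped β Z)
  capped-/ {Y = Y} {Y′ = Y′} α β Z = ⨾-cong uncast (◂-++ Y Y′ _) ∙ ⨾-assoc _ _ _ ∙ ⨾-cong ≋-refl (≋-sym (◂-⨾ Y))

  capped-s° : ∀ A Z → capped (s° A) Z ≋ 1[ (A , ○) ∷ Z ]
  capped-s° A Z = ◂▸-⨾ (° A) Z ∙ ◂id▸ (° A) Z (ι⨾κ ○)

  capped-s• : ∀ A Z → capped (s• A) Z ≋ ε A ⊗ 1[ Z ]
  capped-s• A Z = ⨾-assoc _ _ _ ∙ absorbʳ (⨾-cong ≋-refl (⊗-identityˡ _) ∙ ≋-sym (▸-⨾ Z) ∙ ▸id Z (ι⨾κ ○))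

  flatten-r° : ∀ {A X Y} (α : Cell A unit X Y) Z → flatten (r° A / α) Z ≋ capped α Z
  flatten-r° {A} {X} α Z = ⨾-cong ≋-refl (capped-/ (r° A) α Z)
    ∙ cancel (≋-sym (▸-⨾ _) ∙ ▸id _ (ι⨾κ ○)) (⊗-identityˡ _)

  flatten-r• : ∀ {A X Y} (α : Cell A unit X Y) Z →
               flatten (r• A / α) Z ≋ (η A ⊗ 1[ X ++ Z ]) ⨾ (1[ [ A , ● ] ] ⊗ capped α Z)
  flatten-r• {A} {X} α Z = ⨾-cong ≋-refl (capped-/ (r• A) α Z ∙ ⨾-assoc _ _ _)
    ∙ cancel (≋-sym (▸-⨾ _) ∙ ▸id _ (ι⨾κ ○)) ≋-refl

  bend-cast : ∀ {A B X Y A′ B′ X′ Y′} (p : A ≡ A′) (q : B ≡ B′) (r : X ≡ X′) (s : Y ≡ Y′) (α : Cell A B X Y) Z →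
              bend (cast Cell p q r s α) Z ≋ bend α Z
  bend-cast refl refl refl refl α Z = ≋-refl

  bend-∣ˢ : ∀ A B Z → bend (B ∣ˢ s° A) Z ≋ dec B A ⊗ 1[ Z ]
  bend-∣ˢ A B Z = bend-cast refl (𝔸.⊗₀-identityʳ B) refl refl (idᴴ B ∣ s° A) Z
    ∙ absorbʳ (absorbˡ (⊗-id (° A) _)
        ∙ ⨾-cong (⊗-cong ≋-refl (▸-++ (° B) Z _)) ≋-refl ∙ ◂▸-⨾ (° A) Z ∙ ◂id▸ (° A) Z (ι-mulˡ B))

  bend-ʳ∣ : ∀ A B Z → bend (r° B ʳ∣ A) Z ≋ mul B A ⊗ 1[ Z ]
  bend-ʳ∣ A B Z = bend-cast (𝔸.⊗₀-identityˡ A) refl refl refl (r° B ∣ idᴴ A) Z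
    ∙ cancel (⨾-cong ≋-refl (≋-sym (⊗-assoc _ _ _)) ∙ ≋-sym (▸-⨾ _) ∙ ▸id _ (dec-κʳ A)) ≋-refl
    ∙ ⨾-identityˡ _ ∙ ⊗-identityˡ _

  bend-∣ʳ : ∀ A B Z → bend (A ∣ʳ r• B) Z ≋ (η B ⊗ 1[ (A , ○) ∷ Z ]) ⨾ (1[ [ B , ● ] ] ⊗ mul A B ⊗ 1[ Z ])
  bend-∣ʳ A B Z = bend-cast (𝔸.⊗₀-identityʳ A) refl refl refl (idᴴ A ∣ r• B) Z
    ∙ ⨾-cong ≋-refl (absorbˡ (⊗-id _ _) ∙ ⨾-assoc _ _ _)
    ∙ cancel (⨾-cong ≋-refl (▸-++ (° A) Z _) ∙ ≋-sym (▸-⨾ Z) ∙ ▸id Z (dec-κˡ A)) ≋-refl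

  bend-ˢ∣ : ∀ A B Z → bend (s• A ˢ∣ B) Z ≋ (dec A B ⊗ 1[ (A , ●) ∷ Z ]) ⨾ (1[ ° B ] ⊗ ε A ⊗ 1[ Z ])
  bend-ˢ∣ A B Z = bend-cast refl (𝔸.⊗₀-identityˡ B) refl refl (s• A ∣ idᴴ B) Z
    ∙ ⨾-cong ≋-refl (split (◂-⨾ (° B)) (⨾-identityˡ _ ∙ ⊗-identityˡ _)
        ∙ absorbʳ (⨾-cong (≋-sym (⊗-assoc _ _ _)) ≋-refl ∙ ≋-sym (▸-⨾ Z) ∙ ▸id Z (ι-mulʳ B)))

  dec-unit : dec unit unit ≋ ι ○ ⊗ 1[ ° unit ]
  dec-unit = ≋-sym (absorbʳ (≋-sym (▸-⨾ (° unit)) ∙ ▸id (° unit) (κ⨾ι ○)))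
    ∙ ≋-sym (⨾-assoc _ _ _) ∙ absorbˡ (dec-κˡ unit)

  mul-unit : mul unit unit ≋ κ ○ ⊗ 1[ ° unit ]
  mul-unit = ≋-sym (absorbˡ (≋-sym (▸-⨾ (° unit)) ∙ ▸id (° unit) (κ⨾ι ○)))
    ∙ ⨾-assoc _ _ _ ∙ absorbʳ (ι-mulˡ unit)

  flatten-∣ : ∀ {X Y W} (α : Cell unit unit X Y) (β : Cell unit unit Y W) Z →
              flatten (cast Cell (𝔸.⊗₀-identityˡ unit) (𝔸.⊗₀-identityˡ unit) refl refl
                    (α ∣ β)) Z ≋ flatten α Z ⨾ flatten β Z
  flatten-∣ {X} {Y} {W} α β Z =
    ⨾-cong ≋-refl (⨾-cong
        (bend-cast (𝔸.⊗₀-identityˡ unit) (𝔸.⊗₀-identityˡ unit) refl refl (α ∣ β) Z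
          ∙ ⨾-cong (⊗-cong dec-unit ≋-refl ∙ ⊗-assoc _ _ _ ∙ ⊗-cong ≋-refl (⊗-id _ _))
              (⨾-cong ≋-refl (⨾-cong ≋-refl (⊗-cong ≋-refl (⊗-cong mul-unit ≋-refl ∙ ⊗-assoc _ _ _
                    ∙ ⊗-cong ≋-refl (⊗-id _ _)))))
          ∙ push (exchange (ι ○) (bend α Z) ) ≋-refl ∙ ⨾-cong (⊗-identityˡ _) ≋-refl) ≋-refl
      ∙ ⨾-assoc _ _ _
      ∙ ⨾-cong ≋-refl (⨾-assoc _ _ _ ∙ ⨾-cong ≋-refl (⨾-assoc _ _ _
          ∙ ⨾-cong ≋-refl (≋-sym (◂-⨾ W) ∙ ⊗-cong ≋-refl (⨾-cong ≋-refl (≋-sym (⊗-identityˡ _))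
                ∙ exchange (κ ○) κᶻ) ∙ ◂-⨾ W)
          ∙ push (≋-sym (bend-natural β κᶻ)) ≋-refl)
        ∙ push (⨾-cong ≋-refl (◂-++ (° unit) Y κᶻ) ∙ exchange (ι ○) (1[ Y ] ⊗ κᶻ)
              ∙ ⨾-cong (⊗-identityˡ _) ≋-refl) ≋-refl))
    ∙ ≋-sym (⨾-assoc _ _ _ ∙ ⨾-cong ≋-refl (⨾-assoc _ _ _))
    where
    κᶻ = κ ○ ⊗ 1[ Z ]

  flatten-/ : ∀ {X Y X′ Y′} (α : Cell unit unit X Y) (β : Cell unit unit X′ Y′) Z →
              flatten (α / β) Z ≋ flatten α (X′ ++ Z) ⨾ (1[ Y ] ⊗ flatten β Z)
  flatten-/ {X} {Y} {X′} {Y′} α β Z =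
    ⨾-cong (⊗-cong ≋-refl (1-cong (++-assoc X X′ Z))) (capped-/ α β Z
      ∙ ≋-sym (⨾-assoc _ _ _ ∙ ⨾-cong ≋-refl (⨾-cong ≋-refl (◂-⨾ Y)
          ∙ cancel (◂▸-⨾ Y (X′ ++ Z) ∙ ◂id▸ Y (X′ ++ Z) (κ⨾ι ○)) ≋-refl)))
    ∙ ≋-sym (⨾-assoc _ _ _)

  mate : ∀ {A X} (g : Term X [ A , ● ]) → (η A ⊗ 1[ X ]) ⨾ (1[ [ A , ● ] ] ⊗ ((1[ ° A ] ⊗ g) ⨾ ε A)) ≋ g
  mate {A} g = ⨾-cong ≋-refl (◂-⨾ [ A , ● ])
    ∙ push (⨾-cong ≋-refl (≋-sym (◂-++ [ A , ● ] (° A) g)) ∙ exchange (η A) g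
          ∙ ⨾-cong (⊗-identityˡ g) ≋-refl) (snake• A)
    ∙ ⨾-identityʳ g

  E₂ : ∀ A B → Term ((A ⊗₀ B , ○) ∷ (A , ●) ∷ (B , ●) ∷ []) []
  E₂ A B = (dec A B ⊗ 1[ (A , ●) ∷ (B , ●) ∷ [] ]) ⨾ E B A

  N₂ : ∀ A B → Term [] ((A , ●) ∷ (B , ●) ∷ (A ⊗₀ B , ○) ∷ [])
  N₂ A B = η A ⨾ (1[ [ A , ● ] ] ⊗ ((η B ⊗ 1[ ° A ]) ⨾ (1[ [ B , ● ] ] ⊗ mul A B)))

  N₂-whisker : ∀ A B Q → N₂ A B ⊗ 1[ Q ] ≋
    (η A ⊗ 1[ Q ]) ⨾ (1[ [ A , ● ] ] ⊗ (η B ⊗ 1[ (A , ○) ∷ Q ])) ⨾ (1[ (A , ●) ∷ (B , ●) ∷ [] ] ⊗ mul A B ⊗ 1[ Q ])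
  N₂-whisker A B Q = ▸-⨾ Q ∙ ⨾-cong ≋-refl
    (⊗-assoc _ _ _ ∙ ⊗-cong ≋-refl (▸-⨾ Q) ∙ ◂-⨾ [ A , ● ]
      ∙ ⨾-cong (⊗-cong ≋-refl (≋-sym (▸-++ (° A) Q (η B))))
          (⊗-cong ≋-refl (⊗-assoc _ _ _) ∙ ≋-sym (◂-++ [ A , ● ] [ B , ● ] _)))

  snake₂ : ∀ A B → (N₂ A B ⊗ 1[ (A , ●) ∷ (B , ●) ∷ [] ]) ⨾ (1[ (A , ●) ∷ (B , ●) ∷ [] ] ⊗ E₂ A B)
                     ≋ 1[ (A , ●) ∷ (B , ●) ∷ [] ]
  snake₂ A B =
    ⨾-cong (N₂-whisker A B P) (◂-⨾ P ∙ ⨾-cong ≋-refl (◂-⨾ P))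
    ∙ ⨾-assoc _ _ _ ∙ ⨾-cong ≋-refl (⨾-assoc _ _ _
        ∙ ⨾-cong ≋-refl (cancel (◂▸-⨾ P P ∙ ◂id▸ P P (mul-dec A B)) ≋-refl)
        ∙ push (⨾-cong ≋-refl (◂-++ [ A , ● ] [ B , ● ] _) ∙ ≋-sym (◂-⨾ [ A , ● ])
                  ∙ ⊗-cong ≋-refl (⨾-cong ≋-refl (≋-sym (◂-++ [ B , ● ] (° B) _))
                        ∙ exchange (η B) (ε A ⊗ 1[ [ B , ● ] ])
                      ∙ ⨾-cong (⊗-identityˡ _) ≋-refl)
                  ∙ ◂-⨾ [ A , ● ])
            (⨾-cong ≋-refl (◂-++ [ A , ● ] [ B , ● ] (ε B)) ∙ ≋-sym (◂-⨾ [ A , ● ])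
               ∙ ⊗-cong ≋-refl (snake• B) ∙ ⊗-id _ _))
    ∙ cancel (⨾-cong (▸-++ [ A , ● ] [ B , ● ] (η A)) (≋-sym (⊗-assoc _ _ _)) ∙ ≋-sym (▸-⨾ [ B , ● ])
        ∙ ▸id [ B , ● ] (snake• A)) ≋-refl
    where
    P = (A , ●) ∷ (B , ●) ∷ []

  flatten-R• : ∀ {A X} (α : Cell A unit X []) Z {w : Term ((A , ○) ∷ X) []} {g : Term X [ A , ● ]} →
               capped α Z ≋ w ⊗ 1[ Z ] → w ≋ (1[ ° A ] ⊗ g) ⨾ ε A → flatten (r• A / α) Z ≋ g ⊗ 1[ Z ]
  flatten-R• {A} {X} α Z {w} {g} p q = flatten-r• α Z
    ∙ ⨾-cong (▸-++ X Z (η A)) (⊗-cong ≋-refl (p ∙ ⊗-cong q ≋-refl) ∙ ≋-sym (⊗-assoc _ _ _))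
    ∙ ≋-sym (▸-⨾ Z) ∙ ⊗-cong (mate g) ≋-refl

  flatten-R•₂ : ∀ {A B X} (α : Cell (A ⊗₀ B) unit X []) Z {w : Term ((A ⊗₀ B , ○) ∷ X) []} {g : Term X
        ((A , ●) ∷ (B , ●) ∷ [])} →
                capped α Z ≋ w ⊗ 1[ Z ] → w ≋ (1[ ° (A ⊗₀ B) ] ⊗ g) ⨾ E₂ A B →
                      flatten (r• A / ((A ∣ʳ r• B) / α)) Z ≋ g ⊗ 1[ Z ]
  flatten-R•₂ {A} {B} {X} α Z {w} {g} p q =
    flatten-r• ((A ∣ʳ r• B) / α) Z
    ∙ ⨾-cong ≋-refl (⊗-cong ≋-refl (capped-/ (A ∣ʳ r• B) α Z ∙ ⨾-cong (bend-∣ʳ A B (X ++ Z)) ≋-refl ∙ ⨾-assoc _ _ _)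
        ∙ ◂-⨾ [ A , ● ] ∙ ⨾-cong ≋-refl (◂-⨾ [ A , ● ]
            ∙ ⨾-cong (≋-sym (◂-++ [ A , ● ] [ B , ● ] _)) (≋-sym (◂-++ [ A , ● ] [ B , ● ] _)))
        ∙ ≋-sym (⨾-assoc _ _ _))
    ∙ ≋-sym (⨾-assoc _ _ _)
    ∙ ⨾-cong (≋-sym (N₂-whisker A B (X ++ Z)) ∙ ▸-++ X Z (N₂ A B))
        (⊗-cong ≋-refl (p ∙ ⊗-cong q ≋-refl) ∙ ≋-sym (⊗-assoc _ _ _))
    ∙ ≋-sym (▸-⨾ Z)
    ∙ ⊗-cong (⨾-cong ≋-refl (◂-⨾ P)
        ∙ push (⨾-cong ≋-refl (≋-sym (◂-++ P (° (A ⊗₀ B)) g)) ∙ exchange (N₂ A B) g ∙ ⨾-cong (⊗-identityˡ g) ≋-refl)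
            (snake₂ A B)
        ∙ ⨾-identityʳ g) ≋-refl
    where
    P = (A , ●) ∷ (B , ●) ∷ []

  ◁-σ : ∀ A B → ◁ ○ A B ⨾ σ ○ A B ≋ dec A B
  ◁-σ A B = ⨾-cong ≋-refl (≋-sym (°-σ A B)) ∙ cancel (◁⨾▷ ○ A B) ≋-refl

  dec-σ : ∀ A B → dec B A ⨾ σ ○ A B ≋ 𝔸.σ B A ⟨°⟩ ⨾ dec A B
  dec-σ A B = ⨾-assoc _ _ _ ∙ ⨾-cong ≋-refl (◁-σ A B)

  E₂-σ : ∀ A B → E₂ A B ≋ (◁ ○ A B ⊗ 1[ (A , ●) ∷ (B , ●) ∷ [] ]) ⨾ (σ ○ A B ⊗ 1[ (A , ●) ∷ (B , ●) ∷ [] ]) ⨾ E B A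
  E₂-σ A B = split (⊗-cong (≋-sym (◁-σ A B)) ≋-refl ∙ ▸-⨾ ((A , ●) ∷ (B , ●) ∷ [])) ≋-refl

  E₂-▷● : ∀ A B → E₂ A B ≋ (1[ ° (A ⊗₀ B) ] ⊗ ▷ ● A B) ⨾ ε (A ⊗₀ B)
  E₂-▷● A B = E₂-σ A B ∙ ≋-sym (▷●-ε A B)

  E₂-◁● : ∀ A B → ε (A ⊗₀ B) ≋ (1[ ° (A ⊗₀ B) ] ⊗ ◁ ● A B) ⨾ E₂ A B
  E₂-◁● A B = ≋-sym
    (⨾-cong ≋-refl (E₂-▷● A B) ∙ cancel (≋-sym (◂-⨾ _) ∙ ⊗-cong ≋-refl (◁⨾▷ ● A B) ∙ ⊗-id _ _) ≋-refl)

  E₂-σ● : ∀ A B → (𝔸.σ B A ⟨°⟩ ⊗ 1[ (A , ●) ∷ (B , ●) ∷ [] ]) ⨾ E₂ A B ≋ (1[ ° (B ⊗₀ A) ] ⊗ σ ● A B) ⨾ E₂ B A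
  E₂-σ● A B = merge (≋-sym (▸-⨾ _) ∙ ⊗-cong (≋-sym (dec-σ A B)) ≋-refl ∙ ▸-⨾ _) ≋-refl
    ∙ ⨾-assoc _ _ _ ∙ ⨾-cong ≋-refl (E-σ A B) ∙ push (exchange (dec B A) (σ ● A B)) ≋-refl

  ▷●-unit : ▷ ● unit unit ≋ κ ● ⊗ 1[ [ unit , ● ] ]
  ▷●-unit = ≋-sym (absorbˡ (≋-sym (▸-⨾ _) ∙ ▸id _ (κ⨾ι ●)) ) ∙ ⨾-assoc _ _ _ ∙ absorbʳ (ι-▷ˡ ● unit)

  ε-cong : ∀ {A B} → A ≡ B → ε A ≋ ε B
  ε-cong refl = ≋-refl

  ι-ε : (ι ○ ⊗ 1[ [ unit , ● ] ]) ⨾ ε unit ≋ κ ●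
  ι-ε = ≋-sym (⨾-identityʳ u) ∙ ⨾-cong ≋-refl (≋-sym (ι⨾κ ●)) ∙ ≋-sym (⨾-assoc _ _ _) ∙ absorbˡ u⨾ι
    where
    I● = [ unit , ● ]
    u = (ι ○ ⊗ 1[ I● ]) ⨾ ε unit

    κ-ε : (1[ ° unit ] ⊗ (κ ● ⊗ 1[ I● ])) ⨾ ε unit ≋ (ε unit ⊗ 1[ I● ]) ⨾ u
    κ-ε = ≋-sym
      (≋-sym (⨾-cong (⊗-cong dec-unit ≋-refl ∙ ⊗-assoc _ _ _ ∙ ⊗-cong ≋-refl (⊗-id _ _)) ≋-refl
          ∙ push (exchange (ι ○) (ε unit ⊗ 1[ I● ]) ∙ ⨾-cong (⊗-identityˡ _) ≋-refl) ≋-refl)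
        ∙ E₂-▷● unit unit
        ∙ ⨾-cong (⊗-cong (1-cong (cong (λ A →
              [ A , ○ ]) (𝔸.⊗₀-identityˡ unit))) ▷●-unit) (ε-cong (𝔸.⊗₀-identityˡ unit)))

    κ⊗1≋1⊗u : κ ● ⊗ 1[ I● ] ≋ 1[ I● ] ⊗ u
    κ⊗1≋1⊗u = ≋-sym (mate (κ ● ⊗ 1[ I● ]))
      ∙ ⨾-cong ≋-refl (⊗-cong ≋-refl κ-ε ∙ ◂-⨾ I●)
      ∙ cancel (⨾-cong (▸-++ I● I● (η unit)) (≋-sym (⊗-assoc _ _ _)) ∙ ≋-sym (▸-⨾ I●) ∙ ▸id I● (snake• unit)) ≋-refl

    u⨾ι : u ⨾ ι ● ≋ 1[ I● ]
    u⨾ι = ⨾-cong (≋-sym (⊗-identityˡ u)) (≋-sym (⊗-identityʳ (ι ●))) ∙ ≋-sym (exchange (ι ●) u)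
      ∙ ⨾-cong ≋-refl (≋-sym κ⊗1≋1⊗u) ∙ ≋-sym (▸-⨾ I●) ∙ ▸id I● (ι⨾κ ●)

  ι●-ε : κ ○ ≋ (1[ ° unit ] ⊗ ι ●) ⨾ ε unit
  ι●-ε = ≋-sym (⨾-cong ≋-refl ε≋κ⊗κ ∙ push (≋-sym (exchange (κ ○) (ι ●))
        ∙ ⨾-cong (⊗-identityʳ _) (⊗-identityˡ _)) (ι⨾κ ●)
    ∙ ⨾-identityʳ _)
    where
    ε≋κ⊗κ : ε unit ≋ (κ ○ ⊗ 1[ [ unit , ● ] ]) ⨾ κ ●
    ε≋κ⊗κ = ≋-sym (⨾-cong ≋-refl (≋-sym ι-ε) ∙ cancel (≋-sym (▸-⨾ _) ∙ ▸id _ (κ⨾ι ○)) ≋-refl)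

  capped-⌜⌝ : ∀ {A B X} (f : Hom A B) (α : Cell B unit X []) Z {w : Term ((B , ○) ∷ X) []} →
              capped α Z ≋ w ⊗ 1[ Z ] → capped (⌜ f ⌝ / α) Z ≋ ((f ⟨°⟩ ⊗ 1[ X ]) ⨾ w) ⊗ 1[ Z ]
  capped-⌜⌝ {X = X} f α Z p = capped-/ ⌜ f ⌝ α Z
    ∙ ⨾-cong (▸-++ X Z _) (⊗-identityˡ _ ∙ p) ∙ ≋-sym (▸-⨾ Z)

  capped-S•₂ : ∀ A B Z → capped ((s• A ˢ∣ B) / s• B) Z ≋ E₂ A B ⊗ 1[ Z ]
  capped-S•₂ A B Z = capped-/ (s• A ˢ∣ B) (s• B) Z
    ∙ ⨾-cong (bend-ˢ∣ A B ((B , ●) ∷ Z)) (⊗-identityˡ _ ∙ capped-s• B Z) ∙ ⨾-assoc _ _ _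
    ∙ ≋-sym (▸-⨾ Z ∙ ⨾-cong (≋-sym (▸-++ ((A , ●) ∷ (B , ●) ∷ []) Z _))
        (▸-⨾ Z ∙ ⨾-cong (⊗-assoc _ _ _ ∙ ⊗-cong ≋-refl (≋-sym (▸-++ [ B , ● ] Z _))) ≋-refl))

  capped-⌜⌝° : ∀ {A B X Y} (f : Hom A B) (α : Cell B unit X Y) Z →
               capped (⌜ f ⌝ / α) Z ≋ (f ⟨°⟩ ⊗ 1[ X ++ Z ]) ⨾ capped α Z
  capped-⌜⌝° f α Z = capped-/ ⌜ f ⌝ α Z ∙ ⨾-cong ≋-refl (⊗-identityˡ _)

  capped-S°₂ : ∀ A B Z → capped ((B ∣ˢ s° A) / s° B) Z ≋ dec B A ⊗ 1[ Z ]
  capped-S°₂ A B Z = capped-/ (B ∣ˢ s° A) (s° B) Z ∙ ⨾-cong (bend-∣ˢ A B Z) ≋-refl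
    ∙ absorbʳ (⊗-cong ≋-refl (capped-s° B Z) ∙ ⊗-id _ _)

  flatten-R°₂ : ∀ {A B X Y} (α : Cell (B ⊗₀ A) unit X Y) Z →
                flatten (r° A / (r° B ʳ∣ A) / α) Z ≋ (mul B A ⊗ 1[ X ++ Z ]) ⨾ capped α Z
  flatten-R°₂ {A} {B} {X} α Z = flatten-r° ((r° B ʳ∣ A) / α) Z ∙ capped-/ (r° B ʳ∣ A) α Z
    ∙ ⨾-cong (bend-ʳ∣ A B (X ++ Z)) (⊗-identityˡ _)

  flatten-M₁ : ∀ {X Y} (f : Term X Y) Z → flatten (M₁ f) Z ≋ f ⊗ 1[ Z ]
  flatten-M₁ (id {X}) Z =
    ⨾-cong ≋-refl (⨾-assoc _ _ _ ∙ absorbʳ (◂▸-⨾ X Z ∙ ◂id▸ X Z (ι⨾κ ○))) ∙ ≋-sym (▸-⨾ _) ∙ ▸id _ (ι⨾κ ○)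
          ∙ ≋-sym (⊗-id X Z)
  flatten-M₁ (f ⨾ g) Z = flatten-∣ (M₁ f) (M₁ g) Z ∙ ⨾-cong (flatten-M₁ f Z) (flatten-M₁ g Z) ∙ ≋-sym (▸-⨾ Z)
  flatten-M₁ (_⊗_ {X} {X′} {Y} {Y′} f g) Z = flatten-/ (M₁ f) (M₁ g) Z
    ∙ ⨾-cong (flatten-M₁ f (Y ++ Z)) (⊗-cong ≋-refl (flatten-M₁ g Z))
    ∙ ≋-sym (⊗-⨾ _ _ _ _) ∙ ⊗-cong (⨾-identityʳ f) (⨾-identityˡ _) ∙ ≋-sym (⊗-assoc _ _ _)
  flatten-M₁ (_⟨°⟩ {A} {B} f) Z = flatten-r° (⌜ f ⌝ / s° B) Z ∙ capped-⌜⌝° f (s° B) Z ∙ absorbʳ (capped-s° B Z)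
  flatten-M₁ (_⟨•⟩ {A} {B} f) Z = flatten-R• (⌜ f ⌝ / s• B) Z (capped-⌜⌝ f (s• B) Z (capped-s• B Z)) (ε-natural f)
  flatten-M₁ (◁ ○ A B) Z = flatten-r° (⌜ 𝔸.σ A B ⌝ / (B ∣ˢ s° A) / s° B) Z
    ∙ capped-⌜⌝° (𝔸.σ A B) ((B ∣ˢ s° A) / s° B) Z ∙ ⨾-cong ≋-refl (capped-S°₂ A B Z)
    ∙ ≋-sym (▸-⨾ Z) ∙ ⊗-cong (cancel (σ°σ° A B) ≋-refl) ≋-refl
  flatten-M₁ (◁ ● A B) Z = flatten-R•₂ (s• (A ⊗₀ B)) Z (capped-s• _ Z) (E₂-◁● A B)
  flatten-M₁ (▷ ○ A B) Z = flatten-R°₂ (⌜ 𝔸.σ B A ⌝ / s° (A ⊗₀ B)) Z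
    ∙ ⨾-cong ≋-refl (capped-⌜⌝° (𝔸.σ B A) (s° (A ⊗₀ B)) Z ∙ absorbʳ (capped-s° _ Z))
    ∙ ≋-sym (▸-⨾ Z) ∙ ⊗-cong (⨾-assoc _ _ _ ∙ absorbʳ (σ°σ° A B)) ≋-refl
  flatten-M₁ (▷ ● A B) Z = flatten-R• ((s• A ˢ∣ B) / s• B) Z (capped-S•₂ A B Z) (E₂-▷● A B)
  flatten-M₁ (ι ○) Z = absorbʳ (capped-s° unit Z)
  flatten-M₁ (ι ●) Z = flatten-resp (C.≋-sym (C./-identityʳ (r• unit))) Z
    ∙ flatten-R• (idᴴ unit) Z (⨾-identityˡ _ ∙ ⊗-identityˡ _) ι●-ε
  flatten-M₁ (κ ○) Z = cancel (≋-sym (▸-⨾ _) ∙ ▸id _ (ι⨾κ ○)) (⊗-identityˡ _)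
  flatten-M₁ (κ ●) Z = ⨾-cong (▸-++ [ unit , ● ] Z _) (capped-s• unit Z) ∙ ≋-sym (▸-⨾ Z) ∙ ⊗-cong ι-ε ≋-refl
  flatten-M₁ (σ ○ A B) Z = flatten-R°₂ (⌜ 𝔸.σ B A ⌝ / (A ∣ˢ s° B) / s° A) Z
    ∙ ⨾-cong ≋-refl (capped-⌜⌝° (𝔸.σ B A) ((A ∣ˢ s° B) / s° A) Z ∙ ⨾-cong ≋-refl (capped-S°₂ B A Z) ∙ ≋-sym (▸-⨾ Z))
    ∙ ≋-sym (▸-⨾ Z)
    ∙ ⊗-cong (⨾-assoc _ _ _ ∙ ⨾-cong ≋-refl (cancel (σ°σ° A B) ≋-refl) ∙ °-σ A B) ≋-refl
  flatten-M₁ (σ ● A B) Z = flatten-R•₂ (⌜ 𝔸.σ B A ⌝ / (s• A ˢ∣ B) / s• B) Z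
    (capped-⌜⌝ (𝔸.σ B A) ((s• A ˢ∣ B) / s• B) Z (capped-S•₂ A B Z)) (E₂-σ● A B)
  flatten-M₁ (η A) Z = flatten-r• (s° A) Z ∙ absorbʳ (⊗-cong ≋-refl (capped-s° A Z) ∙ ⊗-id _ _)
  flatten-M₁ (ε A) Z = flatten-r° (s• A) Z ∙ capped-s• A Z

  M₁-injective : ∀ {X Y} {f g : Term X Y} → M₁ f C.≋ M₁ g → f ≋ g
  M₁-injective {f = f} {g} p = ≋-sym (⊗-identityʳ f) ∙ ≋-sym (flatten-M₁ f [])
    ∙ flatten-resp p [] ∙ flatten-M₁ g [] ∙ ⊗-identityʳ g

proposition7p1 : ∀ {o ℓ e} (𝔸 : SymmetricStrictMonoidalCategory o ℓ e) →
    Σ[ M₁-cong ∈ Functor.M-WellDefined 𝔸 ]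
    (let M = Functor.M 𝔸 M₁-cong in
    Full M × Faithful M × (∀ X → StrictMonoidalFunctor.F₀ M X ≡ X))
proposition7p1 𝔸 =
  Soundness.M₁-resp 𝔸 (Crossing./-idⱽ-comm 𝔸) ,
  Fullness.M₁-surjective 𝔸 ,
  Faithfulness.M₁-injective 𝔸 ,
  λ _ → refl
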